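{- Let $f\in\mathbf{k}[x_1,\dots,x_n]$ with $\deg f=n-1$. Expand $\rho_n(f):=f(u_1,u_2-u_1,\dots,u_{n-1}-u_{n-2},-u_{n-1})\in\mathcal{K}_n$ in the basis of squarefree monomials $\{u_I=\prod_{i\in I}u_i: I\subseteq\{1,\dots,n-1\}\}$ of $\mathcal{K}_n$, and let $\mathrm{Top}_n(f)$ be the coefficient of $u_1u_2\cdots u_{n-1}$. Then $$\langle f\rangle_n^q=[n-1]_q!\cdot\mathrm{Top}_n(f).$$
   Context: $\mathbf{k}$ is a field of characteristic zero and $q\in\mathbf{k}$ is not a nontrivial root of unity; $[n]_q=1+q+\dots+q^{n-1}$, $[n]_q!=\prod_{i=1}^n[i]_q$. $\mathcal{K}_n$ is the commutative $\mathbf{k}$-algebra generated by $u_1,\dots,u_{n-1}$ subject to $(q+1)u_i^2=qu_iu_{i-1}+u_iu_{i+1}$ for $1\le i\le n-1$, with $u_0=u_n=0$; the squarefree monomials $u_I$ form a $\mathbf{k}$-basis of $\mathcal{K}_n$. $q$-divided symmetrization: $\langle f\rangle_n^q:=\partial_{w_0}\big(f\cdot\prod_{1\le i,\ i+2\le j\le n}(qx_i-x_j)\big)$, where $\partial_{w_0}g=\big(\sum_{w\in S_n}\mathrm{sgn}(w)\,g(x_{w(1)},\dots,x_{w(n)})\big)/\prod_{1\le i<j\le n}(x_i-x_j)$. -}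

module Defs where

open import Level using (_⊔_)
open import Algebra.Bundles using (CommutativeRing)
open import Data.Nat as ℕ using (ℕ; zero; suc; _<_; _≤_; _<?_; _≤?_)
open import Data.Fin as Fin using (Fin; toℕ; fromℕ<)
open import Data.Vec as Vec using (Vec; []; _∷_; allFin; lookup; replicate; zipWith)
open import Data.Vec.Properties using (≡-dec)
open import Data.Vec.Relation.Unary.All as VAll using ()
open import Data.List as List using (List; []; _∷_; _++_; map; concatMap; foldr; filter)
open import Data.Product using (Σ; Σ-syntax; ∃; _×_; _,_; proj₁; proj₂)
open import Data.Sum using (_⊎_)
open import Relation.Nullary using (¬_; yes; no)
open import Relation.Binary.PropositionalEquality using (_≡_)

module PolyOps {c ℓ} (R : CommutativeRing c ℓ) where
  open CommutativeRing R renaming (Carrier to K)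

  IsField : Set (c ⊔ ℓ)
  IsField = (¬ (1# ≈ 0#)) × (∀ x → ¬ (x ≈ 0#) → Σ[ y ∈ K ] (x * y ≈ 1#))

  natC : ℕ → K
  natC zero = 0#
  natC (suc n) = 1# + natC n

  CharZero : Set ℓ
  CharZero = ∀ n → ¬ (natC (suc n) ≈ 0#)

  powC : K → ℕ → K
  powC x zero = 1#
  powC x (suc k) = x * powC x k

  NotNontrivialRootOfUnity : K → Set ℓ
  NotNontrivialRootOfUnity q = ∀ m → powC q (suc m) ≈ 1# → q ≈ 1#

  qint : K → ℕ → K
  qint q zero = 0#
  qint q (suc k) = qint q k + powC q k

  qfact : K → ℕ → K
  qfact q zero = 1#
  qfact q (suc k) = qfact q k * qint q (suc k)

  -- Polynomials in N variables (variable i : Fin N), given as finite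
  -- formal sums of terms  c · x^α  (α an exponent vector).
  -- Equality is equality of all coefficients.
  Poly : ℕ → Set c
  Poly N = List (K × Vec ℕ N)

  coeff : ∀ {N} → Poly N → Vec ℕ N → K
  coeff [] α = 0#
  coeff ((a , β) ∷ p) α with ≡-dec ℕ._≟_ β α
  ... | yes _ = a + coeff p α
  ... | no _  = coeff p α

  _≈ₚ_ : ∀ {N} → Poly N → Poly N → Set ℓ
  p ≈ₚ p′ = ∀ α → coeff p α ≈ coeff p′ α

  constP : ∀ {N} → K → Poly N
  constP a = (a , replicate _ 0) ∷ []

  zeroP : ∀ {N} → Poly N
  zeroP = []

  oneP : ∀ {N} → Poly N
  oneP = constP 1#

  unitVec : ∀ {N} → Fin N → Vec ℕ N
  unitVec Fin.zero = 1 ∷ replicate _ 0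
  unitVec (Fin.suc i) = 0 ∷ unitVec i

  varP : ∀ {N} → Fin N → Poly N
  varP i = (1# , unitVec i) ∷ []

  _+ₚ_ : ∀ {N} → Poly N → Poly N → Poly N
  p +ₚ p′ = p ++ p′

  scaleP : ∀ {N} → K → Poly N → Poly N
  scaleP a = map (λ t → (a * proj₁ t , proj₂ t))

  -ₚ_ : ∀ {N} → Poly N → Poly N
  -ₚ p = map (λ t → (- proj₁ t , proj₂ t)) p

  _-ₚ_ : ∀ {N} → Poly N → Poly N → Poly N
  p -ₚ p′ = p +ₚ (-ₚ p′)

  _*ₚ_ : ∀ {N} → Poly N → Poly N → Poly N
  p *ₚ p′ = concatMap (λ t → map (λ s → (proj₁ t * proj₁ s , zipWith ℕ._+_ (proj₂ t) (proj₂ s))) p′) p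

  powP : ∀ {N} → Poly N → ℕ → Poly N
  powP p zero = oneP
  powP p (suc k) = p *ₚ powP p k

  sumP : ∀ {N} → List (Poly N) → Poly N
  sumP = foldr _+ₚ_ zeroP

  prodP : ∀ {N} → List (Poly N) → Poly N
  prodP = foldr _*ₚ_ oneP

  substP : ∀ {N M} → (Fin N → Poly M) → Poly N → Poly M
  substP {N} σ p = sumP (map (λ t → scaleP (proj₁ t)
                       (prodP (Vec.toList (Vec.map (λ i → powP (σ i) (lookup (proj₂ t) i)) (allFin N))))) p)

  HasDegree : ∀ {N} → Poly N → ℕ → Set ℓ
  HasDegree f d = (∀ α → d < Vec.sum α → coeff f α ≈ 0#)
                × (Σ[ α ∈ Vec ℕ _ ] (Vec.sum α ≡ d × ¬ (coeff f α ≈ 0#)))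

  insertAll : ∀ {A : Set} {k} → A → Vec A k → List (Vec A (suc k))
  insertAll x [] = (x ∷ []) ∷ []
  insertAll x (y ∷ ys) = (x ∷ y ∷ ys) ∷ map (y ∷_) (insertAll x ys)

  perms : ∀ {A : Set} {k} → Vec A k → List (Vec A k)
  perms [] = [] ∷ []
  perms (x ∷ xs) = concatMap (insertAll x) (perms xs)

  -- all permutations w of {1..n}, w stored as (w(1),...,w(n))
  allPerms : (n : ℕ) → List (Vec (Fin n) n)
  allPerms n = perms (allFin n)

  allPairs : (n : ℕ) → List (Fin n × Fin n)
  allPairs n = concatMap (λ i → map (λ j → (i , j)) (Vec.toList (allFin n))) (Vec.toList (allFin n))

  ltPairs : (n : ℕ) → List (Fin n × Fin n)
  ltPairs n = filter (λ p → suc (toℕ (proj₁ p)) ≤? toℕ (proj₂ p)) (allPairs n)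

  gapPairs : (n : ℕ) → List (Fin n × Fin n)
  gapPairs n = filter (λ p → suc (suc (toℕ (proj₁ p))) ≤? toℕ (proj₂ p)) (allPairs n)

  inversions : ∀ {n} → Vec (Fin n) n → ℕ
  inversions {n} w = List.length
    (filter (λ p → suc (toℕ (lookup w (proj₂ p))) ≤? toℕ (lookup w (proj₁ p))) (ltPairs n))

  signC : ℕ → K
  signC zero = 1#
  signC (suc k) = - signC k

  antisym : ∀ {n} → Poly n → Poly n
  antisym {n} g = sumP (map (λ w → scaleP (signC (inversions w)) (substP (λ i → varP (lookup w i)) g)) (allPerms n))

  vandermonde : (n : ℕ) → Poly n
  vandermonde n = prodP (map (λ p → varP (proj₁ p) -ₚ varP (proj₂ p)) (ltPairs n))

  qFactor : (n : ℕ) → K → Poly n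
  qFactor n q = prodP (map (λ p → scaleP q (varP (proj₁ p)) -ₚ varP (proj₂ p)) (gapPairs n))

  -- ⟨f⟩^q_n = h, i.e. ∂_{w0}(f · qFactor) = h; since ∂_{w0} g is the
  -- (exact) quotient of antisym g by the Vandermonde, this means
  -- antisym (f · qFactor) = h · Vandermonde.
  DividedSymm : (n : ℕ) → K → Poly n → Poly n → Set ℓ
  DividedSymm n q f h = antisym (f *ₚ qFactor n q) ≈ₚ (h *ₚ vandermonde n)

  -- The algebra K_n, n = suc m, with generators u_1..u_m (as Fin m)
  -- u_i for i : ℕ, with u_0 = u_n = 0
  uN : (m : ℕ) → ℕ → Poly m
  uN m zero = zeroP
  uN m (suc i) with i <? m
  ... | yes p = varP (fromℕ< p)
  ... | no _  = zeroP

  -- ρ_n : x_j ↦ u_j - u_{j-1}   (x_{j+1} is variable j : Fin (suc m))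
  rho : (m : ℕ) → Poly (suc m) → Poly m
  rho m = substP (λ j → uN m (suc (toℕ j)) -ₚ uN m (toℕ j))

  -- relation (q+1) u_i^2 - q u_i u_{i-1} - u_i u_{i+1},  i = 1..m  (i : Fin m is u_{i+1})
  relK : (m : ℕ) → K → Fin m → Poly m
  relK m q i = ((scaleP (q + 1#) (ui *ₚ ui) -ₚ scaleP q (ui *ₚ uN m (toℕ i)))
                 -ₚ (ui *ₚ uN m (suc (suc (toℕ i)))))
    where ui = varP i

  InIdeal : (m : ℕ) → K → Poly m → Set (c ⊔ ℓ)
  InIdeal m q g = Σ[ a ∈ (Fin m → Poly m) ]
    (g ≈ₚ sumP (Vec.toList (Vec.map (λ i → a i *ₚ relK m q i) (allFin m))))

  SquareFree : ∀ {m} → Vec ℕ m → Set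
  SquareFree α = VAll.All (_≤ 1) α

  fullMono : (m : ℕ) → Vec ℕ m
  fullMono m = replicate m 1

  -- Top_n(f) = t : in K_n, ρ_n(f) = t · u_1⋯u_m + Σ_{I ≠ [m]} c_I u_I
  IsTop : (m : ℕ) → K → Poly (suc m) → K → Set (c ⊔ ℓ)
  IsTop m q f t = Σ[ g ∈ Poly m ]
    ((∀ α → (¬ SquareFree α ⊎ α ≡ fullMono m) → coeff g α ≈ 0#)
    × InIdeal m q (rho m f -ₚ (((t , fullMono m) ∷ []) +ₚ g)))

{-# OPTIONS --safe #-}
-- A function φ on exponent vectors defines a linear functional on polynomials, and the coefficients of the
-- antisymmetrisation of g are values φ(g) with φ alternating. An alternating φ on ℕⁿ vanishes in degrees below n(n−1)/2
-- and is determined in that degree by its value at (n−1, …, 1, 0). Both sides of the claim, as functions of the exponent,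
-- are alternating, so it suffices to compare the coefficients at (n−1, …, 1, 0).
--
-- Let φ be alternating and concentrated in degree n(n−1)/2, and let Q be the q-factor. The polynomials p with φ(g p Q) = 0
-- for all g form an ideal. With u_k = x₁ + ⋯ + x_k, it contains u_n, and also u_k (q x_k − x_{k+1}): times Q, this is a
-- polynomial symmetric under S_k × S_{n−k} times the q-factors of the two blocks of variables, and for degree reasons one
-- block is too small. These are the relations of K_n, so modulo the ideal f is ρ(f) read in the u_k, the squarefree
-- monomials of degree < n−1 do not contribute, and u_1 ⋯ u_{n−1} = [n−1]_q! x₁^{n−1}. Finally φ(x₁^{n−1} Q) is the value of
-- φ at (n−1, …, 1, 0).
--
-- The squarefree monomials span K_n because for i ∈ I the products y_j = u_I u_j satisfy (q+1) y_j = q y_{j−1} + y_{j+1}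
-- along the interval of I around i. Solving this recurrence, which divides by a nonzero [k]_q, expresses y_i by the two
-- end values, and these are squarefree or zero.
module Submission where

open import Defs
open import Level using (_⊔_)
open import Algebra.Bundles using (CommutativeMonoid; CommutativeRing; RawRing)
import Algebra.Properties.CommutativeMonoid.Sum as FiniteSum
import Algebra.Properties.CommutativeSemigroup as CommutativeSemigroup
import Algebra.Properties.Ring as RingProperties
import Algebra.Solver.Ring as RingSolver
open import Algebra.Solver.Ring.AlmostCommutativeRing using (fromCommutativeRing; _-Raw-AlmostCommutative⟶_)
import Algebra.Solver.Ring.NaturalCoefficients.Default as SemiringSolver
open import Data.Bool using (Bool; true; false; if_then_else_)
open import Data.Fin as Fin using (Fin; toℕ)
import Data.Fin.Properties as Fin
open import Data.List as List using (List; []; _∷_; _++_)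
import Data.List.Properties as List
open import Data.List.Relation.Unary.All as LAll using ([]; _∷_)
import Data.List.Relation.Unary.All.Properties as LAll
open import Data.Maybe using (Maybe; just; nothing)
open import Data.Nat as ℕ using (ℕ; zero; suc; z≤n; s≤s)
import Data.Nat.Properties as ℕ
import Data.Nat.Tactic.RingSolver as ℕSolver
open import Data.Product using (Σ-syntax; _×_; _,_; proj₁; proj₂)
open import Data.Sum using (_⊎_; inj₁; inj₂)
open import Data.Vec as Vec using (Vec; []; _∷_; lookup; replicate; zipWith)
import Data.Vec.Properties as Vec
open import Data.Vec.Relation.Unary.All as VAll using ([]; _∷_)
open import Function using (_∘_; _$_)
open import Relation.Nullary using (¬_; does; yes; no; contradiction)
open import Relation.Nullary.Decidable using (dec-true; dec-false; ¬?; _×-dec_)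
open import Relation.Unary using (Pred; Decidable)
open import Relation.Binary.Definitions using (tri<; tri≈; tri>)
open import Relation.Binary.PropositionalEquality as ≡ using (_≡_)
import Relation.Binary.Reasoning.Setoid as SetoidReasoning

open FiniteSum ℕ.+-0-commutativeMonoid using () renaming (sum to ∑)
open CommutativeSemigroup ℕ.+-commutativeSemigroup using (interchange; x∙yz≈y∙xz)

-- `DividedSymm` clears the Vandermonde denominator, so the claim compares coefficients of two
-- polynomials.
--
-- The obstacle is that Q, lacking the factors of adjacent pairs, has no symmetry to exploit.
-- Between the first k variables and the other n-k, only the factor q x_k - x_{k+1} is absent, and
-- in terms of the u's this factor is (q+1) u_k - q u_{k-1} - u_{k+1}, the bracket in the relation
-- for u_k. Multiplying by it completes the rectangle of k(n-k) factors, which is symmetric in each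
-- block. The other factor u_k of the relation tips the degree: k(n-k) and the minimal degrees
-- k(k-1)/2 and (n-k)(n-k-1)/2 of the two blocks add up to exactly n(n-1)/2, so one degree more in
-- the symmetric part leaves too little for the blocks.
--
-- The q-factorial arises one factor at a time: multiplying u_1...u_k by u_0, u_1, u_2, ... gives a
-- solution of the recurrence that starts at 0, and its value at k+1 is [k+1]_q times its value at
-- 1.
--
-- The top coefficient is encoded as a relation between f and t. Hence the two halves of the result:
-- some t exists, by spanning, and every such t gives the stated value, by the ideal.

-- Ring identities with integer constants

module IntegerRingSolver {c ℓ} (B : CommutativeRing c ℓ) where
  open CommutativeRing B
  open RingProperties ring
  open SetoidReasoning setoid
  private
    module S = SemiringSolver commutativeSemiring
    nat = PolyOps.natC B

  -- (a , b) stands for the integer a − b.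
  Coefficients : RawRing _ _
  Coefficients = record
    { Carrier = ℕ × ℕ
    ; _≈_ = _≡_
    ; _+_ = λ (a , b) (a′ , b′) → (a ℕ.+ a′ , b ℕ.+ b′)
    ; _*_ = λ (a , b) (a′ , b′) → (a ℕ.* a′ ℕ.+ b ℕ.* b′ , a ℕ.* b′ ℕ.+ b ℕ.* a′)
    ; -_ = λ (a , b) → (b , a)
    ; 0# = (0 , 0)
    ; 1# = (1 , 0)
    }

  private
    module C = RawRing Coefficients

    difference : ℕ × ℕ → Carrier
    difference (a , b) = nat a - nat b

    -- Under `difference` alone the pair (1 , 0) would not reduce to 1#. The two special cases make
    -- `con (0 , 0)` and `con (1 , 0)` denote 0# and 1# literally, so that solved equations match
    -- the goals as written.
    ⟦_⟧ : ℕ × ℕ → Carrier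
    ⟦ 0 , 0 ⟧ = 0#
    ⟦ 1 , 0 ⟧ = 1#
    ⟦ x ⟧ = difference x

    -0≈0 : - 0# ≈ 0#
    -0≈0 = trans (sym (+-identityˡ _)) (-‿inverseʳ 0#)

    ⟦⟧≈ : ∀ x → ⟦ x ⟧ ≈ difference x
    ⟦⟧≈ (0 , 0) = sym (-‿inverseʳ 0#)
    ⟦⟧≈ (1 , 0) = sym (trans (+-cong (+-identityʳ 1#) -0≈0) (+-identityʳ 1#))
    ⟦⟧≈ (0 , suc b) = refl
    ⟦⟧≈ (1 , suc b) = refl
    ⟦⟧≈ (suc (suc a) , b) = refl

    nat-+ : ∀ a b → nat (a ℕ.+ b) ≈ nat a + nat b
    nat-+ zero b = sym (+-identityˡ _)
    nat-+ (suc a) b = trans (+-congˡ (nat-+ a b)) (sym (+-assoc _ _ _))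

    nat-* : ∀ a b → nat (a ℕ.* b) ≈ nat a * nat b
    nat-* zero b = sym (zeroˡ _)
    nat-* (suc a) b = begin
      nat (b ℕ.+ a ℕ.* b) ≈⟨ nat-+ b (a ℕ.* b) ⟩
      nat b + nat (a ℕ.* b) ≈⟨ +-cong (sym (*-identityˡ _)) (nat-* a b) ⟩
      1# * nat b + nat a * nat b ≈⟨ sym (distribʳ _ _ _) ⟩
      (1# + nat a) * nat b ∎

    +-interchange : ∀ w x y z → (w + x) + (y + z) ≈ (w + y) + (x + z)
    +-interchange = S.solve 4 (λ w x y z → (w S.:+ x) S.:+ (y S.:+ z) S.:= (w S.:+ y) S.:+ (x S.:+ z)) refl

    difference-cancel : ∀ {a b a′ b′} → a + b′ ≈ a′ + b → a - b ≈ a′ - b′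
    difference-cancel {a} {b} {a′} {b′} eq = begin
      a - b ≈⟨ sym (+-identityʳ _) ⟩
      (a - b) + 0# ≈⟨ +-congˡ (sym (-‿inverseʳ b′)) ⟩
      (a + - b) + (b′ + - b′) ≈⟨ +-interchange a (- b) b′ (- b′) ⟩
      (a + b′) + (- b + - b′) ≈⟨ +-congʳ eq ⟩
      (a′ + b) + (- b + - b′) ≈⟨ rearrange a′ b (- b) (- b′) ⟩
      (a′ - b′) + (b - b) ≈⟨ +-congˡ (-‿inverseʳ b) ⟩
      (a′ - b′) + 0# ≈⟨ +-identityʳ _ ⟩
      a′ - b′ ∎
      where
      rearrange : ∀ w x y z → (w + x) + (y + z) ≈ (w + z) + (x + y)
      rearrange = S.solve 4 (λ w x y z → (w S.:+ x) S.:+ (y S.:+ z) S.:= (w S.:+ z) S.:+ (x S.:+ y)) refl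

    +-homo : ∀ x y → difference (x C.+ y) ≈ difference x + difference y
    +-homo (a , b) (a′ , b′) = begin
      nat (a ℕ.+ a′) - nat (b ℕ.+ b′) ≈⟨ +-cong (nat-+ a a′) (-‿cong (nat-+ b b′)) ⟩
      (nat a + nat a′) - (nat b + nat b′) ≈⟨ +-congˡ (sym (-‿+-comm _ _)) ⟩
      (nat a + nat a′) + (- nat b + - nat b′) ≈⟨ +-interchange _ _ _ _ ⟩
      (nat a - nat b) + (nat a′ - nat b′) ∎

    neg-homo : ∀ x → difference (C.- x) ≈ - difference x
    neg-homo (a , b) = sym (trans (sym (-‿+-comm _ _)) (trans (+-congˡ (-‿involutive _)) (+-comm _ _)))

    *-homo : ∀ x y → difference (x C.* y) ≈ difference x * difference y
    *-homo (a , b) (a′ , b′) = begin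
      nat (a ℕ.* a′ ℕ.+ b ℕ.* b′) - nat (a ℕ.* b′ ℕ.+ b ℕ.* a′)
        ≈⟨ +-cong (trans (nat-+ (a ℕ.* a′) _) (+-cong (nat-* a a′) (nat-* b b′)))
                  (-‿cong (trans (nat-+ (a ℕ.* b′) _) (+-cong (nat-* a b′) (nat-* b a′)))) ⟩
      (A * A′ + B₁ * B′) - (A * B′ + B₁ * A′)
        ≈⟨ +-cong (+-congˡ (sym (trans (sym (-‿distribˡ-* _ _)) (trans (-‿cong (sym (-‿distribʳ-* _ _))) (-‿involutive _)))))
                  (sym (-‿+-comm _ _)) ⟩
      (A * A′ + (- B₁) * (- B′)) + (- (A * B′) + - (B₁ * A′))
        ≈⟨ +-congˡ (+-cong (-‿distribʳ-* _ _) (-‿distribˡ-* _ _)) ⟩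
      (A * A′ + (- B₁) * (- B′)) + (A * - B′ + (- B₁) * A′)
        ≈⟨ S.solve 4 (λ x y z w → (x S.:* z S.:+ y S.:* w) S.:+ (x S.:* w S.:+ y S.:* z) S.:= (x S.:+ y) S.:* (z S.:+ w)) refl A (- B₁) A′ (- B′) ⟩
      (A - B₁) * (A′ - B′) ∎
      where
      A = nat a
      B₁ = nat b
      A′ = nat a′
      B′ = nat b′

    morphism : Coefficients -Raw-AlmostCommutative⟶ fromCommutativeRing B
    morphism = record
      { ⟦_⟧ = ⟦_⟧
      ; +-homo = λ x y → trans (⟦⟧≈ (x C.+ y)) (trans (+-homo x y) (sym (+-cong (⟦⟧≈ x) (⟦⟧≈ y))))
      ; *-homo = λ x y → trans (⟦⟧≈ (x C.* y)) (trans (*-homo x y) (sym (*-cong (⟦⟧≈ x) (⟦⟧≈ y))))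
      ; -‿homo = λ x → trans (⟦⟧≈ (C.- x)) (trans (neg-homo x) (sym (-‿cong (⟦⟧≈ x))))
      ; 0-homo = refl
      ; 1-homo = refl
      }

    -- Pairs are not kept in reduced form, so a - b = a′ - b′ is tested crosswise as a + b′ = a′ +
    -- b.
    _≟_ : ∀ x y → Maybe (⟦ x ⟧ ≈ ⟦ y ⟧)
    x@(a , b) ≟ y@(a′ , b′) with (a ℕ.+ b′) ℕ.≟ (a′ ℕ.+ b)
    ... | yes eq = just (trans (⟦⟧≈ x) (trans (difference-cancel (trans (sym (nat-+ a b′)) (trans (reflexive (≡.cong nat eq)) (nat-+ a′ b)))) (sym (⟦⟧≈ y))))
    ... | no _ = nothing

  open RingSolver Coefficients (fromCommutativeRing B) morphism _≟_ public
    using (solve; _:=_; _:+_; _:*_; _:-_; :-_; con)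

-- Ideals and quotient rings

record IsIdeal {c ℓ ℓ′} (B : CommutativeRing c ℓ) (I : CommutativeRing.Carrier B → Set ℓ′) : Set (c ⊔ ℓ ⊔ ℓ′) where
  open CommutativeRing B
  field
    I-resp : ∀ {x y} → x ≈ y → I x → I y
    I-0 : I 0#
    I-+ : ∀ {x y} → I x → I y → I (x + y)
    I-* : ∀ a {x} → I x → I (a * x)

module Quotient {c ℓ ℓ′} (B : CommutativeRing c ℓ) {I : CommutativeRing.Carrier B → Set ℓ′} (isIdeal : IsIdeal B I) where
  open CommutativeRing B
  open IsIdeal isIdeal
  open IntegerRingSolver B

  infix 4 _~_
  -- A record rather than a synonym for `I (x - y)`: x and y can then be inferred from the type of a
  -- proof.
  record _~_ (x y : Carrier) : Set ℓ′ where
    constructor ~-intro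
    field ~-elim : I (x - y)
  open _~_ public

  I-neg : ∀ {x} → I x → I (- x)
  I-neg {x} Ix = I-resp (solve 1 (λ x → :- con (1 , 0) :* x := :- x) refl x) (I-* (- 1#) Ix)

  ≈⇒~ : ∀ {x y} → x ≈ y → x ~ y
  ≈⇒~ {x} {y} eq = ~-intro $ I-resp (sym (trans (+-congʳ eq) (-‿inverseʳ y))) I-0

  ~-sym : ∀ {x y} → x ~ y → y ~ x
  ~-sym {x} {y} p = ~-intro $ I-resp (solve 2 (λ x y → :- (x :- y) := y :- x) refl x y) (I-neg (~-elim p))

  ~-trans : ∀ {x y z} → x ~ y → y ~ z → x ~ z
  ~-trans {x} {y} {z} p p′ =
    ~-intro $ I-resp (solve 3 (λ x y z → (x :- y) :+ (y :- z) := x :- z) refl x y z) (I-+ (~-elim p) (~-elim p′))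

  ~-+-cong : ∀ {x y u v} → x ~ y → u ~ v → (x + u) ~ (y + v)
  ~-+-cong {x} {y} {u} {v} p p′ =
    ~-intro $ I-resp (solve 4 (λ x y u v → (x :- y) :+ (u :- v) := (x :+ u) :- (y :+ v)) refl x y u v) (I-+ (~-elim p) (~-elim p′))

  ~-*-cong : ∀ {x y u v} → x ~ y → u ~ v → (x * u) ~ (y * v)
  ~-*-cong {x} {y} {u} {v} p p′ =
    ~-intro $ I-resp (solve 4 (λ x y u v → u :* (x :- y) :+ y :* (u :- v) := x :* u :- y :* v) refl x y u v)
      (I-+ (I-* u (~-elim p)) (I-* y (~-elim p′)))

  ~-neg-cong : ∀ {x y} → x ~ y → (- x) ~ (- y)
  ~-neg-cong {x} {y} p = ~-intro $ I-resp (solve 2 (λ x y → :- (x :- y) := :- x :- :- y) refl x y) (I-neg (~-elim p))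

  quotient : CommutativeRing c ℓ′
  quotient = record
    { Carrier = Carrier
    ; _≈_ = _~_
    ; _+_ = _+_
    ; _*_ = _*_
    ; -_ = -_
    ; 0# = 0#
    ; 1# = 1#
    ; isCommutativeRing = record
      { isRing = record
        { +-isAbelianGroup = record
          { isGroup = record
            { isMonoid = record
              { isSemigroup = record
                { isMagma = record
                  { isEquivalence = record { refl = ≈⇒~ refl ; sym = ~-sym ; trans = ~-trans }
                  ; ∙-cong = ~-+-cong
                  }
                ; assoc = λ x y z → ≈⇒~ (+-assoc x y z)
                }
              ; identity = (λ x → ≈⇒~ (+-identityˡ x)) , (λ x → ≈⇒~ (+-identityʳ x))
              }
            ; inverse = (λ x → ≈⇒~ (-‿inverseˡ x)) , (λ x → ≈⇒~ (-‿inverseʳ x))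
            ; ⁻¹-cong = ~-neg-cong
            }
          ; comm = λ x y → ≈⇒~ (+-comm x y)
          }
        ; *-cong = ~-*-cong
        ; *-assoc = λ x y z → ≈⇒~ (*-assoc x y z)
        ; *-identity = (λ x → ≈⇒~ (*-identityˡ x)) , (λ x → ≈⇒~ (*-identityʳ x))
        ; distrib = (λ x y z → ≈⇒~ (distribˡ x y z)) , (λ x y z → ≈⇒~ (distribʳ x y z))
        }
      ; *-comm = λ x y → ≈⇒~ (*-comm x y)
      }
    }

-- The three-term recurrence and q-numbers

module Recurrence {c ℓ} (B : CommutativeRing c ℓ) where
  open CommutativeRing B
  open PolyOps B
  open IntegerRingSolver B
  open SetoidReasoning setoid

  Recurrent : Carrier → (ℕ → Carrier) → ℕ → Set ℓ
  Recurrent q y l = ∀ j → j ℕ.< l → (q + 1#) * y (suc j) ≈ q * y j + y (suc (suc j))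

  -- The recurrence rearranges to y (j+2) - y (j+1) = q (y (j+1) - y j), so consecutive differences
  -- form a geometric progression.
  recurrent-difference : ∀ q y l → Recurrent q y l →
    ∀ j → j ℕ.≤ l → y (suc j) - y j ≈ powC q j * (y 1 - y 0)
  recurrent-difference q y l rec zero _ = sym (*-identityˡ _)
  recurrent-difference q y l rec (suc j) j<l = begin
    y (2 ℕ.+ j) - y (suc j)
      ≈⟨ solve 3 (λ q y₁ y₂ → y₂ :- y₁ := y₂ :+ q :* y₁ :- (q :+ con (1 , 0)) :* y₁) refl q (y (suc j)) (y (2 ℕ.+ j)) ⟩
    (y (2 ℕ.+ j) + q * y (suc j)) - (q + 1#) * y (suc j)
      ≈⟨ +-congˡ (-‿cong (rec j j<l)) ⟩
    (y (2 ℕ.+ j) + q * y (suc j)) - (q * y j + y (2 ℕ.+ j))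
      ≈⟨ solve 4 (λ q y₀ y₁ y₂ → y₂ :+ q :* y₁ :- (q :* y₀ :+ y₂) := q :* (y₁ :- y₀)) refl q (y j) (y (suc j)) (y (2 ℕ.+ j)) ⟩
    q * (y (suc j) - y j)
      ≈⟨ *-congˡ (recurrent-difference q y l rec j (ℕ.<⇒≤ j<l)) ⟩
    q * (powC q j * (y 1 - y 0)) ≈⟨ sym (*-assoc _ _ _) ⟩
    powC q (suc j) * (y 1 - y 0) ∎

  -- Sums the geometric progression of differences. Read at the far end, it also recovers the slope
  -- y 1 - y 0 from two end values when the q-integer there is invertible; the spanning argument
  -- uses it in this way.
  recurrent-solution : ∀ q y l → Recurrent q y l →
    ∀ s → s ℕ.≤ suc l → y s ≈ y 0 + qint q s * (y 1 - y 0)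
  recurrent-solution q y l rec zero _ = sym (trans (+-congˡ (zeroˡ _)) (+-identityʳ _))
  recurrent-solution q y l rec (suc s) (s≤s s≤l) = begin
    y (suc s) ≈⟨ solve 2 (λ a b → b := (b :- a) :+ a) refl (y s) (y (suc s)) ⟩
    (y (suc s) - y s) + y s
      ≈⟨ +-cong (recurrent-difference q y l rec s s≤l) (recurrent-solution q y l rec s (ℕ.m≤n⇒m≤1+n s≤l)) ⟩
    powC q s * d + (y 0 + qint q s * d)
      ≈⟨ solve 4 (λ p i y₀ d → p :* d :+ (y₀ :+ i :* d) := y₀ :+ (i :+ p) :* d) refl (powC q s) (qint q s) (y 0) d ⟩
    y 0 + qint q (suc s) * d ∎
    where d = y 1 - y 0

  product : (ℕ → Carrier) → ℕ → Carrier
  product f zero = 1#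
  product f (suc k) = product f k * f k

  product-factor : ∀ f {j k} → j ℕ.< k → Σ[ r ∈ Carrier ] (product f k ≈ r * f j)
  product-factor f {j} {suc k} (s≤s j≤k) with ℕ.m≤n⇒m<n∨m≡n j≤k
  ... | inj₂ ≡.refl = product f k , refl
  ... | inj₁ j<k with product-factor f j<k
  ...   | r , eq = r * f k , trans (*-congʳ eq) (solve 3 (λ x y z → (x :* y) :* z := (x :* z) :* y) refl r (f j) (f k))

  product-suc : ∀ f k → f 0 * product (f ∘ suc) k ≈ product f (suc k)
  product-suc f zero = *-comm (f 0) 1#
  product-suc f (suc k) = trans (sym (*-assoc _ _ _)) (*-congʳ (product-suc f k))

  -- With π = x 1 ... x k, the sequence y j = π x j satisfies the recurrence: the relation at j+1
  -- holds only after multiplication by x (j+1), and π contains this factor for all j < k. Since y 0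
  -- = 0, the solution gives y (k+1) = [k+1] y 1 = [k+1] x 1 π, and induction treats π.
  product-recurrence : ∀ q x m → x 0 ≈ 0# →
    (∀ j → j ℕ.< m → x (suc j) * ((q + 1#) * x (suc j)) ≈ x (suc j) * (q * x j + x (suc (suc j)))) →
    ∀ k → k ℕ.≤ m → product (x ∘ suc) k ≈ qfact q k * powC (x 1) k
  product-recurrence q x m x₀≈0 rel zero _ = sym (*-identityˡ 1#)
  product-recurrence q x m x₀≈0 rel (suc k) k<m = begin
    y (suc k) ≈⟨ recurrent-solution q y k recurrent (suc k) ℕ.≤-refl ⟩
    y 0 + i * (y 1 - y 0) ≈⟨ +-cong y₀≈0 (*-congˡ (+-congˡ (-‿cong y₀≈0))) ⟩
    0# + i * (π * x 1 - 0#) ≈⟨ solve 3 (λ i p x → con (0 , 0) :+ i :* (p :* x :- con (0 , 0)) := (i :* x) :* p) refl i π (x 1) ⟩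
    (i * x 1) * π ≈⟨ *-congˡ (product-recurrence q x m x₀≈0 rel k (ℕ.<⇒≤ k<m)) ⟩
    (i * x 1) * (qfact q k * powC (x 1) k)
      ≈⟨ solve 4 (λ i x a p → (i :* x) :* (a :* p) := (a :* i) :* (x :* p)) refl i (x 1) (qfact q k) (powC (x 1) k) ⟩
    qfact q (suc k) * powC (x 1) (suc k) ∎
    where
    i = qint q (suc k)
    π = product (x ∘ suc) k
    y : ℕ → Carrier
    y j = π * x j
    y₀≈0 : y 0 ≈ 0#
    y₀≈0 = trans (*-congˡ x₀≈0) (zeroʳ π)
    recurrent : Recurrent q y k
    recurrent j j<k with product-factor (x ∘ suc) j<k
    ... | r , eq = begin
      (q + 1#) * (π * x (suc j)) ≈⟨ *-congˡ (*-congʳ eq) ⟩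
      (q + 1#) * ((r * x (suc j)) * x (suc j)) ≈⟨ solve 3 (λ s r x → s :* ((r :* x) :* x) := r :* (x :* (s :* x))) refl (q + 1#) r (x (suc j)) ⟩
      r * (x (suc j) * ((q + 1#) * x (suc j))) ≈⟨ *-congˡ (rel j (ℕ.<-trans j<k k<m)) ⟩
      r * (x (suc j) * (q * x j + x (suc (suc j))))
        ≈⟨ solve 5 (λ r x s x₀ x₂ → r :* (x :* (s :* x₀ :+ x₂)) := s :* ((r :* x) :* x₀) :+ (r :* x) :* x₂) refl
             r (x (suc j)) q (x j) (x (suc (suc j))) ⟩
      q * ((r * x (suc j)) * x j) + (r * x (suc j)) * x (suc (suc j)) ≈⟨ +-cong (*-congˡ (*-congʳ (sym eq))) (*-congʳ (sym eq)) ⟩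
      q * y j + y (suc (suc j)) ∎

-- The recurrence is solved in quotients of polynomial rings, where q-numbers are formed from
-- `constP q`; these lemmas turn them back into constants.
module QuantumIntegerImages {a b ℓ₁ ℓ₂} (A : CommutativeRing a ℓ₁) (B : CommutativeRing b ℓ₂)
  (h : CommutativeRing.Carrier A → CommutativeRing.Carrier B)
  (h-0 : CommutativeRing._≈_ B (h (CommutativeRing.0# A)) (CommutativeRing.0# B))
  (h-1 : CommutativeRing._≈_ B (h (CommutativeRing.1# A)) (CommutativeRing.1# B))
  (h-+ : ∀ x y → CommutativeRing._≈_ B (h (CommutativeRing._+_ A x y)) (CommutativeRing._+_ B (h x) (h y)))
  (h-* : ∀ x y → CommutativeRing._≈_ B (h (CommutativeRing._*_ A x y)) (CommutativeRing._*_ B (h x) (h y)))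
  where
  open CommutativeRing B
  private
    module PA = PolyOps A
    module PB = PolyOps B

  powC-image : ∀ q k → PB.powC (h q) k ≈ h (PA.powC q k)
  powC-image q zero = sym h-1
  powC-image q (suc k) = trans (*-congˡ (powC-image q k)) (sym (h-* q (PA.powC q k)))

  qint-image : ∀ q k → PB.qint (h q) k ≈ h (PA.qint q k)
  qint-image q zero = sym h-0
  qint-image q (suc k) = trans (+-cong (qint-image q k) (powC-image q k)) (sym (h-+ (PA.qint q k) (PA.powC q k)))

  qfact-image : ∀ q k → PB.qfact (h q) k ≈ h (PA.qfact q k)
  qfact-image q zero = sym h-1
  qfact-image q (suc k) = trans (*-cong (qfact-image q k) (qint-image q (suc k))) (sym (h-* (PA.qfact q k) (PA.qint q (suc k))))

-- Exponent vectors and linear functionals on polynomials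

infixl 6 _⊕_
_⊕_ : ∀ {n} → Vec ℕ n → Vec ℕ n → Vec ℕ n
_⊕_ = zipWith ℕ._+_

𝟎 : ∀ {n} → Vec ℕ n
𝟎 = replicate _ 0

⊕-comm : ∀ {n} (α β : Vec ℕ n) → α ⊕ β ≡ β ⊕ α
⊕-comm = Vec.zipWith-comm ℕ.+-comm

⊕-assoc : ∀ {n} (α β γ : Vec ℕ n) → (α ⊕ β) ⊕ γ ≡ α ⊕ (β ⊕ γ)
⊕-assoc = Vec.zipWith-assoc ℕ.+-assoc

⊕-identityˡ : ∀ {n} (α : Vec ℕ n) → 𝟎 ⊕ α ≡ α
⊕-identityˡ = Vec.zipWith-identityˡ ℕ.+-identityˡ

⊕-identityʳ : ∀ {n} (α : Vec ℕ n) → α ⊕ 𝟎 ≡ α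
⊕-identityʳ = Vec.zipWith-identityʳ ℕ.+-identityʳ

sum-⊕ : ∀ {n} (α β : Vec ℕ n) → Vec.sum (α ⊕ β) ≡ Vec.sum α ℕ.+ Vec.sum β
sum-⊕ [] [] = ≡.refl
sum-⊕ (a ∷ α) (b ∷ β) = ≡.trans (≡.cong ((a ℕ.+ b) ℕ.+_) (sum-⊕ α β)) (interchange a b (Vec.sum α) (Vec.sum β))

sum-𝟎 : ∀ n → Vec.sum (replicate n 0) ≡ 0
sum-𝟎 zero = ≡.refl
sum-𝟎 (suc n) = sum-𝟎 n

module Functionals {c ℓ} (R : CommutativeRing c ℓ) where
  open CommutativeRing R renaming (Carrier to K) hiding (zero)
  open PolyOps R
  open IntegerRingSolver R
  open RingProperties ring
  open SetoidReasoning setoid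

  -- The value on p of the linear functional sending the monomial x^α to φ α.
  ev : ∀ {n} → (Vec ℕ n → K) → Poly n → K
  ev φ [] = 0#
  ev φ ((a , α) ∷ p) = a * φ α + ev φ p

  χ : ∀ {n} → Vec ℕ n → Vec ℕ n → K
  χ β α with Vec.≡-dec ℕ._≟_ α β
  ... | yes _ = 1#
  ... | no _ = 0#

  χ-refl : ∀ {n} (α : Vec ℕ n) → χ α α ≈ 1#
  χ-refl α with Vec.≡-dec ℕ._≟_ α α
  ... | yes _ = refl
  ... | no α≢α = contradiction ≡.refl α≢α

  χ-≢ : ∀ {n} {α β : Vec ℕ n} → ¬ (α ≡ β) → χ β α ≈ 0#
  χ-≢ {α = α} {β} α≢β with Vec.≡-dec ℕ._≟_ α β
  ... | yes α≡β = contradiction α≡β α≢β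
  ... | no _ = refl

  ev-cong-All : ∀ {n} {P : Vec ℕ n → Set} {φ ψ : Vec ℕ n → K} → (∀ α → P α → φ α ≈ ψ α) →
    ∀ {p} → LAll.All (P ∘ proj₂) p → ev φ p ≈ ev ψ p
  ev-cong-All eq [] = refl
  ev-cong-All eq (Pα ∷ Pp) = +-cong (*-congˡ (eq _ Pα)) (ev-cong-All eq Pp)

  ev-cong : ∀ {n} {φ ψ : Vec ℕ n → K} → (∀ α → φ α ≈ ψ α) → ∀ p → ev φ p ≈ ev ψ p
  ev-cong eq [] = refl
  ev-cong eq ((a , α) ∷ p) = +-cong (*-congˡ (eq α)) (ev-cong eq p)

  ev-0 : ∀ {n} (p : Poly n) → ev (λ _ → 0#) p ≈ 0#
  ev-0 [] = refl
  ev-0 ((a , α) ∷ p) = trans (+-cong (zeroʳ a) (ev-0 p)) (+-identityˡ 0#)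

  ev-vanishing : ∀ {n} {φ : Vec ℕ n → K} → (∀ α → φ α ≈ 0#) → ∀ p → ev φ p ≈ 0#
  ev-vanishing eq p = trans (ev-cong eq p) (ev-0 p)

  ev-vanishing-All : ∀ {n} {P : Vec ℕ n → Set} {φ : Vec ℕ n → K} → (∀ α → P α → φ α ≈ 0#) →
    ∀ {p} → LAll.All (P ∘ proj₂) p → ev φ p ≈ 0#
  ev-vanishing-All eq {p} Pp = trans (ev-cong-All eq Pp) (ev-0 p)

  ev-+ : ∀ {n} (φ ψ : Vec ℕ n → K) p → ev (λ α → φ α + ψ α) p ≈ ev φ p + ev ψ p
  ev-+ φ ψ [] = sym (+-identityˡ 0#)
  ev-+ φ ψ ((a , α) ∷ p) = trans (+-congˡ (ev-+ φ ψ p))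
    (solve 5 (λ a x y u v → a :* (x :+ y) :+ (u :+ v) := (a :* x :+ u) :+ (a :* y :+ v)) refl a (φ α) (ψ α) (ev φ p) (ev ψ p))

  ev-* : ∀ {n} b (φ : Vec ℕ n → K) p → ev (λ α → b * φ α) p ≈ b * ev φ p
  ev-* b φ [] = sym (zeroʳ b)
  ev-* b φ ((a , α) ∷ p) = trans (+-congˡ (ev-* b φ p))
    (solve 4 (λ a b x u → a :* (b :* x) :+ b :* u := b :* (a :* x :+ u)) refl a b (φ α) (ev φ p))

  ev-neg : ∀ {n} (φ : Vec ℕ n → K) p → ev (λ α → - φ α) p ≈ - ev φ p
  ev-neg φ [] = sym -0#≈0#
  ev-neg φ ((a , α) ∷ p) = trans (+-congˡ (ev-neg φ p))
    (solve 3 (λ a x u → a :* :- x :+ :- u := :- (a :* x :+ u)) refl a (φ α) (ev φ p))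

  ev-+ₚ : ∀ {n} (φ : Vec ℕ n → K) p q → ev φ (p +ₚ q) ≈ ev φ p + ev φ q
  ev-+ₚ φ [] q = sym (+-identityˡ _)
  ev-+ₚ φ (_ ∷ p) q = trans (+-congˡ (ev-+ₚ φ p q)) (sym (+-assoc _ _ _))

  ev-scaleP : ∀ {n} (φ : Vec ℕ n → K) b p → ev φ (scaleP b p) ≈ b * ev φ p
  ev-scaleP φ b [] = sym (zeroʳ b)
  ev-scaleP φ b ((a , α) ∷ p) = trans (+-congˡ (ev-scaleP φ b p))
    (solve 4 (λ a b x u → b :* a :* x :+ b :* u := b :* (a :* x :+ u)) refl a b (φ α) (ev φ p))

  ev--ₚ : ∀ {n} (φ : Vec ℕ n → K) p → ev φ (-ₚ p) ≈ - ev φ p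
  ev--ₚ φ [] = sym -0#≈0#
  ev--ₚ φ ((a , α) ∷ p) = trans (+-congˡ (ev--ₚ φ p))
    (solve 3 (λ a x u → :- a :* x :+ :- u := :- (a :* x :+ u)) refl a (φ α) (ev φ p))

  ev-constP : ∀ {n} (φ : Vec ℕ n → K) a → ev φ (constP a) ≈ a * φ 𝟎
  ev-constP φ a = +-identityʳ _

  ev-oneP : ∀ {n} (φ : Vec ℕ n → K) → ev φ oneP ≈ φ 𝟎
  ev-oneP φ = trans (ev-constP φ 1#) (*-identityˡ _)

  ev-varP : ∀ {n} (φ : Vec ℕ n → K) i → ev φ (varP i) ≈ φ (unitVec i)
  ev-varP φ i = trans (+-identityʳ _) (*-identityˡ _)

  ev-*ₚ : ∀ {n} (φ : Vec ℕ n → K) p q → ev φ (p *ₚ q) ≈ ev (λ α → ev (λ β → φ (α ⊕ β)) q) p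
  ev-*ₚ φ [] q = refl
  ev-*ₚ φ ((a , α) ∷ p) q = trans (ev-+ₚ φ (List.map (λ s → (a * proj₁ s , α ⊕ proj₂ s)) q) (p *ₚ q)) (+-cong (ev-term q) (ev-*ₚ φ p q))
    where
    ev-term : ∀ q → ev φ (List.map (λ s → (a * proj₁ s , α ⊕ proj₂ s)) q) ≈ a * ev (λ β → φ (α ⊕ β)) q
    ev-term [] = sym (zeroʳ a)
    ev-term ((b , β) ∷ q) = trans (+-congˡ (ev-term q))
      (solve 4 (λ a b x u → a :* b :* x :+ a :* u := a :* (b :* x :+ u)) refl a b (φ (α ⊕ β)) (ev (λ β → φ (α ⊕ β)) q))

  -- Fubini for finite sums; commutativity of the product and multiplicativity of substitution rest
  -- on it.
  ev-swap : ∀ {m n} (h : Vec ℕ m → Vec ℕ n → K) p q →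
    ev (λ α → ev (h α) q) p ≈ ev (λ β → ev (λ α → h α β) p) q
  ev-swap h [] q = sym (ev-0 q)
  ev-swap h ((a , α) ∷ p) q = begin
    a * ev (h α) q + ev (λ α → ev (h α) q) p ≈⟨ +-cong (sym (ev-* a (h α) q)) (ev-swap h p q) ⟩
    ev (λ β → a * h α β) q + ev (λ β → ev (λ α → h α β) p) q ≈⟨ sym (ev-+ _ _ q) ⟩
    ev (λ β → a * h α β + ev (λ α → h α β) p) q ∎

  coeff-ev : ∀ {n} (p : Poly n) β → coeff p β ≈ ev (χ β) p
  coeff-ev [] β = refl
  coeff-ev ((a , α) ∷ p) β with Vec.≡-dec ℕ._≟_ α β
  ... | yes _ = +-cong (sym (*-identityʳ a)) (coeff-ev p β)
  ... | no _ = trans (coeff-ev p β) (sym (trans (+-congʳ (zeroʳ a)) (+-identityˡ _)))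

  -- All terms with exponent α go at once, because terms of a formal sum cancel only within one
  -- exponent.
  without : ∀ {n} → Vec ℕ n → Poly n → Poly n
  without α [] = []
  without α ((a , β) ∷ p) with Vec.≡-dec ℕ._≟_ β α
  ... | yes _ = without α p
  ... | no _ = (a , β) ∷ without α p

  length-without : ∀ {n} (α : Vec ℕ n) p → List.length (without α p) ℕ.≤ List.length p
  length-without α [] = z≤n
  length-without α ((a , β) ∷ p) with Vec.≡-dec ℕ._≟_ β α
  ... | yes _ = ℕ.m≤n⇒m≤1+n (length-without α p)
  ... | no _ = s≤s (length-without α p)

  ev-without : ∀ {n} (φ : Vec ℕ n → K) α p → ev φ p ≈ coeff p α * φ α + ev φ (without α p)
  ev-without φ α [] = sym (trans (+-congʳ (zeroˡ _)) (+-identityˡ _))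
  ev-without φ α ((a , β) ∷ p) with Vec.≡-dec ℕ._≟_ β α
  ... | yes ≡.refl = trans (+-congˡ (ev-without φ α p))
    (solve 4 (λ a k x u → a :* x :+ (k :* x :+ u) := (a :+ k) :* x :+ u) refl a (coeff p α) (φ α) (ev φ (without α p)))
  ... | no _ = trans (+-congˡ (ev-without φ α p))
    (solve 3 (λ x y z → x :+ (y :+ z) := y :+ (x :+ z)) refl (a * φ β) (coeff p α * φ α) (ev φ (without α p)))

  private
    coeff-head : ∀ {n} a (α : Vec ℕ n) p → coeff ((a , α) ∷ p) α ≈ a + coeff p α
    coeff-head a α p with Vec.≡-dec ℕ._≟_ α α
    ... | yes _ = refl
    ... | no α≢α = contradiction ≡.refl α≢α

    -- A formal sum with zero coefficients may still list terms. Deleting every term with the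
    -- exponent of the head changes the value by that exponent's coefficient, which is zero, and
    -- leaves a shorter sum that is again null. The bound l makes this an induction on length.
    ev-null : ∀ {n} (φ : Vec ℕ n → K) l p → List.length p ℕ.≤ l → (∀ β → coeff p β ≈ 0#) → ev φ p ≈ 0#
    ev-null φ l [] _ null = refl
    ev-null φ (suc l) (t@(a , α) ∷ p) (s≤s len) null = begin
      a * φ α + ev φ p ≈⟨ +-congˡ (ev-without φ α p) ⟩
      a * φ α + (coeff p α * φ α + ev φ p′)
        ≈⟨ solve 4 (λ a k x u → a :* x :+ (k :* x :+ u) := (a :+ k) :* x :+ u) refl a (coeff p α) (φ α) (ev φ p′) ⟩
      (a + coeff p α) * φ α + ev φ p′
        ≈⟨ +-cong (trans (*-congʳ (trans (sym (coeff-head a α p)) (null α))) (zeroˡ _))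
                  (ev-null φ l p′ (ℕ.≤-trans (length-without α p) len) null′) ⟩
      0# + 0# ≈⟨ +-identityˡ 0# ⟩
      0# ∎
      where
      p′ = without α p
      null′ : ∀ β → coeff p′ β ≈ 0#
      null′ β = begin
        coeff p′ β ≈⟨ coeff-ev p′ β ⟩
        ev (χ β) p′
          ≈⟨ solve 3 (λ x y z → z := (x :+ (y :+ z)) :- (x :+ y)) refl (a * χ β α) (coeff p α * χ β α) (ev (χ β) p′) ⟩
        (a * χ β α + (coeff p α * χ β α + ev (χ β) p′)) - (a * χ β α + coeff p α * χ β α)
          ≈⟨ +-cong (trans (+-congˡ (sym (ev-without (χ β) α p))) (trans (sym (coeff-ev (t ∷ p) β)) (null β)))
                    (-‿cong (trans (sym (distribʳ _ _ _)) (trans (*-congʳ (trans (sym (coeff-head a α p)) (null α))) (zeroˡ _)))) ⟩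
        0# - 0# ≈⟨ -‿inverseʳ 0# ⟩
        0# ∎

  ev-resp : ∀ {n} (φ : Vec ℕ n → K) (p q : Poly n) → p ≈ₚ q → ev φ p ≈ ev φ q
  ev-resp φ p q p≈q = begin
    ev φ p ≈⟨ solve 2 (λ x y → x := (x :- y) :+ y) refl (ev φ p) (ev φ q) ⟩
    (ev φ p - ev φ q) + ev φ q ≈⟨ +-congʳ (+-congˡ (sym (ev--ₚ φ q))) ⟩
    (ev φ p + ev φ (-ₚ q)) + ev φ q ≈⟨ +-congʳ (sym (ev-+ₚ φ p (-ₚ q))) ⟩
    ev φ (p -ₚ q) + ev φ q ≈⟨ +-congʳ (ev-null φ _ (p -ₚ q) ℕ.≤-refl difference-null) ⟩
    0# + ev φ q ≈⟨ +-identityˡ _ ⟩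
    ev φ q ∎
    where
    difference-null : ∀ β → coeff (p -ₚ q) β ≈ 0#
    difference-null β = begin
      coeff (p -ₚ q) β ≈⟨ coeff-ev (p -ₚ q) β ⟩
      ev (χ β) (p -ₚ q) ≈⟨ ev-+ₚ (χ β) p (-ₚ q) ⟩
      ev (χ β) p + ev (χ β) (-ₚ q)
        ≈⟨ +-cong (sym (coeff-ev p β)) (trans (ev--ₚ (χ β) q) (-‿cong (sym (coeff-ev q β)))) ⟩
      coeff p β - coeff q β ≈⟨ +-congʳ (p≈q β) ⟩
      coeff q β - coeff q β ≈⟨ -‿inverseʳ _ ⟩
      0# ∎

  filter-≈ₚ : ∀ {n ℓ′} {P : Pred (Vec ℕ n) ℓ′} (P? : Decidable P) p → (∀ α → ¬ P α → coeff p α ≈ 0#) →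
    p ≈ₚ List.filter (P? ∘ proj₂) p
  filter-≈ₚ {P = P} P? p vanish β with P? β
  ... | yes Pβ = kept p
    where
    kept : ∀ p → coeff p β ≈ coeff (List.filter (P? ∘ proj₂) p) β
    kept [] = refl
    kept ((a , α) ∷ p) with P? α
    ... | yes _ with Vec.≡-dec ℕ._≟_ α β
    ...   | yes _ = +-congˡ (kept p)
    ...   | no _ = kept p
    kept ((a , α) ∷ p) | no ¬Pα with Vec.≡-dec ℕ._≟_ α β
    ...   | yes ≡.refl = contradiction Pβ ¬Pα
    ...   | no _ = kept p
  ... | no ¬Pβ = trans (vanish β ¬Pβ) (sym (dropped p))
    where
    dropped : ∀ p → coeff (List.filter (P? ∘ proj₂) p) β ≈ 0#
    dropped [] = refl
    dropped ((a , α) ∷ p) with P? α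
    ... | no _ = dropped p
    ... | yes Pα with Vec.≡-dec ℕ._≟_ α β
    ...   | yes ≡.refl = contradiction Pα ¬Pβ
    ...   | no _ = dropped p

  infix 4 _≋_
  -- Equality tested by every functional, equivalent to equality of coefficients by `ev-resp`. In
  -- this form the ring laws become identities between iterated finite sums.
  record _≋_ {n} (p q : Poly n) : Set (c ⊔ ℓ) where
    constructor ≋-intro
    field ev-≋ : ∀ φ → ev φ p ≈ ev φ q
  open _≋_ public

  ≋⇒≈ₚ : ∀ {n} {p q : Poly n} → p ≋ q → p ≈ₚ q
  ≋⇒≈ₚ {p = p} {q} e β = trans (coeff-ev p β) (trans (ev-≋ e (χ β)) (sym (coeff-ev q β)))

  ≈ₚ⇒≋ : ∀ {n} (p q : Poly n) → p ≈ₚ q → p ≋ q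
  ≈ₚ⇒≋ p q e = ≋-intro λ φ → ev-resp φ p q e

  private
    *ₚ-cong : ∀ {n} {p q r s : Poly n} → p ≋ q → r ≋ s → (p *ₚ r) ≋ (q *ₚ s)
    *ₚ-cong {p = p} {q} {r} {s} e e′ = ≋-intro λ φ → begin
      ev φ (p *ₚ r) ≈⟨ ev-*ₚ φ p r ⟩
      ev (λ α → ev (λ β → φ (α ⊕ β)) r) p ≈⟨ ev-≋ e _ ⟩
      ev (λ α → ev (λ β → φ (α ⊕ β)) r) q ≈⟨ ev-cong (λ α → ev-≋ e′ _) q ⟩
      ev (λ α → ev (λ β → φ (α ⊕ β)) s) q ≈⟨ sym (ev-*ₚ φ q s) ⟩
      ev φ (q *ₚ s) ∎

    *ₚ-comm : ∀ {n} (p q : Poly n) → (p *ₚ q) ≋ (q *ₚ p)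
    *ₚ-comm p q = ≋-intro λ φ → begin
      ev φ (p *ₚ q) ≈⟨ ev-*ₚ φ p q ⟩
      ev (λ α → ev (λ β → φ (α ⊕ β)) q) p ≈⟨ ev-swap _ p q ⟩
      ev (λ β → ev (λ α → φ (α ⊕ β)) p) q
        ≈⟨ ev-cong (λ β → ev-cong (λ α → reflexive (≡.cong φ (⊕-comm α β))) p) q ⟩
      ev (λ β → ev (λ α → φ (β ⊕ α)) p) q ≈⟨ sym (ev-*ₚ φ q p) ⟩
      ev φ (q *ₚ p) ∎

    *ₚ-assoc : ∀ {n} (p q r : Poly n) → ((p *ₚ q) *ₚ r) ≋ (p *ₚ (q *ₚ r))
    *ₚ-assoc p q r = ≋-intro λ φ → begin
      ev φ ((p *ₚ q) *ₚ r) ≈⟨ ev-*ₚ φ (p *ₚ q) r ⟩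
      ev (λ α → ev (λ γ → φ (α ⊕ γ)) r) (p *ₚ q) ≈⟨ ev-*ₚ _ p q ⟩
      ev (λ α → ev (λ β → ev (λ γ → φ ((α ⊕ β) ⊕ γ)) r) q) p
        ≈⟨ ev-cong (λ α → ev-cong (λ β → ev-cong (λ γ → reflexive (≡.cong φ (⊕-assoc α β γ))) r) q) p ⟩
      ev (λ α → ev (λ β → ev (λ γ → φ (α ⊕ (β ⊕ γ))) r) q) p ≈⟨ ev-cong (λ α → sym (ev-*ₚ _ q r)) p ⟩
      ev (λ α → ev (λ β → φ (α ⊕ β)) (q *ₚ r)) p ≈⟨ sym (ev-*ₚ φ p (q *ₚ r)) ⟩
      ev φ (p *ₚ (q *ₚ r)) ∎

    *ₚ-identityˡ : ∀ {n} (p : Poly n) → (oneP *ₚ p) ≋ p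
    *ₚ-identityˡ p = ≋-intro λ φ → trans (ev-*ₚ φ oneP p)
      (trans (ev-oneP (λ α → ev (λ β → φ (α ⊕ β)) p)) (ev-cong (λ β → reflexive (≡.cong φ (⊕-identityˡ β))) p))

    *ₚ-distribˡ : ∀ {n} (p q r : Poly n) → (p *ₚ (q +ₚ r)) ≋ ((p *ₚ q) +ₚ (p *ₚ r))
    *ₚ-distribˡ p q r = ≋-intro λ φ → begin
      ev φ (p *ₚ (q +ₚ r)) ≈⟨ ev-*ₚ φ p (q +ₚ r) ⟩
      ev (λ α → ev (λ β → φ (α ⊕ β)) (q +ₚ r)) p ≈⟨ ev-cong (λ α → ev-+ₚ _ q r) p ⟩
      ev (λ α → ev (λ β → φ (α ⊕ β)) q + ev (λ β → φ (α ⊕ β)) r) p ≈⟨ ev-+ _ _ p ⟩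
      ev (λ α → ev (λ β → φ (α ⊕ β)) q) p + ev (λ α → ev (λ β → φ (α ⊕ β)) r) p
        ≈⟨ sym (+-cong (ev-*ₚ φ p q) (ev-*ₚ φ p r)) ⟩
      ev φ (p *ₚ q) + ev φ (p *ₚ r) ≈⟨ sym (ev-+ₚ φ (p *ₚ q) (p *ₚ r)) ⟩
      ev φ ((p *ₚ q) +ₚ (p *ₚ r)) ∎

    ≋-trans : ∀ {n} {p q r : Poly n} → p ≋ q → q ≋ r → p ≋ r
    ≋-trans e e′ = ≋-intro λ φ → trans (ev-≋ e φ) (ev-≋ e′ φ)

    +ₚ-cong : ∀ {n} {p q r s : Poly n} → p ≋ q → r ≋ s → (p +ₚ r) ≋ (q +ₚ s)
    +ₚ-cong {p = p} {q} {r} {s} e e′ = ≋-intro λ φ →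
      trans (ev-+ₚ φ p r) (trans (+-cong (ev-≋ e φ) (ev-≋ e′ φ)) (sym (ev-+ₚ φ q s)))

    +ₚ-comm : ∀ {n} (p q : Poly n) → (p +ₚ q) ≋ (q +ₚ p)
    +ₚ-comm p q = ≋-intro λ φ → trans (ev-+ₚ φ p q) (trans (+-comm _ _) (sym (ev-+ₚ φ q p)))

    -ₚ-inverseʳ : ∀ {n} (p : Poly n) → (p -ₚ p) ≋ zeroP
    -ₚ-inverseʳ p = ≋-intro λ φ → trans (ev-+ₚ φ p (-ₚ p)) (trans (+-congˡ (ev--ₚ φ p)) (-‿inverseʳ _))

    -ₚ-cong : ∀ {n} {p q : Poly n} → p ≋ q → (-ₚ p) ≋ (-ₚ q)
    -ₚ-cong {p = p} {q} e = ≋-intro λ φ → trans (ev--ₚ φ p) (trans (-‿cong (ev-≋ e φ)) (sym (ev--ₚ φ q)))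

  polyRing : ℕ → CommutativeRing c (c ⊔ ℓ)
  polyRing n = record
    { Carrier = Poly n
    ; _≈_ = _≋_
    ; _+_ = _+ₚ_
    ; _*_ = _*ₚ_
    ; -_ = -ₚ_
    ; 0# = zeroP
    ; 1# = oneP
    ; isCommutativeRing = record
      { isRing = record
        { +-isAbelianGroup = record
          { isGroup = record
            { isMonoid = record
              { isSemigroup = record
                { isMagma = record
                  { isEquivalence = record
                    { refl = ≋-intro λ _ → refl
                    ; sym = λ e → ≋-intro λ φ → sym (ev-≋ e φ)
                    ; trans = ≋-trans }
                  ; ∙-cong = +ₚ-cong
                  }
                ; assoc = λ p q r → ≋-intro λ φ → reflexive (≡.cong (ev φ) (List.++-assoc p q r))
                }
              ; identity = (λ p → ≋-intro λ _ → refl) , (λ p → ≋-intro λ φ → reflexive (≡.cong (ev φ) (List.++-identityʳ p)))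
              }
            ; inverse = (λ p → ≋-trans (+ₚ-comm (-ₚ p) p) (-ₚ-inverseʳ p)) , -ₚ-inverseʳ
            ; ⁻¹-cong = -ₚ-cong
            }
          ; comm = +ₚ-comm
          }
        ; *-cong = *ₚ-cong
        ; *-assoc = *ₚ-assoc
        ; *-identity = *ₚ-identityˡ , (λ p → ≋-trans (*ₚ-comm p oneP) (*ₚ-identityˡ p))
        ; distrib = *ₚ-distribˡ , λ p q r →
            ≋-trans (*ₚ-comm (q +ₚ r) p) (≋-trans (*ₚ-distribˡ p q r) (+ₚ-cong (*ₚ-comm p q) (*ₚ-comm p r)))
        }
      ; *-comm = *ₚ-comm
      }
    }

-- Substitution and homogeneous polynomials

infixr 8 _·_
_·_ : ∀ {n} → ℕ → Vec ℕ n → Vec ℕ n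
a · α = Vec.map (a ℕ.*_) α

0·-≡𝟎 : ∀ {n} (α : Vec ℕ n) → 0 · α ≡ 𝟎
0·-≡𝟎 [] = ≡.refl
0·-≡𝟎 (a ∷ α) = ≡.cong (0 ∷_) (0·-≡𝟎 α)

·-𝟎 : ∀ {n} a → a · 𝟎 {n} ≡ 𝟎
·-𝟎 {zero} a = ≡.refl
·-𝟎 {suc n} a = ≡.cong₂ _∷_ (ℕ.*-zeroʳ a) (·-𝟎 a)

suc-· : ∀ {n} a (α : Vec ℕ n) → suc a · α ≡ α ⊕ a · α
suc-· a [] = ≡.refl
suc-· a (b ∷ α) = ≡.cong (_ ∷_) (suc-· a α)

record Additive {m n} (h : Vec ℕ m → Vec ℕ n) : Set where
  field
    h-𝟎 : h 𝟎 ≡ 𝟎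
    h-⊕ : ∀ α β → h (α ⊕ β) ≡ h α ⊕ h β

module Polynomials {c ℓ} (R : CommutativeRing c ℓ) where
  open CommutativeRing R renaming (Carrier to K) hiding (zero)
  open PolyOps R
  open Functionals R
  open IntegerRingSolver R

  -- The exponent of the image of x^α under the substitution of x_{w(i)} for x_i. The length k is
  -- independent of n, so that words can be treated by recursion.
  unitVec-act : ∀ {n k} → Vec (Fin n) k → Vec ℕ k → Vec ℕ n
  unitVec-act [] [] = 𝟎
  unitVec-act (j ∷ w) (a ∷ α) = (a · unitVec j) ⊕ unitVec-act w α

  unitVec-act-suc : ∀ {n k} (w : Vec (Fin n) k) α → unitVec-act (Vec.map Fin.suc w) α ≡ 0 ∷ unitVec-act w α
  unitVec-act-suc [] [] = ≡.refl
  unitVec-act-suc (j ∷ w) (a ∷ α) rewrite unitVec-act-suc w α | ℕ.*-zeroʳ a = ≡.refl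

  unitVec-act-allFin : ∀ {n} (α : Vec ℕ n) → unitVec-act (Vec.allFin n) α ≡ α
  unitVec-act-allFin [] = ≡.refl
  unitVec-act-allFin {suc n} (a ∷ α) = ≡.trans
    (≡.cong ((a · unitVec Fin.zero) ⊕_) (≡.trans (≡.cong (λ w → unitVec-act w α) (Vec.tabulate-∘ Fin.suc (λ i → i)))
      (≡.trans (unitVec-act-suc (Vec.allFin n) α) (≡.cong (0 ∷_) (unitVec-act-allFin α)))))
    (≡.cong₂ _∷_ (≡.trans (ℕ.+-identityʳ _) (ℕ.*-identityʳ a))
      (≡.trans (≡.cong (_⊕ α) (·-𝟎 a)) (⊕-identityˡ α)))

  sum-unitVec : ∀ {n} (i : Fin n) → Vec.sum (unitVec i) ≡ 1
  sum-unitVec {suc n} Fin.zero = ≡.cong suc (sum-𝟎 n)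
  sum-unitVec (Fin.suc i) = sum-unitVec i

  monomial : ∀ {n} → Vec ℕ n → Poly n
  monomial α = (1# , α) ∷ []

  ev-monomial : ∀ {n} (φ : Vec ℕ n → K) α → ev φ (monomial α) ≈ φ α
  ev-monomial φ α = trans (+-identityʳ _) (*-identityˡ _)

  module PolyRing (n : ℕ) where
    open CommutativeRing (polyRing n) public
    open IntegerRingSolver (polyRing n) public

  module PolyReasoning (n : ℕ) = SetoidReasoning (CommutativeRing.setoid (polyRing n))

  module _ {n : ℕ} where
    open FiniteSum (CommutativeRing.*-commutativeMonoid (polyRing n)) public using ()
      renaming (sum to Π; sum-cong-≋ to Π-cong; ∑-distrib-+ to Π-*; sum-replicate-zero to Π-1)

  scaleP≋ : ∀ {n} a (p : Poly n) → scaleP a p ≋ (constP a *ₚ p)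
  scaleP≋ a p = ≋-intro λ φ → trans (ev-scaleP φ a p) (sym (trans (ev-*ₚ φ (constP a) p)
    (trans (ev-constP (λ α → ev (λ β → φ (α ⊕ β)) p) a) (*-congˡ (ev-cong (λ β → reflexive (≡.cong φ (⊕-identityˡ β))) p)))))

  constP-0 : ∀ {n} → constP {n} 0# ≋ zeroP
  constP-0 = ≋-intro λ φ → trans (ev-constP φ 0#) (zeroˡ _)

  constP-cong : ∀ {n a b} → a ≈ b → constP {n} a ≋ constP b
  constP-cong a≈b = ≋-intro λ φ → +-congʳ (*-congʳ a≈b)

  constP-+ : ∀ {n} a b → constP {n} (a + b) ≋ (constP a +ₚ constP b)
  constP-+ a b = ≋-intro λ φ → solve 3 (λ a b x → (a :+ b) :* x :+ con (0 , 0) := a :* x :+ (b :* x :+ con (0 , 0))) refl a b (φ 𝟎)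

  constP-* : ∀ {n} a b → constP {n} (a * b) ≋ (constP a *ₚ constP b)
  constP-* a b = ≋-intro λ φ → +-congˡ′ (≡.cong φ (≡.sym (⊕-identityˡ 𝟎)))
    where
    +-congˡ′ : ∀ {x y} → x ≡ y → (a * b) * x + 0# ≈ (a * b) * y + 0#
    +-congˡ′ ≡.refl = refl

  monomial-⊕ : ∀ {n} (α β : Vec ℕ n) → monomial (α ⊕ β) ≋ (monomial α *ₚ monomial β)
  monomial-⊕ α β = ≋-intro λ φ → trans (ev-monomial φ (α ⊕ β))
    (sym (trans (ev-*ₚ φ (monomial α) (monomial β)) (trans (ev-monomial (λ γ → ev (λ δ → φ (γ ⊕ δ)) (monomial β)) α) (ev-monomial (λ δ → φ (α ⊕ δ)) β))))

  ≡⇒≋ : ∀ {n} {p q : Poly n} → p ≡ q → p ≋ q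
  ≡⇒≋ ≡.refl = ≋-intro λ _ → refl

  powP-varP : ∀ {n} (j : Fin n) a → powP (varP j) a ≋ monomial (a · unitVec j)
  powP-varP {n} j zero = ≡⇒≋ (≡.cong monomial (≡.sym (0·-≡𝟎 (unitVec j))))
  powP-varP {n} j (suc a) = begin
    varP j *ₚ powP (varP j) a ≈⟨ P.*-congˡ {varP j} (powP-varP j a) ⟩
    varP j *ₚ monomial (a · unitVec j) ≈⟨ monomial-⊕ (unitVec j) (a · unitVec j) ⟨
    monomial (unitVec j ⊕ a · unitVec j) ≡⟨ ≡.cong monomial (suc-· a (unitVec j)) ⟨
    monomial (suc a · unitVec j) ∎
    where
    module P = PolyRing n
    open PolyReasoning n

  powP-+ : ∀ {n} (p : Poly n) k l → powP p (k ℕ.+ l) ≋ (powP p k *ₚ powP p l)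
  powP-+ {n} p zero l = P.sym (P.*-identityˡ (powP p l))
    where module P = PolyRing n
  powP-+ {n} p (suc k) l = P.trans (P.*-congˡ {p} (powP-+ p k l)) (P.sym (P.*-assoc p (powP p k) (powP p l)))
    where module P = PolyRing n

  powP-1 : ∀ {n} (p : Poly n) → powP p 1 ≋ p
  powP-1 {n} p = PolyRing.*-identityʳ n p

  record Multiplicative {m n} (F : Poly m → Poly n) : Set (c ⊔ ℓ) where
    field
      F-cong : ∀ {p q} → p ≋ q → F p ≋ F q
      F-1 : F oneP ≋ oneP
      F-* : ∀ p q → F (p *ₚ q) ≋ (F p *ₚ F q)

    F-Π : ∀ {k} (f : Fin k → Poly m) → F (Π f) ≋ Π (F ∘ f)
    F-Π {zero} f = F-1
    F-Π {suc k} f = P.trans (F-* (f Fin.zero) (Π (f ∘ Fin.suc))) (P.*-congˡ {F (f Fin.zero)} (F-Π (f ∘ Fin.suc)))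
      where module P = PolyRing n

    F-powP : ∀ p k → F (powP p k) ≋ powP (F p) k
    F-powP p zero = F-1
    F-powP p (suc k) = P.trans (F-* p (powP p k)) (P.*-congˡ {F p} (F-powP p k))
      where module P = PolyRing n

  mapExponents : ∀ {m n} → (Vec ℕ m → Vec ℕ n) → Poly m → Poly n
  mapExponents h = List.map (λ t → (proj₁ t , h (proj₂ t)))

  ev-mapExponents : ∀ {m n} (h : Vec ℕ m → Vec ℕ n) φ p → ev φ (mapExponents h p) ≈ ev (φ ∘ h) p
  ev-mapExponents h φ [] = refl
  ev-mapExponents h φ (_ ∷ p) = +-congˡ (ev-mapExponents h φ p)

  mapExponents-multiplicative : ∀ {m n} {h : Vec ℕ m → Vec ℕ n} → Additive h → Multiplicative (mapExponents h)
  mapExponents-multiplicative {h = h} additive = record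
    { F-cong = λ {p q} e → ≋-intro λ φ → trans (ev-mapExponents h φ p) (trans (ev-≋ e _) (sym (ev-mapExponents h φ q)))
    ; F-1 = ≡⇒≋ (≡.cong monomial h-𝟎)
    ; F-* = λ p q → ≋-intro λ φ → begin
        ev φ (mapExponents h (p *ₚ q)) ≈⟨ ev-mapExponents h φ (p *ₚ q) ⟩
        ev (φ ∘ h) (p *ₚ q) ≈⟨ ev-*ₚ (φ ∘ h) p q ⟩
        ev (λ α → ev (λ β → φ (h (α ⊕ β))) q) p
          ≈⟨ ev-cong (λ α → ev-cong (λ β → reflexive (≡.cong φ (h-⊕ α β))) q) p ⟩
        ev (λ α → ev (λ β → φ (h α ⊕ h β)) q) p
          ≈⟨ ev-cong (λ α → sym (ev-mapExponents h _ q)) p ⟩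
        ev (λ α → ev (λ β → φ (h α ⊕ β)) (mapExponents h q)) p ≈⟨ sym (ev-mapExponents h _ p) ⟩
        ev (λ α → ev (λ β → φ (α ⊕ β)) (mapExponents h q)) (mapExponents h p)
          ≈⟨ sym (ev-*ₚ φ (mapExponents h p) (mapExponents h q)) ⟩
        ev φ (mapExponents h p *ₚ mapExponents h q) ∎
    }
    where
    open Additive additive
    open SetoidReasoning setoid

  mapExponents-+ : ∀ {m n} (h : Vec ℕ m → Vec ℕ n) p q → mapExponents h (p +ₚ q) ≡ mapExponents h p +ₚ mapExponents h q
  mapExponents-+ h p q = List.map-++ _ p q

  mapExponents-- : ∀ {m n} (h : Vec ℕ m → Vec ℕ n) p → mapExponents h (-ₚ p) ≡ -ₚ (mapExponents h p)
  mapExponents-- h p = ≡.trans (≡.sym (List.map-∘ p)) (List.map-∘ p)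

  monomialImage : ∀ {m n} → (Fin m → Poly n) → Vec ℕ m → Poly n
  monomialImage σ α = Π (λ i → powP (σ i) (lookup α i))

  prodP-toList-tabulate : ∀ {n k} (f : Fin k → Poly n) → prodP (Vec.toList (Vec.tabulate f)) ≡ Π f
  prodP-toList-tabulate {k = zero} f = ≡.refl
  prodP-toList-tabulate {k = suc k} f = ≡.cong (f Fin.zero *ₚ_) (prodP-toList-tabulate (f ∘ Fin.suc))

  substP-∷ : ∀ {m n} (σ : Fin m → Poly n) a α p →
    substP σ ((a , α) ∷ p) ≡ scaleP a (monomialImage σ α) +ₚ substP σ p
  substP-∷ σ a α p = ≡.cong (λ r → scaleP a r +ₚ substP σ p)
    (≡.trans (≡.cong (prodP ∘ Vec.toList) (≡.sym (Vec.tabulate-∘ (λ i → powP (σ i) (lookup α i)) (λ i → i))))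
      (prodP-toList-tabulate (λ i → powP (σ i) (lookup α i))))

  ev-substP : ∀ {m n} (σ : Fin m → Poly n) φ p → ev φ (substP σ p) ≈ ev (λ α → ev φ (monomialImage σ α)) p
  ev-substP σ φ [] = refl
  ev-substP σ φ ((a , α) ∷ p) = trans (reflexive (≡.cong (ev φ) (substP-∷ σ a α p)))
    (trans (ev-+ₚ φ (scaleP a (monomialImage σ α)) (substP σ p))
      (+-cong (ev-scaleP φ a (monomialImage σ α)) (ev-substP σ φ p)))

  monomialImage-⊕ : ∀ {m n} (σ : Fin m → Poly n) α β →
    monomialImage σ (α ⊕ β) ≋ (monomialImage σ α *ₚ monomialImage σ β)
  monomialImage-⊕ {m} {n} σ α β = P.trans (Π-cong λ i → P.trans
      (≡⇒≋ (≡.cong (powP (σ i)) (Vec.lookup-zipWith ℕ._+_ i α β)))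
      (powP-+ (σ i) (lookup α i) (lookup β i)))
    (Π-* (λ i → powP (σ i) (lookup α i)) (λ i → powP (σ i) (lookup β i)))
    where module P = PolyRing n

  monomialImage-𝟎 : ∀ {m n} (σ : Fin m → Poly n) → monomialImage σ 𝟎 ≋ oneP
  monomialImage-𝟎 {m} {n} σ = P.trans (Π-cong λ i → ≡⇒≋ (≡.cong (powP (σ i)) (Vec.lookup-replicate i 0))) (Π-1 m)
    where module P = PolyRing n

  monomialImage-unitVec : ∀ {m n} (σ : Fin m → Poly n) i → monomialImage σ (unitVec i) ≋ σ i
  monomialImage-unitVec {suc m} {n} σ Fin.zero =
    P.trans (P.*-cong (powP-1 (σ Fin.zero)) (monomialImage-𝟎 (σ ∘ Fin.suc))) (P.*-identityʳ (σ Fin.zero))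
    where module P = PolyRing n
  monomialImage-unitVec {suc m} {n} σ (Fin.suc i) =
    P.trans (P.*-identityˡ (monomialImage (σ ∘ Fin.suc) (unitVec i))) (monomialImage-unitVec (σ ∘ Fin.suc) i)
    where module P = PolyRing n

  substP-multiplicative : ∀ {m n} (σ : Fin m → Poly n) → Multiplicative (substP σ)
  substP-multiplicative σ = record
    { F-cong = λ {p q} e → ≋-intro λ φ → trans (ev-substP σ φ p) (trans (ev-≋ e _) (sym (ev-substP σ φ q)))
    ; F-1 = ≋-intro λ φ → trans (ev-substP σ φ oneP)
        (trans (ev-oneP (λ α → ev φ (monomialImage σ α))) (ev-≋ (monomialImage-𝟎 σ) φ))
    ; F-* = λ p q → ≋-intro λ φ → begin
        ev φ (substP σ (p *ₚ q)) ≈⟨ ev-substP σ φ (p *ₚ q) ⟩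
        ev (λ α → ev φ (monomialImage σ α)) (p *ₚ q) ≈⟨ ev-*ₚ _ p q ⟩
        ev (λ α → ev (λ β → ev φ (monomialImage σ (α ⊕ β))) q) p
          ≈⟨ ev-cong (λ α → ev-cong (λ β → trans (ev-≋ (monomialImage-⊕ σ α β) φ)
               (ev-*ₚ φ (monomialImage σ α) (monomialImage σ β))) q) p ⟩
        ev (λ α → ev (λ β → ev (λ γ → ev (λ δ → φ (γ ⊕ δ)) (monomialImage σ β)) (monomialImage σ α)) q) p
          ≈⟨ ev-cong (λ α → ev-swap _ q (monomialImage σ α)) p ⟩
        ev (λ α → ev (λ γ → ev (λ β → ev (λ δ → φ (γ ⊕ δ)) (monomialImage σ β)) q) (monomialImage σ α)) p
          ≈⟨ ev-cong (λ α → ev-cong (λ γ → sym (ev-substP σ _ q)) (monomialImage σ α)) p ⟩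
        ev (λ α → ev (λ γ → ev (λ δ → φ (γ ⊕ δ)) (substP σ q)) (monomialImage σ α)) p
          ≈⟨ sym (ev-substP σ _ p) ⟩
        ev (λ γ → ev (λ δ → φ (γ ⊕ δ)) (substP σ q)) (substP σ p) ≈⟨ sym (ev-*ₚ φ (substP σ p) (substP σ q)) ⟩
        ev φ (substP σ p *ₚ substP σ q) ∎
    }
    where open SetoidReasoning setoid

  substP-+ : ∀ {m n} (σ : Fin m → Poly n) p q → substP σ (p +ₚ q) ≋ (substP σ p +ₚ substP σ q)
  substP-+ σ p q = ≋-intro λ φ → trans (ev-substP σ φ (p +ₚ q)) (trans (ev-+ₚ _ p q)
    (sym (trans (ev-+ₚ φ (substP σ p) (substP σ q)) (+-cong (ev-substP σ φ p) (ev-substP σ φ q)))))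

  substP-- : ∀ {m n} (σ : Fin m → Poly n) p → substP σ (-ₚ p) ≋ (-ₚ substP σ p)
  substP-- σ p = ≋-intro λ φ → trans (ev-substP σ φ (-ₚ p)) (trans (ev--ₚ _ p)
    (sym (trans (ev--ₚ φ (substP σ p)) (-‿cong (ev-substP σ φ p)))))

  substP-scaleP : ∀ {m n} (σ : Fin m → Poly n) a p → substP σ (scaleP a p) ≋ scaleP a (substP σ p)
  substP-scaleP σ a p = ≋-intro λ φ → trans (ev-substP σ φ (scaleP a p)) (trans (ev-scaleP _ a p)
    (sym (trans (ev-scaleP φ a (substP σ p)) (*-congˡ (ev-substP σ φ p)))))

  substP-varP : ∀ {m n} (σ : Fin m → Poly n) i → substP σ (varP i) ≋ σ i
  substP-varP σ i = ≋-intro λ φ → trans (ev-substP σ φ (varP i))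
    (trans (ev-varP (λ α → ev φ (monomialImage σ α)) i) (ev-≋ (monomialImage-unitVec σ i) φ))

  substP-∘ : ∀ {l m n} (τ : Fin m → Poly n) (σ : Fin l → Poly m) p →
    substP τ (substP σ p) ≋ substP (substP τ ∘ σ) p
  substP-∘ τ σ p = ≋-intro λ φ → trans (ev-substP τ φ (substP σ p)) (trans (ev-substP σ _ p)
    (trans (ev-cong (λ α → trans (sym (ev-substP τ φ (monomialImage σ α))) (ev-≋ (image α) φ)) p)
      (sym (ev-substP (substP τ ∘ σ) φ p))))
    where
    open Multiplicative (substP-multiplicative τ)
    image : ∀ α → substP τ (monomialImage σ α) ≋ monomialImage (substP τ ∘ σ) α
    image α = CommutativeRing.trans (polyRing _) (F-Π λ i → powP (σ i) (lookup α i))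
      (Π-cong λ i → F-powP (σ i) (lookup α i))

  monomialImage-varP : ∀ {n k} (w : Vec (Fin n) k) α →
    monomialImage (λ i → varP (lookup w i)) α ≋ monomial (unitVec-act w α)
  monomialImage-varP {n} [] [] = PolyRing.refl n
  monomialImage-varP {n} (j ∷ w) (a ∷ α) = P.trans (P.*-cong (powP-varP j a) (monomialImage-varP w α))
    (P.sym (monomial-⊕ (a · unitVec j) (unitVec-act w α)))
    where module P = PolyRing n

  ev-substP-varP : ∀ {n k} (w : Vec (Fin n) k) φ p →
    ev φ (substP (λ i → varP (lookup w i)) p) ≈ ev (φ ∘ unitVec-act w) p
  ev-substP-varP w φ p = trans (ev-substP (λ i → varP (lookup w i)) φ p)
    (ev-cong (λ α → trans (ev-≋ (monomialImage-varP w α) φ) (ev-monomial φ _)) p)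

  powP-cong : ∀ {n} {p q : Poly n} → p ≋ q → ∀ k → powP p k ≋ powP q k
  powP-cong {n} e zero = PolyRing.refl n
  powP-cong {n} e (suc k) = PolyRing.*-cong n e (powP-cong e k)

  substP-cong : ∀ {m n} {σ τ : Fin m → Poly n} → (∀ i → σ i ≋ τ i) → ∀ p → substP σ p ≋ substP τ p
  substP-cong {m} {n} {σ} {τ} e p = ≋-intro λ φ → trans (ev-substP σ φ p)
    (trans (ev-cong (λ α → ev-≋ (Π-cong λ i → powP-cong (e i) (lookup α i)) φ) p) (sym (ev-substP τ φ p)))

  substP-identity : ∀ {n} (p : Poly n) → substP varP p ≋ p
  substP-identity {n} p = P.trans
    (substP-cong (λ i → ≡⇒≋ (≡.cong varP (≡.sym (Vec.lookup-allFin i)))) p)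
    (≋-intro λ φ → trans (ev-substP-varP (Vec.allFin n) φ p)
      (ev-cong (λ α → reflexive (≡.cong φ (unitVec-act-allFin α))) p))
    where module P = PolyRing n

  module _ {m n : ℕ} {ℓ′} {I : Poly n → Set ℓ′} (isIdeal : IsIdeal (polyRing n) I) where
    open Quotient (polyRing n) isIdeal
    private
      module P = PolyRing n
      module Q = CommutativeRing quotient

    -- Needed for the composite of ρ with u_k ↦ x₁ + ⋯ + x_k, which agrees with the identity
    -- substitution only modulo an ideal.
    substP-~ : {σ τ : Fin m → Poly n} → (∀ i → σ i ~ τ i) → ∀ p → substP σ p ~ substP τ p
    substP-~ e [] = Q.refl
    substP-~ {σ} {τ} e ((a , α) ∷ p) = ≡.subst₂ _~_ (≡.sym (substP-∷ σ a α p)) (≡.sym (substP-∷ τ a α p))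
      (Q.+-cong (Q.trans (≈⇒~ (scaleP≋ a (monomialImage σ α)))
          (Q.trans (Q.*-congˡ {constP a} (Π-~ λ i → powP-~ (e i) (lookup α i))) (≈⇒~ (P.sym (scaleP≋ a (monomialImage τ α))))))
        (substP-~ e p))
      where
      powP-~ : ∀ {p q} → p ~ q → ∀ k → powP p k ~ powP q k
      powP-~ e zero = Q.refl
      powP-~ e (suc k) = Q.*-cong e (powP-~ e k)
      Π-~ : ∀ {k} {f g : Fin k → Poly n} → (∀ i → f i ~ g i) → Π f ~ Π g
      Π-~ {zero} e = Q.refl
      Π-~ {suc k} e = Q.*-cong (e Fin.zero) (Π-~ (e ∘ Fin.suc))

  Homogeneous : ∀ {n} → ℕ → Poly n → Set c
  Homogeneous d = LAll.All (λ t → Vec.sum (proj₂ t) ≡ d)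

  homogeneous-+ : ∀ {n d} {p q : Poly n} → Homogeneous d p → Homogeneous d q → Homogeneous d (p +ₚ q)
  homogeneous-+ = LAll.++⁺

  homogeneous-- : ∀ {n d} {p : Poly n} → Homogeneous d p → Homogeneous d (-ₚ p)
  homogeneous-- = LAll.map⁺

  homogeneous-* : ∀ {n d e} {p q : Poly n} → Homogeneous d p → Homogeneous e q → Homogeneous (d ℕ.+ e) (p *ₚ q)
  homogeneous-* [] hq = []
  homogeneous-* {p = (a , α) ∷ p} (hα ∷ hp) hq = LAll.++⁺
    (LAll.map⁺ (LAll.map (λ {t} hβ → ≡.trans (sum-⊕ α (proj₂ t)) (≡.cong₂ ℕ._+_ hα hβ)) hq)) (homogeneous-* hp hq)

  homogeneous-constP : ∀ {n} a → Homogeneous {n} 0 (constP a)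
  homogeneous-constP {n} a = sum-𝟎 n ∷ []

  homogeneous-varP : ∀ {n} (i : Fin n) → Homogeneous 1 (varP i)
  homogeneous-varP i = sum-unitVec i ∷ []

  homogeneous-powP : ∀ {n d} {p : Poly n} → Homogeneous d p → ∀ k → Homogeneous (k ℕ.* d) (powP p k)
  homogeneous-powP {n} hp zero = homogeneous-constP {n} 1#
  homogeneous-powP {n} hp (suc k) = homogeneous-* hp (homogeneous-powP hp k)

  homogeneous-Π : ∀ {n k} {d : Fin k → ℕ} {f : Fin k → Poly n} → (∀ i → Homogeneous (d i) (f i)) → Homogeneous (∑ d) (Π f)
  homogeneous-Π {n} {zero} h = homogeneous-constP {n} 1#
  homogeneous-Π {n} {suc k} h = homogeneous-* (h Fin.zero) (homogeneous-Π (h ∘ Fin.suc))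

-- Strictly decreasing exponents and the staircase

swapAt : ∀ {A : Set} {n} → ℕ → Vec A n → Vec A n
swapAt a [] = []
swapAt (suc a) (x ∷ v) = x ∷ swapAt a v
swapAt zero (x ∷ []) = x ∷ []
swapAt zero (x ∷ y ∷ v) = y ∷ x ∷ v

-- This is n(n-1)/2, the degree of the Vandermonde product in n variables and the least sum of n
-- distinct naturals.
triangular : ℕ → ℕ
triangular zero = 0
triangular (suc n) = n ℕ.+ triangular n

staircase : ∀ n → Vec ℕ n
staircase zero = []
staircase (suc n) = n ∷ staircase n

sum-staircase : ∀ n → Vec.sum (staircase n) ≡ triangular n
sum-staircase zero = ≡.refl
sum-staircase (suc n) = ≡.cong (n ℕ.+_) (sum-staircase n)

staircase-< : ∀ n → VAll.All (ℕ._< n) (staircase n)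
staircase-< zero = []
staircase-< (suc n) = ℕ.≤-refl ∷ VAll.map ℕ.m≤n⇒m≤1+n (staircase-< n)

data Decreasing : ℕ → ∀ {n} → Vec ℕ n → Set where
  [] : ∀ {h} → Decreasing h []
  _∷_ : ∀ {h a n} {α : Vec ℕ n} → a ℕ.< h → Decreasing a α → Decreasing h (a ∷ α)

decreasing-length : ∀ {h n} {α : Vec ℕ n} → Decreasing h α → n ℕ.≤ h
decreasing-length [] = z≤n
decreasing-length (a<h ∷ α↓) = ℕ.≤-trans (s≤s (decreasing-length α↓)) a<h

decreasing-sum : ∀ {h n} {α : Vec ℕ n} → Decreasing h α → triangular n ℕ.≤ Vec.sum α
decreasing-sum [] = z≤n
decreasing-sum (_ ∷ α↓) = ℕ.+-mono-≤ (decreasing-length α↓) (decreasing-sum α↓)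

-- A strictly decreasing vector dominates the staircase entry by entry, so equal sums leave no slack
-- anywhere.
decreasing-minimal : ∀ {h n} {α : Vec ℕ n} → Decreasing h α → Vec.sum α ≡ triangular n → α ≡ staircase n
decreasing-minimal [] _ = ≡.refl
decreasing-minimal {n = suc n} {α = a ∷ α} (_ ∷ α↓) eq = ≡.cong₂ _∷_ a≡n (decreasing-minimal α↓ sum≡)
  where
  a≡n : a ≡ n
  a≡n = ℕ.≤-antisym (ℕ.+-cancelʳ-≤ (triangular n) a n
    (ℕ.≤-trans (ℕ.+-monoʳ-≤ a (decreasing-sum α↓)) (ℕ.≤-reflexive eq))) (decreasing-length α↓)
  sum≡ : Vec.sum α ≡ triangular n
  sum≡ = ℕ.+-cancelˡ-≡ n _ _ (≡.trans (≡.cong (ℕ._+ Vec.sum α) (≡.sym a≡n)) eq)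

entries-≤-sum : ∀ {n} (α : Vec ℕ n) → VAll.All (ℕ._< suc (Vec.sum α)) α
entries-≤-sum [] = []
entries-≤-sum (a ∷ α) = s≤s (ℕ.m≤m+n a _) ∷ VAll.map (λ b< → ℕ.≤-trans b< (s≤s (ℕ.m≤n+m _ a))) (entries-≤-sum α)

-- Folds over pairs of indices, and inversions

module PairFolds {c ℓ} (M : CommutativeMonoid c ℓ) where
  open CommutativeMonoid M
  open FiniteSum M using (sum; sum-cong-≋)

  foldMap : ∀ {A : Set} → (A → Carrier) → List A → Carrier
  foldMap F = List.foldr (λ x r → F x ∙ r) ε

  module _ {A : Set} (F : A → Carrier) where
    foldMap-filter : ∀ {ℓ′} {P : Pred A ℓ′} (P? : Decidable P) xs →
      foldMap F (List.filter P? xs) ≈ foldMap (λ x → if does (P? x) then F x else ε) xs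
    foldMap-filter P? [] = refl
    foldMap-filter P? (x ∷ xs) with does (P? x)
    ... | true = ∙-congˡ (foldMap-filter P? xs)
    ... | false = trans (foldMap-filter P? xs) (sym (identityˡ _))

    foldMap-++ : ∀ xs ys → foldMap F (xs ++ ys) ≈ foldMap F xs ∙ foldMap F ys
    foldMap-++ [] ys = sym (identityˡ _)
    foldMap-++ (x ∷ xs) ys = trans (∙-congˡ (foldMap-++ xs ys)) (sym (assoc _ _ _))

    foldMap-map : ∀ {B : Set} (g : B → A) xs → foldMap F (List.map g xs) ≡ foldMap (F ∘ g) xs
    foldMap-map g [] = ≡.refl
    foldMap-map g (x ∷ xs) = ≡.cong (_ ∙_) (foldMap-map g xs)

    foldMap-concatMap : ∀ {B : Set} (g : B → List A) xs → foldMap F (List.concatMap g xs) ≈ foldMap (λ x → foldMap F (g x)) xs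
    foldMap-concatMap g [] = refl
    foldMap-concatMap g (x ∷ xs) = trans (foldMap-++ (g x) _) (∙-congˡ (foldMap-concatMap g xs))

    foldMap-tabulate : ∀ {n} (f : Fin n → A) → foldMap F (Vec.toList (Vec.tabulate f)) ≡ sum (F ∘ f)
    foldMap-tabulate {zero} f = ≡.refl
    foldMap-tabulate {suc n} f = ≡.cong (_ ∙_) (foldMap-tabulate (f ∘ Fin.suc))

  -- Stated over a commutative monoid because it serves twice: additively on ℕ for counting
  -- inversions, and multiplicatively on polynomials for the Vandermonde product and the q-factor.
  foldMap-pairs : ∀ {n} (F : Fin n × Fin n → Carrier) →
    foldMap F (List.concatMap (λ i → List.map (λ j → (i , j)) (Vec.toList (Vec.allFin n))) (Vec.toList (Vec.allFin n)))
      ≈ sum (λ i → sum (λ j → F (i , j)))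
  foldMap-pairs {n} F = trans (foldMap-concatMap F row all)
    (trans (reflexive (foldMap-tabulate (foldMap F ∘ row) (λ i → i)))
      (sum-cong-≋ λ i → reflexive (≡.trans (foldMap-map F (i ,_) all) (foldMap-tabulate (λ j → F (i , j)) (λ j → j)))))
    where
    all = Vec.toList (Vec.allFin n)
    row : Fin n → List (Fin n × Fin n)
    row i = List.map (i ,_) all

below : ∀ {n k} → Fin n → Vec (Fin n) k → ℕ
below {k = k} x w = ∑ {k} λ j → if does (suc (toℕ (lookup w j)) ℕ.≤? toℕ x) then 1 else 0

-- A recursive count that makes sense for words of any length over `Fin n`, as the induction on
-- inserted letters requires.
inversionCount : ∀ {n k} → Vec (Fin n) k → ℕ
inversionCount [] = 0
inversionCount (x ∷ w) = below x w ℕ.+ inversionCount w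

private
  invertedPairs : ∀ {n k} → Vec (Fin n) k → ℕ
  invertedPairs {k = k} w = ∑ {k} λ i → ∑ {k} λ j →
    if does (suc (toℕ i) ℕ.≤? toℕ j) then (if does (suc (toℕ (lookup w j)) ℕ.≤? toℕ (lookup w i)) then 1 else 0) else 0

  invertedPairs-count : ∀ {n k} (w : Vec (Fin n) k) → invertedPairs w ≡ inversionCount w
  invertedPairs-count [] = ≡.refl
  invertedPairs-count (x ∷ w) = ≡.cong (below x w ℕ.+_) (invertedPairs-count w)

inversions≡count : ∀ {c ℓ} (R : CommutativeRing c ℓ) {n} (w : Vec (Fin n) n) → PolyOps.inversions R w ≡ inversionCount w
inversions≡count R {n} w = ≡.trans (length-foldMap (List.filter inverted? (PolyOps.ltPairs R n)))
  (≡.trans (foldMap-filter (λ _ → 1) inverted? (PolyOps.ltPairs R n))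
    (≡.trans (foldMap-filter inverted ascending? (PolyOps.allPairs R n))
      (≡.trans (foldMap-pairs {n} (λ p → if does (ascending? p) then inverted p else 0)) (invertedPairs-count w))))
  where
  open PairFolds ℕ.+-0-commutativeMonoid
  inverted? = λ (p : Fin n × Fin n) → suc (toℕ (lookup w (proj₂ p))) ℕ.≤? toℕ (lookup w (proj₁ p))
  inverted = λ p → if does (inverted? p) then 1 else 0
  ascending? = λ (p : Fin n × Fin n) → suc (toℕ (proj₁ p)) ℕ.≤? toℕ (proj₂ p)
  length-foldMap : ∀ {A : Set} (xs : List A) → List.length xs ≡ foldMap (λ _ → 1) xs
  length-foldMap [] = ≡.refl
  length-foldMap (x ∷ xs) = ≡.cong suc (length-foldMap xs)

below-zero : ∀ {n k} (w : Vec (Fin (suc n)) k) → below Fin.zero w ≡ 0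
below-zero [] = ≡.refl
below-zero (x ∷ w) = below-zero w

below-suc : ∀ {n k} (x : Fin n) (w : Vec (Fin n) k) → below (Fin.suc x) (Vec.map Fin.suc w) ≡ below x w
below-suc x [] = ≡.refl
below-suc x (y ∷ w) = ≡.cong (_ ℕ.+_) (below-suc x w)

inversionCount-suc : ∀ {n k} (w : Vec (Fin n) k) → inversionCount (Vec.map Fin.suc w) ≡ inversionCount w
inversionCount-suc [] = ≡.refl
inversionCount-suc (x ∷ w) = ≡.cong₂ ℕ._+_ (below-suc x w) (inversionCount-suc w)

-- Alternating functions of the exponent

module Alternation {c ℓ} (R : CommutativeRing c ℓ) where
  open CommutativeRing R renaming (Carrier to K) hiding (zero)
  open PolyOps R
  open Functionals R
  open Polynomials R
  open IntegerRingSolver R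
  open RingProperties ring
  open SetoidReasoning setoid

  AlternatingAt : ∀ {n} → ℕ → (Vec ℕ n → K) → Set ℓ
  AlternatingAt a φ = ∀ α → φ (swapAt a α) ≈ - φ α

  Alternating : ∀ {n} → (Vec ℕ n → K) → Set ℓ
  Alternating {n} φ = ∀ a → suc a ℕ.< n → AlternatingAt a φ

  alternating-head : ∀ {n} {φ : Vec ℕ (2 ℕ.+ n) → K} → Alternating φ →
    ∀ a b α → φ (a ∷ b ∷ α) ≈ - φ (b ∷ a ∷ α)
  alternating-head alt a b α = alt 0 (s≤s (s≤s z≤n)) (b ∷ a ∷ α)

  alternating-tail : ∀ {n} {φ : Vec ℕ (suc n) → K} → Alternating φ → ∀ a → Alternating (φ ∘ (a ∷_))
  alternating-tail alt a i i<n α = alt (suc i) (s≤s i<n) (a ∷ α)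

  -- Laplace expansion along a row: the sum over i of (-1)^i h(α_i, α with entry i deleted). The
  -- prefix `a ∷ γ` puts the entries already passed back in place.
  expand : ∀ {n} → (ℕ → Vec ℕ n → K) → Vec ℕ (suc n) → K
  expand {zero} h (a ∷ []) = h a []
  expand {suc n} h (a ∷ α) = h a α - expand (λ b γ → h b (a ∷ γ)) α

  expand-cong : ∀ {n} {h k : ℕ → Vec ℕ n → K} → (∀ a γ → h a γ ≈ k a γ) → ∀ α → expand h α ≈ expand k α
  expand-cong {zero} eq (a ∷ []) = eq a []
  expand-cong {suc n} eq (a ∷ α) = +-cong (eq a α) (-‿cong (expand-cong (λ b γ → eq b (a ∷ γ)) α))

  expand-vanishing : ∀ {n} {P : ℕ → Set} {h : ℕ → Vec ℕ n → K} → (∀ a γ → P a → h a γ ≈ 0#) →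
    ∀ {α} → VAll.All P α → expand h α ≈ 0#
  expand-vanishing {zero} eq {a ∷ []} (Pa ∷ []) = eq a [] Pa
  expand-vanishing {suc n} eq {a ∷ α} (Pa ∷ Pα) = trans
    (+-cong (eq a α Pa) (-‿cong (expand-vanishing (λ b γ → eq b (a ∷ γ)) Pα))) (-‿inverseʳ 0#)

  expand-+ : ∀ {n} (h k : ℕ → Vec ℕ n → K) α → expand (λ a γ → h a γ + k a γ) α ≈ expand h α + expand k α
  expand-+ {zero} h k (a ∷ []) = refl
  expand-+ {suc n} h k (a ∷ α) = trans (+-congˡ (-‿cong (expand-+ _ _ α)))
    (solve 4 (λ x y u v → (x :+ y) :- (u :+ v) := (x :- u) :+ (y :- v)) refl (h a α) (k a α)
      (expand (λ b γ → h b (a ∷ γ)) α) (expand (λ b γ → k b (a ∷ γ)) α))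

  expand-* : ∀ {n} s (h : ℕ → Vec ℕ n → K) α → expand (λ a γ → s * h a γ) α ≈ s * expand h α
  expand-* {zero} s h (a ∷ []) = refl
  expand-* {suc n} s h (a ∷ α) = trans (+-congˡ (-‿cong (expand-* s _ α)))
    (solve 3 (λ s x u → s :* x :- s :* u := s :* (x :- u)) refl s (h a α) (expand (λ b γ → h b (a ∷ γ)) α))

  expand-neg : ∀ {n} (h : ℕ → Vec ℕ n → K) α → expand (λ a γ → - h a γ) α ≈ - expand h α
  expand-neg h α = trans (expand-cong (λ a γ → sym (-1*x≈-x (h a γ))) α)
    (trans (expand-* (- 1#) h α) (-1*x≈-x _))

  expand-0 : ∀ {n} (α : Vec ℕ (suc n)) → expand (λ _ _ → 0#) α ≈ 0#
  expand-0 {zero} (a ∷ []) = refl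
  expand-0 {suc n} (a ∷ α) = trans (+-congˡ (-‿cong (expand-0 α))) (-‿inverseʳ 0#)

  -- Deleting two entries in either order leaves the same vector, but the signs are opposite,
  -- because deleting the earlier entry first shifts the position of the later one by one.
  expand-anticommute : ∀ {n} (h : ℕ → ℕ → Vec ℕ n → K) α →
    expand (λ a → expand (h a)) α ≈ - expand (λ a → expand (λ b → h b a)) α
  expand-anticommute {zero} h (a ∷ b ∷ []) =
    solve 2 (λ x y → x :- y := :- (y :- x)) refl (h a b []) (h b a [])
  expand-anticommute {suc n} h (a ∷ α) = begin
    expand (h a) α - expand (λ b γ → h b a γ - expand (λ c δ → h b c (a ∷ δ)) γ) α
      ≈⟨ +-congˡ (-‿cong (trans (expand-+ _ _ α) (+-congˡ (expand-neg _ α)))) ⟩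
    expand (h a) α - (expand (λ b → h b a) α - expand (λ b → expand (λ c δ → h b c (a ∷ δ))) α)
      ≈⟨ +-congˡ (-‿cong (+-congˡ (-‿cong (expand-anticommute (λ b c δ → h b c (a ∷ δ)) α)))) ⟩
    expand (h a) α - (expand (λ b → h b a) α - - expand (λ b → expand (λ c δ → h c b (a ∷ δ))) α)
      ≈⟨ solve 3 (λ x y z → x :- (y :- :- z) := :- (y :- (x :- z))) refl (expand (h a) α) (expand (λ b → h b a) α)
           (expand (λ b → expand (λ c δ → h c b (a ∷ δ))) α) ⟩
    - (expand (λ b → h b a) α - (expand (h a) α - expand (λ b → expand (λ c δ → h c b (a ∷ δ))) α))
      ≈⟨ -‿cong (+-congˡ (-‿cong (sym (trans (expand-+ _ _ α) (+-congˡ (expand-neg _ α)))))) ⟩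
    - (expand (λ b → h b a) α - expand (λ b γ → h a b γ - expand (λ c δ → h c b (a ∷ δ)) γ) α) ∎

  -- Exchanging two neighbours exchanges the two terms that delete one of them, whose signs differ;
  -- in every other term both survive as neighbours and h supplies the sign.
  expand-alternating : ∀ {n} {h : ℕ → Vec ℕ n → K} → (∀ b → Alternating (h b)) → Alternating (expand h)
  expand-alternating {zero} alt i (s≤s ()) α
  expand-alternating {suc zero} {h} alt zero _ (a ∷ b ∷ []) =
    solve 2 (λ x y → y :- x := :- (x :- y)) refl (h a (b ∷ [])) (h b (a ∷ []))
  expand-alternating {suc (suc n)} {h} alt zero _ (a ∷ b ∷ α) = begin
    h b (a ∷ α) - (h a (b ∷ α) - expand (λ d γ → h d (b ∷ a ∷ γ)) α)
      ≈⟨ +-congˡ (-‿cong (+-congˡ (-‿cong (trans (expand-cong (λ d γ → alternating-head (alt d) b a γ) α) (expand-neg _ α))))) ⟩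
    h b (a ∷ α) - (h a (b ∷ α) - - expand (λ d γ → h d (a ∷ b ∷ γ)) α)
      ≈⟨ solve 3 (λ x y z → y :- (x :- :- z) := :- (x :- (y :- z))) refl (h a (b ∷ α)) (h b (a ∷ α)) (expand (λ d γ → h d (a ∷ b ∷ γ)) α) ⟩
    - (h a (b ∷ α) - (h b (a ∷ α) - expand (λ d γ → h d (a ∷ b ∷ γ)) α)) ∎
  expand-alternating {suc n} {h} alt (suc i) (s≤s i<n) (a ∷ α) = begin
    h a (swapAt i α) - expand (λ b γ → h b (a ∷ γ)) (swapAt i α)
      ≈⟨ +-cong (alt a i i<n α) (-‿cong (expand-alternating (λ b → alternating-tail (alt b) a) i i<n α)) ⟩
    - h a α - - expand (λ b γ → h b (a ∷ γ)) α
      ≈⟨ solve 2 (λ x y → :- x :- :- y := :- (x :- y)) refl (h a α) (expand (λ b γ → h b (a ∷ γ)) α) ⟩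
    - (h a α - expand (λ b γ → h b (a ∷ γ)) α) ∎

  δ : ℕ → ℕ → K
  δ b a with a ℕ.≟ b
  ... | yes _ = 1#
  ... | no _ = 0#

  -- The determinant of the matrix [αᵢ = βⱼ], that is, the coefficient of x^β in the antisymmetrisation of x^α.
  det : ∀ {n} → Vec ℕ n → Vec ℕ n → K
  det [] α = 1#
  det (b ∷ β) α = expand (λ a γ → δ b a * det β γ) α

  det-alternating : ∀ {n} (β : Vec ℕ n) → Alternating (det β)
  det-alternating [] i ()
  det-alternating (b ∷ β) = expand-alternating λ a i i<n γ →
    trans (*-congˡ (det-alternating β i i<n γ)) (sym (-‿distribʳ-* _ _))

  -- Exchanging the first two rows exchanges the order of two successive Laplace expansions; lower
  -- rows are reached by induction inside the expansion.
  det-alternating′ : ∀ {n} (α : Vec ℕ n) → Alternating (λ β → det β α)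
  det-alternating′ α zero (s≤s (s≤s _)) (b ∷ b′ ∷ β) = begin
    expand (λ a γ → δ b′ a * expand (λ a′ γ′ → δ b a′ * det β γ′) γ) α
      ≈⟨ expand-cong (λ a γ → sym (expand-* (δ b′ a) _ γ)) α ⟩
    expand (λ a → expand (λ a′ γ′ → δ b′ a * (δ b a′ * det β γ′))) α
      ≈⟨ expand-anticommute (λ a a′ γ′ → δ b′ a * (δ b a′ * det β γ′)) α ⟩
    - expand (λ a → expand (λ a′ γ′ → δ b′ a′ * (δ b a * det β γ′))) α
      ≈⟨ -‿cong (expand-cong (λ a γ → trans
           (expand-cong (λ a′ γ′ → solve 3 (λ x y z → x :* (y :* z) := y :* (x :* z)) refl (δ b′ a′) (δ b a) (det β γ′)) γ)
           (expand-* (δ b a) _ γ)) α) ⟩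
    - expand (λ a γ → δ b a * expand (λ a′ γ′ → δ b′ a′ * det β γ′) γ) α ∎
  det-alternating′ α (suc i) (s≤s i<n) (b ∷ β) = trans
    (expand-cong (λ a γ → trans (*-congˡ (det-alternating′ γ i i<n β)) (sym (-‿distribʳ-* _ _))) α)
    (expand-neg _ α)

  δ-refl : ∀ a → δ a a ≈ 1#
  δ-refl a with a ℕ.≟ a
  ... | yes _ = refl
  ... | no a≢a = contradiction ≡.refl a≢a

  δ-≢ : ∀ {a b} → ¬ (a ≡ b) → δ b a ≈ 0#
  δ-≢ {a} {b} a≢b with a ℕ.≟ b
  ... | yes a≡b = contradiction a≡b a≢b
  ... | no _ = refl

  -- r is the sum of the entries that the recursion has passed and put back in front of γ.
  expand-homogeneous : ∀ {n} r s {h : ℕ → Vec ℕ n → K} → (∀ a γ → ¬ (a ℕ.+ (r ℕ.+ Vec.sum γ) ≡ s) → h a γ ≈ 0#) →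
    ∀ α → ¬ (r ℕ.+ Vec.sum α ≡ s) → expand h α ≈ 0#
  expand-homogeneous {zero} r s hom (a ∷ []) ≢s = hom a [] λ eq → ≢s (≡.trans (x∙yz≈y∙xz r a 0) eq)
  expand-homogeneous {suc n} r s hom (a ∷ α) ≢s = trans
    (+-cong (hom a α λ eq → ≢s (≡.trans (x∙yz≈y∙xz r a (Vec.sum α)) eq))
      (-‿cong (expand-homogeneous (r ℕ.+ a) s
        (λ b γ ≢s′ → hom b (a ∷ γ) λ eq → ≢s′ (≡.trans (≡.cong (b ℕ.+_) (ℕ.+-assoc r a _)) eq))
        α (λ eq → ≢s (≡.trans (≡.sym (ℕ.+-assoc r a _)) eq)))))
    (-‿inverseʳ 0#)

  det-homogeneous : ∀ {n} (β α : Vec ℕ n) → ¬ (Vec.sum α ≡ Vec.sum β) → det β α ≈ 0#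
  det-homogeneous [] [] ≢ = contradiction ≡.refl ≢
  det-homogeneous (b ∷ β) α ≢ = expand-homogeneous 0 (b ℕ.+ Vec.sum β) vanish α ≢
    where
    vanish : ∀ a γ → ¬ (a ℕ.+ Vec.sum γ ≡ b ℕ.+ Vec.sum β) → δ b a * det β γ ≈ 0#
    vanish a γ ≢′ with a ℕ.≟ b
    ... | yes ≡.refl = trans (*-congˡ (det-homogeneous β γ λ eq → ≢′ (≡.cong (a ℕ.+_) eq))) (zeroʳ _)
    ... | no _ = zeroˡ _

  det-staircase : ∀ n → det (staircase n) (staircase n) ≈ 1#
  det-staircase zero = refl
  det-staircase (suc zero) = trans (*-congʳ (δ-refl 0)) (*-identityˡ _)
  det-staircase (suc (suc n)) = begin
    δ m m * det (staircase m) (staircase m) - expand (λ b γ → δ m b * det (staircase m) (m ∷ γ)) (staircase m)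
      ≈⟨ +-cong (*-cong (δ-refl m) (det-staircase (suc n)))
           (-‿cong (expand-vanishing (λ a γ a<m → trans (*-congʳ (δ-≢ (ℕ.<⇒≢ a<m))) (zeroˡ _)) (staircase-< m))) ⟩
    1# * 1# - 0# ≈⟨ solve 0 (con (1 , 0) :* con (1 , 0) :- con (0 , 0) := con (1 , 0)) refl ⟩
    1# ∎
    where m = suc n

  -- `Alternating` only prescribes a change of sign. Absence of 2-torsion turns this into vanishing
  -- at vectors with two equal neighbouring entries.
  module TorsionFree (torsion-free : ∀ {x} → x ≈ - x → x ≈ 0#) where

    private
      -- One insertion of insertion sort: passing a larger entry costs a sign, meeting an equal one
      -- gives zero, and above a smaller one the vector is already decreasing. The bound h is kept
      -- for the entries in front.
      insert-vanishing : ∀ {n} {φ : Vec ℕ (suc n) → K} → Alternating φ → ∀ {h a} {α : Vec ℕ n} →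
        a ℕ.< h → Decreasing h α → (∀ γ → Decreasing h γ → Vec.sum γ ≡ a ℕ.+ Vec.sum α → φ γ ≈ 0#) → φ (a ∷ α) ≈ 0#
      insert-vanishing alt a<h [] vanish = vanish _ (a<h ∷ []) ≡.refl
      insert-vanishing {φ = φ} alt {h} {a} {b ∷ α} a<h (b<h ∷ α↓) vanish with ℕ.<-cmp a b
      ... | tri> _ _ b<a = vanish _ (a<h ∷ (b<a ∷ α↓)) ≡.refl
      ... | tri≈ _ ≡.refl _ = torsion-free (alternating-head alt a a α)
      ... | tri< a<b _ _ = trans (alternating-head alt a b α) (trans (-‿cong inserted) -0#≈0#)
        where
        inserted : φ (b ∷ a ∷ α) ≈ 0#
        inserted = insert-vanishing (alternating-tail alt b) a<b α↓ λ γ γ↓ sum≡ → vanish (b ∷ γ) (b<h ∷ γ↓)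
          (≡.trans (≡.cong (b ℕ.+_) sum≡) (≡.trans (≡.sym (ℕ.+-assoc b a _))
            (≡.trans (≡.cong (ℕ._+ Vec.sum α) (ℕ.+-comm b a)) (ℕ.+-assoc a b _))))

      -- Insertion sort from the right; the sum of the entries is preserved, so vanishing has to be
      -- known only at decreasing vectors of the same degree.
      sort-vanishing : ∀ {n} {φ : Vec ℕ n → K} → Alternating φ → ∀ {h} {α : Vec ℕ n} → VAll.All (ℕ._< h) α →
        (∀ γ → Decreasing h γ → Vec.sum γ ≡ Vec.sum α → φ γ ≈ 0#) → φ α ≈ 0#
      sort-vanishing alt [] vanish = vanish [] [] ≡.refl
      sort-vanishing alt {α = a ∷ α} (a<h ∷ α<h) vanish = sort-vanishing (alternating-tail alt a) α<h λ γ γ↓ sum≡ →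
        insert-vanishing alt a<h γ↓ λ γ′ γ′↓ sum≡′ → vanish γ′ γ′↓ (≡.trans sum≡′ (≡.cong (a ℕ.+_) sum≡))

    alternating-low : ∀ {n} {φ : Vec ℕ n → K} → Alternating φ → ∀ {α} → Vec.sum α ℕ.< triangular n → φ α ≈ 0#
    alternating-low alt {α} low = sort-vanishing alt (entries-≤-sum α) λ γ γ↓ sum≡ →
      contradiction (ℕ.≤-trans (decreasing-sum γ↓) (ℕ.≤-reflexive sum≡)) (ℕ.<⇒≱ low)

    alternating-staircase : ∀ {n} {φ : Vec ℕ n → K} → Alternating φ → φ (staircase n) ≈ 0# →
      ∀ {α} → Vec.sum α ≡ triangular n → φ α ≈ 0#
    alternating-staircase {φ = φ} alt φδ≈0 {α} sum≡ = sort-vanishing alt (entries-≤-sum α) λ γ γ↓ sum≡′ →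
      trans (reflexive (≡.cong φ (decreasing-minimal γ↓ (≡.trans sum≡′ sum≡)))) φδ≈0

-- Antisymmetrisation as a determinant

module Antisymmetrisation {c ℓ} (R : CommutativeRing c ℓ) where
  open CommutativeRing R renaming (Carrier to K) hiding (zero)
  open PolyOps R
  open Functionals R
  open Polynomials R
  open Alternation R
  open IntegerRingSolver R
  open RingProperties ring
  open SetoidReasoning setoid

  sumOver : {A : Set} → (A → K) → List A → K
  sumOver f [] = 0#
  sumOver f (x ∷ xs) = f x + sumOver f xs

  sumOver-++ : ∀ {A : Set} (f : A → K) xs ys → sumOver f (xs ++ ys) ≈ sumOver f xs + sumOver f ys
  sumOver-++ f [] ys = sym (+-identityˡ _)
  sumOver-++ f (x ∷ xs) ys = trans (+-congˡ (sumOver-++ f xs ys)) (sym (+-assoc _ _ _))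

  module _ {A : Set} where
    sumOver-cong-All : ∀ {P : A → Set} {f g : A → K} → (∀ x → P x → f x ≈ g x) →
      ∀ {xs} → LAll.All P xs → sumOver f xs ≈ sumOver g xs
    sumOver-cong-All eq [] = refl
    sumOver-cong-All eq (Px ∷ Pxs) = +-cong (eq _ Px) (sumOver-cong-All eq Pxs)

    sumOver-cong : ∀ {f g : A → K} → (∀ x → f x ≈ g x) → ∀ xs → sumOver f xs ≈ sumOver g xs
    sumOver-cong eq [] = refl
    sumOver-cong eq (x ∷ xs) = +-cong (eq x) (sumOver-cong eq xs)

    sumOver-* : ∀ s (f : A → K) xs → sumOver (λ x → s * f x) xs ≈ s * sumOver f xs
    sumOver-* s f [] = sym (zeroʳ s)
    sumOver-* s f (x ∷ xs) = trans (+-congˡ (sumOver-* s f xs)) (sym (distribˡ _ _ _))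

    module _ {B : Set} where
      sumOver-map : ∀ (f : B → K) (g : A → B) xs → sumOver f (List.map g xs) ≡ sumOver (f ∘ g) xs
      sumOver-map f g [] = ≡.refl
      sumOver-map f g (x ∷ xs) = ≡.cong (f (g x) +_) (sumOver-map f g xs)

      sumOver-concatMap : ∀ (f : B → K) (g : A → List B) xs →
        sumOver f (List.concatMap g xs) ≈ sumOver (λ x → sumOver f (g x)) xs
      sumOver-concatMap f g [] = refl
      sumOver-concatMap f g (x ∷ xs) = trans (sumOver-++ f (g x) _) (+-congˡ (sumOver-concatMap f g xs))

    expand-sumOver : ∀ {n} (h : A → ℕ → Vec ℕ n → K) xs α →
      sumOver (λ x → expand (h x) α) xs ≈ expand (λ a γ → sumOver (λ x → h x a γ) xs) α
    expand-sumOver h [] α = sym (expand-0 α)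
    expand-sumOver h (x ∷ xs) α = trans (+-congˡ (expand-sumOver h xs α)) (sym (expand-+ _ _ α))

    ev-sumOver : ∀ {n} (h : A → Vec ℕ n → K) xs p → sumOver (λ x → ev (h x) p) xs ≈ ev (λ α → sumOver (λ x → h x α) xs) p
    ev-sumOver h [] p = sym (ev-0 p)
    ev-sumOver h (x ∷ xs) p = trans (+-congˡ (ev-sumOver h xs p)) (sym (ev-+ _ _ p))

    ev-sumP : ∀ {n} (φ : Vec ℕ n → K) (f : A → Poly n) xs → ev φ (sumP (List.map f xs)) ≈ sumOver (λ x → ev φ (f x)) xs
    ev-sumP φ f [] = refl
    ev-sumP φ f (x ∷ xs) = trans (ev-+ₚ φ (f x) (sumP (List.map f xs))) (+-congˡ (ev-sumP φ f xs))

  insertAll-map : ∀ {A B : Set} (f : A → B) x {k} (ys : Vec A k) →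
    insertAll (f x) (Vec.map f ys) ≡ List.map (Vec.map f) (insertAll x ys)
  insertAll-map f x [] = ≡.refl
  insertAll-map f x (y ∷ ys) = ≡.cong (_ ∷_) (≡.trans (≡.cong (List.map (f y ∷_)) (insertAll-map f x ys))
    (≡.trans (≡.sym (List.map-∘ (insertAll x ys))) (List.map-∘ (insertAll x ys))))

  perms-map : ∀ {A B : Set} (f : A → B) {k} (xs : Vec A k) → perms (Vec.map f xs) ≡ List.map (Vec.map f) (perms xs)
  perms-map f [] = ≡.refl
  perms-map f (x ∷ xs) = ≡.trans (≡.cong (List.concatMap (insertAll (f x))) (perms-map f xs))
    (≡.trans (List.concatMap-map (insertAll (f x)) (Vec.map f) (perms xs))
      (≡.trans (List.concatMap-cong (insertAll-map f x) (perms xs))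
        (≡.sym (List.map-concatMap (Vec.map f) (insertAll x) (perms xs)))))

  sign : ∀ {n k} → Vec (Fin n) k → K
  sign w = signC (inversionCount w)

  signC-+ : ∀ a b → signC (a ℕ.+ b) ≈ signC a * signC b
  signC-+ zero b = sym (*-identityˡ _)
  signC-+ (suc a) b = trans (-‿cong (signC-+ a b)) (-‿distribˡ-* _ _)

  -- Wherever 0 is inserted, it lies below `suc y`, so it adds exactly one inversion with that
  -- letter.
  below-insertAll : ∀ {n k} (y : Fin n) (ys : Vec (Fin n) k) →
    LAll.All (λ w → below (Fin.suc y) w ≡ suc (below y ys)) (insertAll Fin.zero (Vec.map Fin.suc ys))
  below-insertAll y [] = ≡.refl ∷ []
  below-insertAll y (z ∷ ys) = ≡.cong suc (below-suc y (z ∷ ys)) ∷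
    LAll.map⁺ (LAll.map (λ eq → ≡.trans (≡.cong (here ℕ.+_) eq) (ℕ.+-suc here (below y ys))) (below-insertAll y ys))
    where here = if does (suc (toℕ z) ℕ.≤? toℕ y) then 1 else 0

  sign-zero∷ : ∀ {n k} (w : Vec (Fin n) k) → sign (Fin.zero ∷ Vec.map Fin.suc w) ≡ sign w
  sign-zero∷ w = ≡.cong signC (≡.cong₂ ℕ._+_ (below-zero (Vec.map Fin.suc w)) (inversionCount-suc w))

  unitVec-act-zero∷ : ∀ {n k} (w : Vec (Fin n) k) a α →
    unitVec-act (Fin.zero ∷ Vec.map Fin.suc w) (a ∷ α) ≡ a ∷ unitVec-act w α
  unitVec-act-zero∷ w a α = ≡.trans (≡.cong ((a · unitVec Fin.zero) ⊕_) (unitVec-act-suc w α))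
    (≡.cong₂ _∷_ (≡.trans (ℕ.+-identityʳ _) (ℕ.*-identityʳ a))
      (≡.trans (≡.cong (_⊕ unitVec-act w α) (·-𝟎 a)) (⊕-identityˡ _)))

  -- Inserting 0 at place i gives the exponent α_i to the first variable, leaves the other exponents
  -- to w, and adds i inversions: this is the i-th term of the Laplace expansion.
  sumOver-insertAll : ∀ {n k} (ψ : Vec ℕ (suc n) → K) (w : Vec (Fin n) k) α →
    sumOver (λ v → sign v * ψ (unitVec-act v α)) (insertAll Fin.zero (Vec.map Fin.suc w))
      ≈ expand (λ a γ → sign w * ψ (a ∷ unitVec-act w γ)) α
  sumOver-insertAll ψ [] (a ∷ []) = trans (+-identityʳ _) (*-congˡ (reflexive (≡.cong ψ (unitVec-act-zero∷ [] a []))))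
  sumOver-insertAll ψ w@(y ∷ ys) (a ∷ α) = +-cong
    (*-cong (reflexive (sign-zero∷ w)) (reflexive (≡.cong ψ (unitVec-act-zero∷ w a α)))) (begin
      sumOver F (List.map (Fin.suc y ∷_) inserted)
        ≡⟨ sumOver-map F (Fin.suc y ∷_) inserted ⟩
      sumOver (λ v → sign (Fin.suc y ∷ v) * ψ (shift (unitVec-act v α))) inserted
        ≈⟨ sumOver-cong-All (λ v below≡ → trans
             (*-congʳ (trans (signC-+ (below (Fin.suc y) v) (inversionCount v)) (*-congʳ (reflexive (≡.cong signC below≡)))))
             (*-assoc _ _ _)) (below-insertAll y ys) ⟩
      sumOver (λ v → - s * (sign v * ψ (shift (unitVec-act v α)))) inserted
        ≈⟨ sumOver-* (- s) (λ v → sign v * ψ (shift (unitVec-act v α))) inserted ⟩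
      - s * sumOver (λ v → sign v * ψ (shift (unitVec-act v α))) inserted
        ≈⟨ *-congˡ (sumOver-insertAll (ψ ∘ shift) ys α) ⟩
      - s * expand (λ b γ → sign ys * ψ (shift (b ∷ unitVec-act ys γ))) α
        ≈⟨ trans (sym (-‿distribˡ-* _ _)) (-‿cong (sym (expand-* s _ α))) ⟩
      - expand (λ b γ → s * (sign ys * ψ (shift (b ∷ unitVec-act ys γ)))) α
        ≈⟨ -‿cong (expand-cong (λ b γ → trans (sym (*-assoc _ _ _)) (*-cong
             (sym (signC-+ (below y ys) (inversionCount ys)))
             (reflexive (≡.cong (λ z → ψ (z ℕ.+ b ∷ (a · unitVec y) ⊕ unitVec-act ys γ)) (ℕ.*-zeroʳ a))))) α) ⟩
      - expand (λ b γ → sign w * ψ (b ∷ unitVec-act w (a ∷ γ))) α ∎)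
    where
    inserted = insertAll Fin.zero (Vec.map Fin.suc ys)
    s = signC (below y ys)
    F = λ v → sign v * ψ (unitVec-act v (a ∷ α))
    shift = (a · unitVec (Fin.suc y)) ⊕_

  χ-∷ : ∀ {n} b a (β α : Vec ℕ n) → χ (b ∷ β) (a ∷ α) ≈ δ b a * χ β α
  χ-∷ b a β α with a ℕ.≟ b | Vec.≡-dec ℕ._≟_ α β
  ... | yes ≡.refl | yes ≡.refl = sym (*-identityˡ 1#)
  ... | yes _ | no _ = sym (zeroʳ 1#)
  ... | no _ | _ = sym (zeroˡ _)

  -- `perms` builds each permutation by inserting 0 into a shifted permutation of the rest. Summing
  -- over the insertions expands the determinant along its first row, and induction evaluates the
  -- minors.
  sumOver-allPerms : ∀ {n} (β α : Vec ℕ n) → sumOver (λ w → sign w * χ β (unitVec-act w α)) (allPerms n) ≈ det β α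
  sumOver-allPerms [] [] = solve 0 (con (1 , 0) :* con (1 , 0) :+ con (0 , 0) := con (1 , 0)) refl
  sumOver-allPerms {suc n} (b ∷ β) α = begin
    sumOver F (allPerms (suc n))
      ≈⟨ sumOver-concatMap F (insertAll Fin.zero) (perms (Vec.tabulate Fin.suc)) ⟩
    sumOver (λ w → sumOver F (insertAll Fin.zero w)) (perms (Vec.tabulate Fin.suc))
      ≡⟨ ≡.cong (sumOver (λ w → sumOver F (insertAll Fin.zero w)))
           (≡.trans (≡.cong perms (Vec.tabulate-∘ Fin.suc (λ i → i))) (perms-map Fin.suc (Vec.allFin n))) ⟩
    sumOver (λ w → sumOver F (insertAll Fin.zero w)) (List.map (Vec.map Fin.suc) (allPerms n))
      ≡⟨ sumOver-map (λ w → sumOver F (insertAll Fin.zero w)) (Vec.map Fin.suc) (allPerms n) ⟩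
    sumOver (λ w → sumOver F (insertAll Fin.zero (Vec.map Fin.suc w))) (allPerms n)
      ≈⟨ sumOver-cong (λ w → sumOver-insertAll (χ (b ∷ β)) w α) (allPerms n) ⟩
    sumOver (λ w → expand (λ a γ → sign w * χ (b ∷ β) (a ∷ unitVec-act w γ)) α) (allPerms n)
      ≈⟨ expand-sumOver (λ w a γ → sign w * χ (b ∷ β) (a ∷ unitVec-act w γ)) (allPerms n) α ⟩
    expand (λ a γ → sumOver (λ w → sign w * χ (b ∷ β) (a ∷ unitVec-act w γ)) (allPerms n)) α
      ≈⟨ expand-cong (λ a γ → begin
           sumOver (λ w → sign w * χ (b ∷ β) (a ∷ unitVec-act w γ)) (allPerms n)
             ≈⟨ sumOver-cong (λ w → trans (*-congˡ (χ-∷ b a β (unitVec-act w γ)))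
                  (solve 3 (λ x y z → x :* (y :* z) := y :* (x :* z)) refl (sign w) (δ b a) (χ β (unitVec-act w γ)))) (allPerms n) ⟩
           sumOver (λ w → δ b a * (sign w * χ β (unitVec-act w γ))) (allPerms n)
             ≈⟨ sumOver-* (δ b a) (λ w → sign w * χ β (unitVec-act w γ)) (allPerms n) ⟩
           δ b a * sumOver (λ w → sign w * χ β (unitVec-act w γ)) (allPerms n)
             ≈⟨ *-congˡ (sumOver-allPerms β γ) ⟩
           δ b a * det β γ ∎) α ⟩
    det (b ∷ β) α ∎
    where
    F = λ w → sign w * χ (b ∷ β) (unitVec-act w α)

  coeff-antisym : ∀ {n} (g : Poly n) β → coeff (antisym g) β ≈ ev (det β) g
  coeff-antisym {n} g β = begin
    coeff (antisym g) β ≈⟨ coeff-ev (antisym g) β ⟩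
    ev (χ β) (antisym g) ≈⟨ ev-sumP (χ β) term (allPerms n) ⟩
    sumOver (λ w → ev (χ β) (term w)) (allPerms n)
      ≈⟨ sumOver-cong (λ w → begin
           ev (χ β) (term w) ≈⟨ ev-scaleP (χ β) _ (image w) ⟩
           signC (inversions w) * ev (χ β) (image w)
             ≈⟨ *-cong (reflexive (≡.cong signC (inversions≡count R w))) (ev-substP-varP w (χ β) g) ⟩
           sign w * ev (χ β ∘ unitVec-act w) g ≈⟨ ev-* (sign w) (χ β ∘ unitVec-act w) g ⟨
           ev (λ α → sign w * χ β (unitVec-act w α)) g ∎) (allPerms n) ⟩
    sumOver (λ w → ev (λ α → sign w * χ β (unitVec-act w α)) g) (allPerms n)
      ≈⟨ ev-sumOver (λ w α → sign w * χ β (unitVec-act w α)) (allPerms n) g ⟩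
    ev (λ α → sumOver (λ w → sign w * χ β (unitVec-act w α)) (allPerms n)) g
      ≈⟨ ev-cong (sumOver-allPerms β) g ⟩
    ev (det β) g ∎
    where
    image : Vec (Fin n) n → Poly n
    image w = substP (λ i → varP (lookup w i)) g
    term : Vec (Fin n) n → Poly n
    term w = scaleP (signC (inversions w)) (image w)

-- Adjacent transpositions and the Vandermonde product

swapAt-𝟎 : ∀ {n} a → swapAt a (𝟎 {n}) ≡ 𝟎
swapAt-𝟎 {zero} a = ≡.refl
swapAt-𝟎 {suc n} (suc a) = ≡.cong (0 ∷_) (swapAt-𝟎 a)
swapAt-𝟎 {suc zero} zero = ≡.refl
swapAt-𝟎 {suc (suc n)} zero = ≡.refl

swapAt-⊕ : ∀ {n} a (α β : Vec ℕ n) → swapAt a (α ⊕ β) ≡ swapAt a α ⊕ swapAt a β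
swapAt-⊕ a [] [] = ≡.refl
swapAt-⊕ (suc a) (x ∷ α) (y ∷ β) = ≡.cong (_ ∷_) (swapAt-⊕ a α β)
swapAt-⊕ zero (x ∷ []) (y ∷ []) = ≡.refl
swapAt-⊕ zero (x ∷ x′ ∷ α) (y ∷ y′ ∷ β) = ≡.refl

swapAt-involutive : ∀ {n} a (α : Vec ℕ n) → swapAt a (swapAt a α) ≡ α
swapAt-involutive a [] = ≡.refl
swapAt-involutive (suc a) (x ∷ α) = ≡.cong (x ∷_) (swapAt-involutive a α)
swapAt-involutive zero (x ∷ []) = ≡.refl
swapAt-involutive zero (x ∷ y ∷ α) = ≡.refl

swapAt-additive : ∀ {n} a → Additive (swapAt {n = n} a)
swapAt-additive a = record { h-𝟎 = swapAt-𝟎 a ; h-⊕ = swapAt-⊕ a }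

0∷-additive : ∀ {n} → Additive {n} (0 ∷_)
0∷-additive = record { h-𝟎 = ≡.refl ; h-⊕ = λ _ _ → ≡.refl }

swapFin : ∀ {n} → ℕ → Fin n → Fin n
swapFin (suc a) Fin.zero = Fin.zero
swapFin (suc a) (Fin.suc i) = Fin.suc (swapFin a i)
swapFin {suc zero} zero Fin.zero = Fin.zero
swapFin {suc (suc n)} zero Fin.zero = Fin.suc Fin.zero
swapFin {suc (suc n)} zero (Fin.suc Fin.zero) = Fin.zero
swapFin {suc (suc n)} zero (Fin.suc (Fin.suc i)) = Fin.suc (Fin.suc i)

module Products {c ℓ} (R : CommutativeRing c ℓ) where
  open CommutativeRing R renaming (Carrier to K) hiding (zero)
  open PolyOps R
  open Functionals R
  open Polynomials R
  open Alternation R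
  open SetoidReasoning setoid

  swapAt-unitVec : ∀ {n} a (i : Fin n) → swapAt a (unitVec i) ≡ unitVec (swapFin a i)
  swapAt-unitVec (suc a) Fin.zero = ≡.cong (1 ∷_) (swapAt-𝟎 a)
  swapAt-unitVec (suc a) (Fin.suc i) = ≡.cong (0 ∷_) (swapAt-unitVec a i)
  swapAt-unitVec {suc zero} zero Fin.zero = ≡.refl
  swapAt-unitVec {suc (suc n)} zero Fin.zero = ≡.refl
  swapAt-unitVec {suc (suc n)} zero (Fin.suc Fin.zero) = ≡.refl
  swapAt-unitVec {suc (suc n)} zero (Fin.suc (Fin.suc i)) = ≡.refl

  swapP : ∀ {n} → ℕ → Poly n → Poly n
  swapP a = mapExponents (swapAt a)

  shift : ∀ {n} → Poly n → Poly (suc n)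
  shift = mapExponents (0 ∷_)

  module SwapP {n} (a : ℕ) = Multiplicative (mapExponents-multiplicative (swapAt-additive {n} a))
  module Shift {n} = Multiplicative (mapExponents-multiplicative (0∷-additive {n}))

  linear : ∀ {n} → K → Fin n → Fin n → Poly n
  linear a i j = scaleP a (varP i) -ₚ varP j

  swapP-linear : ∀ {n} b a (i j : Fin n) → swapP b (linear a i j) ≡ linear a (swapFin b i) (swapFin b j)
  swapP-linear b a i j = ≡.cong₂ (λ α β → (a * 1# , α) ∷ (- 1# , β) ∷ []) (swapAt-unitVec b i) (swapAt-unitVec b j)

  homogeneous-linear : ∀ {n} a (i j : Fin n) → Homogeneous 1 (linear a i j)
  homogeneous-linear a i j = sum-unitVec i ∷ sum-unitVec j ∷ []

  Π-swapFin : ∀ {n k} a (f : Fin k → Poly n) → Π (f ∘ swapFin a) ≋ Π f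
  Π-swapFin {n} {zero} a f = PolyRing.refl n
  Π-swapFin {n} {suc k} (suc a) f = PolyRing.*-congˡ n {f Fin.zero} (Π-swapFin a (f ∘ Fin.suc))
  Π-swapFin {n} {suc zero} zero f = PolyRing.refl n
  Π-swapFin {n} {suc (suc k)} zero f = P.solve 3 (λ x y z → y P.:* (x P.:* z) P.:= x P.:* (y P.:* z)) P.refl
    (f Fin.zero) (f (Fin.suc Fin.zero)) (Π (λ i → f (Fin.suc (Fin.suc i))))
    where module P = PolyRing n

  foldMap-prodP : ∀ {n} {A : Set} (F : A → Poly n) xs →
    prodP (List.map F xs) ≡ PairFolds.foldMap (CommutativeRing.*-commutativeMonoid (polyRing n)) F xs
  foldMap-prodP F [] = ≡.refl
  foldMap-prodP F (x ∷ xs) = ≡.cong (F x *ₚ_) (foldMap-prodP F xs)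

  prodP-filter-allPairs : ∀ {n ℓ′} (F : Fin n × Fin n → Poly n) {P : Pred (Fin n × Fin n) ℓ′} (P? : Decidable P) →
    prodP (List.map F (List.filter P? (allPairs n))) ≋ Π (λ i → Π (λ j → if does (P? (i , j)) then F (i , j) else oneP))
  prodP-filter-allPairs {n} F P? = P.trans (P.reflexive (foldMap-prodP F (List.filter P? (allPairs n))))
    (P.trans (foldMap-filter F P? (allPairs n)) (foldMap-pairs (λ x → if does (P? x) then F x else oneP)))
    where
    open PairFolds (CommutativeRing.*-commutativeMonoid (polyRing n))
    module P = PolyRing n

  -- Peels the first row off an upper triangular table of factors. Both the Vandermonde product and
  -- the q-factor get their recursion in the number of variables from it.
  Π-Π-suc : ∀ {n k} (F : Fin (suc k) → Fin (suc k) → Poly (suc n)) (G : Fin k → Fin k → Poly n) →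
    (∀ i → F (Fin.suc i) Fin.zero ≡ oneP) → (∀ i j → F (Fin.suc i) (Fin.suc j) ≡ shift (G i j)) →
    Π (λ i → Π (F i)) ≋ (Π (F Fin.zero) *ₚ shift (Π (λ i → Π (G i))))
  Π-Π-suc {n} {k} F G first rest = P.*-congˡ {Π (F Fin.zero)} (P.trans
    (Π-cong λ i → P.trans (P.*-cong (≡⇒≋ (first i)) (Π-cong λ j → ≡⇒≋ (rest i j)))
      (P.trans (P.*-identityˡ (Π λ j → shift (G i j))) (P.sym (Shift.F-Π (G i)))))
    (P.sym (Shift.F-Π (λ i → Π (G i)))))
    where module P = PolyRing (suc n)

  private
    vTable : ∀ n → Fin n → Fin n → Poly n
    vTable n i j = if does (suc (toℕ i) ℕ.≤? toℕ j) then varP i -ₚ varP j else oneP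

  firstVandermondeRow : ∀ n → Poly (suc n)
  firstVandermondeRow n = Π λ (j : Fin n) → varP Fin.zero -ₚ varP (Fin.suc j)

  vandermonde-suc : ∀ n → vandermonde (suc n) ≋ (firstVandermondeRow n *ₚ shift (vandermonde n))
  vandermonde-suc n = P.trans (table (suc n)) (P.trans
    (Π-Π-suc (vTable (suc n)) (vTable n) (λ i → ≡.refl) shifted)
    (P.*-cong (P.*-identityˡ (firstVandermondeRow n)) (Shift.F-cong (CommutativeRing.sym (polyRing n) (table n)))))
    where
    module P = PolyRing (suc n)
    table : ∀ n → vandermonde n ≋ Π (λ i → Π (vTable n i))
    table n = prodP-filter-allPairs (λ (i , j) → varP i -ₚ varP j) (λ (i , j) → suc (toℕ i) ℕ.≤? toℕ j)
    shifted : ∀ i j → vTable (suc n) (Fin.suc i) (Fin.suc j) ≡ shift (vTable n i j)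
    shifted i j with does (suc (toℕ i) ℕ.≤? toℕ j)
    ... | true = ≡.refl
    ... | false = ≡.refl

  shift-swapP : ∀ {n} a (p : Poly n) → swapP (suc a) (shift p) ≡ shift (swapP a p)
  shift-swapP a p = ≡.trans (≡.sym (List.map-∘ p)) (List.map-∘ p)

  swapP-zero-shift² : ∀ {n} (p : Poly n) → swapP 0 (shift (shift p)) ≡ shift (shift p)
  swapP-zero-shift² [] = ≡.refl
  swapP-zero-shift² (_ ∷ p) = ≡.cong (_ ∷_) (swapP-zero-shift² p)

  -- A transposition of later variables permutes the factors of the first row, and induction gives
  -- the sign. The transposition of the first two variables negates x₀ - x₁, exchanges the
  -- remainders A and B of their rows, and fixes the rest.
  swapP-vandermonde : ∀ n a → suc a ℕ.< n → swapP a (vandermonde n) ≋ (-ₚ vandermonde n)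
  swapP-vandermonde (suc n) (suc a) (s≤s a<n) = P.trans (F-cong (vandermonde-suc n))
    (P.trans (F-* row (shift V)) (P.trans (P.*-cong row-symmetric shifted)
      (P.trans (P.solve 2 (λ x y → x P.:* P.:- y P.:= P.:- (x P.:* y)) P.refl row (shift V))
        (P.-‿cong (P.sym (vandermonde-suc n))))))
    where
    module P = PolyRing (suc n)
    open SwapP (suc a)
    V = vandermonde n
    row = firstVandermondeRow n
    row-symmetric : swapP (suc a) row ≋ row
    row-symmetric = P.trans (F-Π (λ j → varP Fin.zero -ₚ varP (Fin.suc j)))
      (P.trans (Π-cong λ j → ≡⇒≋ (≡.cong₂ (λ α β → (1# , α) ∷ (- 1# , β) ∷ [])
          (swapAt-unitVec (suc a) Fin.zero) (swapAt-unitVec (suc a) (Fin.suc j))))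
        (Π-swapFin a (λ j → varP Fin.zero -ₚ varP (Fin.suc j))))
    shifted : swapP (suc a) (shift V) ≋ (-ₚ shift V)
    shifted = P.trans (≡⇒≋ (shift-swapP a V)) (P.trans (Shift.F-cong (swapP-vandermonde n a a<n)) (≡⇒≋ (mapExponents-- (0 ∷_) V)))
  swapP-vandermonde (suc zero) zero (s≤s ())
  swapP-vandermonde (suc (suc n)) zero _ = P.trans (F-cong expanded) (P.trans
    (P.trans (F-* (d *ₚ A) (B *ₚ S)) (P.*-cong (F-* d A) (F-* B S)))
    (P.trans (P.*-cong (P.*-cong d-swapped A-swapped) (P.*-cong B-swapped (≡⇒≋ (swapP-zero-shift² V))))
      (P.trans (P.solve 4 (λ d A B S → (P.:- d P.:* B) P.:* (A P.:* S) P.:= P.:- ((d P.:* A) P.:* (B P.:* S))) P.refl d A B S)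
        (P.-‿cong (P.sym expanded)))))
    where
    module P = PolyRing (suc (suc n))
    open SwapP 0
    V = vandermonde n
    x₀ = Fin.zero
    x₁ = Fin.suc Fin.zero
    d = varP x₀ -ₚ varP x₁
    A = Π λ (j : Fin n) → varP x₀ -ₚ varP (Fin.suc (Fin.suc j))
    B = Π λ (j : Fin n) → varP x₁ -ₚ varP (Fin.suc (Fin.suc j))
    S = shift (shift V)
    expanded : vandermonde (suc (suc n)) ≋ ((d *ₚ A) *ₚ (B *ₚ S))
    expanded = P.trans (vandermonde-suc (suc n)) (P.*-congˡ {d *ₚ A} (P.trans (Shift.F-cong (vandermonde-suc n))
      (P.trans (Shift.F-* (firstVandermondeRow n) (shift V))
        (P.*-congʳ {S} (Shift.F-Π (λ j → varP Fin.zero -ₚ varP (Fin.suc j)))))))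
    d-swapped : swapP 0 d ≋ (-ₚ d)
    d-swapped = P.solve 2 (λ x y → y P.:- x P.:= P.:- (x P.:- y)) P.refl (varP x₀) (varP x₁)
    A-swapped : swapP 0 A ≋ B
    A-swapped = F-Π (λ j → varP x₀ -ₚ varP (Fin.suc (Fin.suc j)))
    B-swapped : swapP 0 B ≋ A
    B-swapped = F-Π (λ j → varP x₁ -ₚ varP (Fin.suc (Fin.suc j)))

  χ-swapAt : ∀ {n} a (β α : Vec ℕ n) → χ (swapAt a β) α ≈ χ β (swapAt a α)
  χ-swapAt a β α with Vec.≡-dec ℕ._≟_ α (swapAt a β)
  ... | yes ≡.refl = sym (trans (reflexive (≡.cong (χ β) (swapAt-involutive a β))) (χ-refl β))
  ... | no α≢ = sym (χ-≢ λ eq → α≢ (≡.trans (≡.sym (swapAt-involutive a α)) (≡.cong (swapAt a) eq)))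

  coeff-vandermonde-alternating : ∀ n → Alternating (coeff (vandermonde n))
  coeff-vandermonde-alternating n a a<n β = begin
    coeff V (swapAt a β) ≈⟨ coeff-ev V (swapAt a β) ⟩
    ev (χ (swapAt a β)) V ≈⟨ ev-cong (χ-swapAt a β) V ⟩
    ev (χ β ∘ swapAt a) V ≈⟨ ev-mapExponents (swapAt a) (χ β) V ⟨
    ev (χ β) (swapP a V) ≈⟨ ev-≋ (swapP-vandermonde n a a<n) (χ β) ⟩
    ev (χ β) (-ₚ V) ≈⟨ ev--ₚ (χ β) V ⟩
    - ev (χ β) V ≈⟨ -‿cong (coeff-ev V β) ⟨
    - coeff V β ∎
    where V = vandermonde n

-- Leading coefficients and first rows

𝟏 : ∀ {n} → Vec ℕ n
𝟏 = replicate _ 1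

sum-𝟏 : ∀ n → Vec.sum (𝟏 {n}) ≡ n
sum-𝟏 zero = ≡.refl
sum-𝟏 (suc n) = ≡.cong suc (sum-𝟏 n)

swapAt-𝟏 : ∀ {n} a → swapAt a (𝟏 {n}) ≡ 𝟏
swapAt-𝟏 {zero} a = ≡.refl
swapAt-𝟏 {suc n} (suc a) = ≡.cong (1 ∷_) (swapAt-𝟏 a)
swapAt-𝟏 {suc zero} zero = ≡.refl
swapAt-𝟏 {suc (suc n)} zero = ≡.refl

𝟏⊕staircase-∷ʳ : ∀ n → (𝟏 ⊕ staircase n) Vec.∷ʳ 0 ≡ staircase (suc n)
𝟏⊕staircase-∷ʳ zero = ≡.refl
𝟏⊕staircase-∷ʳ (suc n) = ≡.cong (suc n ∷_) (𝟏⊕staircase-∷ʳ n)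

∑-ones : ∀ n → ∑ {n} (λ _ → 1) ≡ n
∑-ones zero = ≡.refl
∑-ones (suc n) = ≡.cong suc (∑-ones n)

module Leading {c ℓ} (R : CommutativeRing c ℓ) where
  open CommutativeRing R renaming (Carrier to K) hiding (zero)
  open PolyOps R
  open Functionals R
  open Polynomials R
  open Alternation R
  open Antisymmetrisation R
  open Products R
  open SetoidReasoning setoid

  -- `Homogeneous` inspects the listed terms and is not invariant under `≋`, so a suitable
  -- presentation is carried along.
  Form : ∀ {n} → ℕ → Poly n → Set (c ⊔ ℓ)
  Form d p = Σ[ p′ ∈ Poly _ ] (p ≋ p′ × Homogeneous d p′)

  ev-form : ∀ {n d} {p : Poly n} → Form d p → ∀ {φ} → (∀ α → Vec.sum α ≡ d → φ α ≈ 0#) → ev φ p ≈ 0#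
  ev-form (p′ , p≋p′ , hom) {φ} vanish = trans (ev-≋ p≋p′ φ) (ev-vanishing-All vanish hom)

  homogeneous-shift : ∀ {n d} {p : Poly n} → Homogeneous d p → Homogeneous d (shift p)
  homogeneous-shift = LAll.map⁺

  vandermonde-form : ∀ n → Form (triangular n) (vandermonde n)
  vandermonde-form zero = oneP , PolyRing.refl 0 , homogeneous-constP {0} 1#
  vandermonde-form (suc n) with vandermonde-form n
  ... | V′ , V≋V′ , hom = firstVandermondeRow n *ₚ shift V′ ,
    P.trans (vandermonde-suc n) (P.*-congˡ {firstVandermondeRow n} (Shift.F-cong V≋V′)) ,
    ≡.subst (λ d → Homogeneous (d ℕ.+ triangular n) (firstVandermondeRow n *ₚ shift V′)) (∑-ones n)
      (homogeneous-* (homogeneous-Π {d = λ _ → 1} {f = λ j → varP Fin.zero -ₚ varP (Fin.suc j)}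
        (λ j → homogeneous-+ (homogeneous-varP Fin.zero) (homogeneous-- (homogeneous-varP (Fin.suc j)))))
        (homogeneous-shift hom))
    where module P = PolyRing (suc n)

  record Linear {n} (Λ : Poly n → K) : Set (c ⊔ ℓ) where
    field
      Λ-cong : ∀ {p p′} → p ≋ p′ → Λ p ≈ Λ p′
      Λ-+ : ∀ p p′ → Λ (p +ₚ p′) ≈ Λ p + Λ p′

  ev-linear : ∀ {n} (φ : Vec ℕ n → K) l r → Linear (λ g → ev φ (l *ₚ (g *ₚ r)))
  ev-linear {n} φ l r = record
    { Λ-cong = λ e → ev-≋ (P.*-congˡ {l} (P.*-congʳ {r} e)) φ
    ; Λ-+ = λ p p′ → trans (ev-≋ (P.solve 4 (λ p p′ l r → l P.:* ((p P.:+ p′) P.:* r) P.:= l P.:* (p P.:* r) P.:+ l P.:* (p′ P.:* r)) P.refl p p′ l r) φ)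
        (ev-+ₚ φ (l *ₚ (p *ₚ r)) (l *ₚ (p′ *ₚ r)))
    }
    where module P = PolyRing n

  -- In the expanded product every term containing some B j is killed by Λ, so a single term is
  -- left. The factor g collects the A j already chosen.
  pick : ∀ {n k} {Λ : Poly n → K} → Linear Λ → (A B : Fin k → Poly n) → (∀ j g → Λ (B j *ₚ g) ≈ 0#) →
    ∀ g → Λ (Π (λ j → B j +ₚ A j) *ₚ g) ≈ Λ (Π A *ₚ g)
  pick {k = zero} linear A B kill g = refl
  pick {n} {suc k} {Λ} linear A B kill g = begin
    Λ (((b +ₚ a) *ₚ rest) *ₚ g)
      ≈⟨ Λ-cong (P.solve 4 (λ a b r g → ((b P.:+ a) P.:* r) P.:* g P.:= b P.:* (r P.:* g) P.:+ r P.:* (a P.:* g)) P.refl a b rest g) ⟩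
    Λ ((b *ₚ (rest *ₚ g)) +ₚ (rest *ₚ (a *ₚ g))) ≈⟨ Λ-+ _ _ ⟩
    Λ (b *ₚ (rest *ₚ g)) + Λ (rest *ₚ (a *ₚ g)) ≈⟨ +-cong (kill Fin.zero _) (pick linear _ _ (kill ∘ Fin.suc) (a *ₚ g)) ⟩
    0# + Λ (Π (A ∘ Fin.suc) *ₚ (a *ₚ g)) ≈⟨ +-identityˡ _ ⟩
    Λ (Π (A ∘ Fin.suc) *ₚ (a *ₚ g))
      ≈⟨ Λ-cong (P.solve 3 (λ a r g → r P.:* (a P.:* g) P.:= (a P.:* r) P.:* g) P.refl a (Π (A ∘ Fin.suc)) g) ⟩
    Λ (Π A *ₚ g) ∎
    where
    open Linear linear
    module P = PolyRing n
    a = A Fin.zero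
    b = B Fin.zero
    rest = Π (λ j → B (Fin.suc j) +ₚ A (Fin.suc j))

  ev-monomial-* : ∀ {n} (φ : Vec ℕ n → K) α p → ev φ (monomial α *ₚ p) ≈ ev (λ β → φ (α ⊕ β)) p
  ev-monomial-* φ α p = trans (ev-*ₚ φ (monomial α) p) (ev-monomial (λ α → ev (λ β → φ (α ⊕ β)) p) α)

  ev-constP-* : ∀ {n} (φ : Vec ℕ n → K) a p → ev φ (constP a *ₚ p) ≈ a * ev φ p
  ev-constP-* φ a p = trans (sym (ev-≋ (scaleP≋ a p) φ)) (ev-scaleP φ a p)

  Π-varP-constant : ∀ {n} k (i : Fin n) → Π {_} {k} (λ _ → varP i) ≋ monomial (k · unitVec i)
  Π-varP-constant {n} k i = P.trans (power k) (powP-varP i k)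
    where
    module P = PolyRing n
    power : ∀ k → Π {_} {k} (λ _ → varP i) ≋ powP (varP i) k
    power zero = P.refl
    power (suc k) = P.*-congˡ {varP i} (power k)

  -- Choosing some -x_j in the first row raises the degree in the tail variables above that of the
  -- shorter staircase. Only x₀^n from the first row contributes, with coefficient 1, and the tail
  -- is the smaller case.
  coeff-vandermonde-staircase : ∀ n → coeff (vandermonde n) (staircase n) ≈ 1#
  coeff-vandermonde-staircase zero = +-identityʳ 1#
  coeff-vandermonde-staircase (suc n) = begin
    coeff (vandermonde (suc n)) γ ≈⟨ coeff-ev (vandermonde (suc n)) γ ⟩
    ev (χ γ) (vandermonde (suc n)) ≈⟨ ev-≋ (vandermonde-suc n) (χ γ) ⟩
    ev (χ γ) (firstVandermondeRow n *ₚ S) ≈⟨ ev-≋ (P.trans (P.*-congʳ {S} (Π-cong λ j → P.+-comm (varP x₀) (-ₚ varP (Fin.suc j)))) (unit-insert (Π λ (j : Fin n) → (-ₚ varP (Fin.suc j)) +ₚ varP x₀))) (χ γ) ⟩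
    Λ (Π (λ (j : Fin n) → (-ₚ varP (Fin.suc j)) +ₚ varP x₀) *ₚ oneP)
      ≈⟨ pick (ev-linear (χ γ) oneP S) (λ _ → varP x₀) (λ j → -ₚ varP (Fin.suc j)) kill oneP ⟩
    Λ (Π {_} {n} (λ _ → varP x₀) *ₚ oneP) ≈⟨ ev-≋ (P.trans (P.sym (unit-insert (Π {_} {n} (λ _ → varP x₀)))) (P.*-congʳ {S} (Π-varP-constant n x₀))) (χ γ) ⟩
    ev (χ γ) (monomial (n · unitVec x₀) *ₚ S) ≈⟨ ev-monomial-* (χ γ) (n · unitVec x₀) S ⟩
    ev (λ β → χ γ (n · unitVec x₀ ⊕ β)) S ≈⟨ ev-mapExponents (0 ∷_) _ (vandermonde n) ⟩
    ev (λ β → χ γ (n · unitVec x₀ ⊕ (0 ∷ β))) (vandermonde n)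
      ≈⟨ ev-cong (λ β → trans (reflexive (≡.cong (χ γ) (≡.cong₂ _∷_ (≡.trans (ℕ.+-identityʳ _) (ℕ.*-identityʳ n))
             (≡.trans (≡.cong (_⊕ β) (·-𝟎 n)) (⊕-identityˡ β)))))
           (trans (χ-∷ n n (staircase n) β) (trans (*-congʳ (δ-refl n)) (*-identityˡ _)))) (vandermonde n) ⟩
    ev (χ (staircase n)) (vandermonde n) ≈⟨ coeff-ev (vandermonde n) (staircase n) ⟨
    coeff (vandermonde n) (staircase n) ≈⟨ coeff-vandermonde-staircase n ⟩
    1# ∎
    where
    module P = PolyRing (suc n)
    γ = staircase (suc n)
    x₀ = Fin.zero {n}
    S = shift (vandermonde n)
    Λ : Poly (suc n) → K
    Λ g = ev (χ γ) (oneP *ₚ (g *ₚ S))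
    unit-insert : ∀ g → (g *ₚ S) ≋ (oneP *ₚ ((g *ₚ oneP) *ₚ S))
    unit-insert g = P.solve 2 (λ g S → g P.:* S P.:= P.con (1 , 0) P.:* ((g P.:* P.con (1 , 0)) P.:* S)) P.refl g S
    tail-degree : ∀ j g β → Vec.sum β ≡ triangular n → ¬ (unitVec (Fin.suc j) ⊕ (g ⊕ (0 ∷ β)) ≡ γ)
    tail-degree j (_ ∷ g) β sum≡ eq = ℕ.<-irrefl
      (≡.trans (≡.sym (sum-staircase n)) (≡.cong Vec.sum (≡.sym (Vec.∷-injectiveʳ eq))))
      (ℕ.≤-trans (s≤s (ℕ.≤-trans (ℕ.≤-reflexive (≡.sym sum≡)) (ℕ.m≤n+m (Vec.sum β) (Vec.sum g))))
        (ℕ.≤-reflexive (≡.sym (≡.trans (sum-⊕ (unitVec j) (g ⊕ β)) (≡.cong₂ ℕ._+_ (sum-unitVec j) (sum-⊕ g β))))))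
    kill : ∀ j g → Λ ((-ₚ varP (Fin.suc j)) *ₚ g) ≈ 0#
    kill j g = begin
      Λ ((-ₚ varP (Fin.suc j)) *ₚ g)
        ≈⟨ ev-≋ (P.solve 3 (λ x g S → P.con (1 , 0) P.:* ((P.:- x P.:* g) P.:* S) P.:= x P.:* (P.:- g P.:* S)) P.refl (varP (Fin.suc j)) g S) (χ γ) ⟩
      ev (χ γ) (varP (Fin.suc j) *ₚ ((-ₚ g) *ₚ S)) ≈⟨ ev-monomial-* (χ γ) (unitVec (Fin.suc j)) ((-ₚ g) *ₚ S) ⟩
      ev (λ β → χ γ (unitVec (Fin.suc j) ⊕ β)) ((-ₚ g) *ₚ S) ≈⟨ ev-*ₚ _ (-ₚ g) S ⟩
      ev (λ α → ev (λ β → χ γ (unitVec (Fin.suc j) ⊕ (α ⊕ β))) S) (-ₚ g)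
        ≈⟨ ev-vanishing (λ α → trans (ev-mapExponents (0 ∷_) _ (vandermonde n))
             (ev-form (vandermonde-form n) λ β sum≡ → χ-≢ (tail-degree j α β sum≡))) (-ₚ g) ⟩
      0# ∎

  module _ (q : K) where
    private
      qTable : ∀ n → Fin n → Fin n → Poly n
      qTable n i j = if does (suc (suc (toℕ i)) ℕ.≤? toℕ j) then linear q i j else oneP

    qFactor-table : ∀ n → qFactor n q ≋ Π (λ i → Π (qTable n i))
    qFactor-table n = prodP-filter-allPairs (λ (i , j) → linear q i j) (λ (i , j) → suc (suc (toℕ i)) ℕ.≤? toℕ j)

    -- There are n factors for n+2 variables: the pair of the first two variables is adjacent and
    -- has no factor.
    firstQRow : ∀ n → Poly (suc (suc n))
    firstQRow n = Π λ (j : Fin n) → linear q Fin.zero (Fin.suc (Fin.suc j))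

    qFactor-suc : ∀ n → qFactor (suc (suc n)) q ≋ (firstQRow n *ₚ shift (qFactor (suc n) q))
    qFactor-suc n = P.trans (qFactor-table (suc (suc n))) (P.trans
      (Π-Π-suc (qTable (suc (suc n))) (qTable (suc n)) (λ i → ≡.refl) shifted)
      (P.*-cong (P.trans (P.*-identityˡ (oneP *ₚ firstQRow n)) (P.*-identityˡ (firstQRow n)))
        (Shift.F-cong (CommutativeRing.sym (polyRing (suc n)) (qFactor-table (suc n))))))
      where
      module P = PolyRing (suc (suc n))
      shifted : ∀ i j → qTable (suc (suc n)) (Fin.suc i) (Fin.suc j) ≡ shift (qTable (suc n) i j)
      shifted i j with does (suc (suc (toℕ i)) ℕ.≤? toℕ j)
      ... | true = ≡.refl
      ... | false = ≡.refl

-- Functionals concentrated in the critical degree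

module Normalisation {c ℓ} (R : CommutativeRing c ℓ)
  (torsion-free : ∀ {x} → CommutativeRing._≈_ R x (CommutativeRing.-_ R x) → CommutativeRing._≈_ R x (CommutativeRing.0# R))
  (q : CommutativeRing.Carrier R) where
  open CommutativeRing R renaming (Carrier to K) hiding (zero)
  open PolyOps R
  open Functionals R
  open Polynomials R
  open Alternation R
  open TorsionFree torsion-free
  open Products R
  open Leading R
  open IntegerRingSolver R
  open RingProperties ring
  open SetoidReasoning setoid

  -- `det (staircase n)` is the instance used in the end. The property is treated abstractly because
  -- it survives fixing the first exponent at its maximum or at 0 with 𝟏 added to the others, and
  -- the inductions on n run through these restrictions.
  record Critical {n} (φ : Vec ℕ n → K) : Set ℓ where
    field
      alternating : Alternating φ
      concentrated : ∀ α → ¬ (Vec.sum α ≡ triangular n) → φ α ≈ 0#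

  critical-tail : ∀ {n} {φ : Vec ℕ (suc n) → K} → Critical φ → Critical (φ ∘ (n ∷_))
  critical-tail {n} crit = record
    { alternating = alternating-tail alternating n
    ; concentrated = λ α ≢ → concentrated (n ∷ α) λ eq → ≢ (ℕ.+-cancelˡ-≡ n _ _ eq)
    }
    where open Critical crit

  alternating-⊕ : ∀ {n} {φ : Vec ℕ n → K} γ → (∀ a → swapAt a γ ≡ γ) → Alternating φ → Alternating (λ α → φ (γ ⊕ α))
  alternating-⊕ {φ = φ} γ fixed alt a a<n α = trans
    (reflexive (≡.cong φ (≡.trans (≡.cong (_⊕ swapAt a α) (≡.sym (fixed a))) (≡.sym (swapAt-⊕ a γ α)))))
    (alt a a<n (γ ⊕ α))

  -- Adding the symmetric vector 𝟏 preserves alternation, but takes `suc n` from the critical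
  -- degree, so α lies below the least degree of an alternating function.
  critical-positive : ∀ {n} {φ : Vec ℕ (suc n) → K} → Critical φ → ∀ α → φ (𝟏 ⊕ α) ≈ 0#
  critical-positive {n} crit α with Vec.sum (𝟏 ⊕ α) ℕ.≟ triangular (suc n)
  ... | no ≢ = concentrated _ ≢
    where open Critical crit
  ... | yes eq = alternating-low (alternating-⊕ 𝟏 swapAt-𝟏 alternating)
      (ℕ.≤-trans (s≤s (ℕ.m≤n+m (Vec.sum α) n)) (ℕ.≤-reflexive (≡.trans (≡.sym degree) eq)))
    where
    open Critical crit
    degree : Vec.sum (𝟏 ⊕ α) ≡ suc n ℕ.+ Vec.sum α
    degree = ≡.trans (sum-⊕ 𝟏 α) (≡.cong (ℕ._+ Vec.sum α) (sum-𝟏 (suc n)))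

  -- A head above n leaves the n remaining entries less than `triangular n`.
  critical-large-head : ∀ {n} {φ : Vec ℕ (suc n) → K} → Critical φ → ∀ {a} α → n ℕ.< a → φ (a ∷ α) ≈ 0#
  critical-large-head {n} crit {a} α n<a with a ℕ.+ Vec.sum α ℕ.≟ triangular (suc n)
  ... | no ≢ = Critical.concentrated crit (a ∷ α) ≢
  ... | yes eq = alternating-low (alternating-tail (Critical.alternating crit) a)
    (ℕ.+-cancelˡ-< n _ _ (ℕ.<-≤-trans (ℕ.+-monoˡ-< (Vec.sum α) n<a) (ℕ.≤-reflexive eq)))

  alternating-rotate : ∀ {n} {φ : Vec ℕ (suc n) → K} → Alternating φ → ∀ a α → φ (a ∷ α) ≈ signC n * φ (α Vec.∷ʳ a)
  alternating-rotate alt a [] = sym (*-identityˡ _)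
  alternating-rotate {suc n} {φ} alt a (b ∷ α) = begin
    φ (a ∷ b ∷ α) ≈⟨ alternating-head alt a b α ⟩
    - φ (b ∷ a ∷ α) ≈⟨ -‿cong (alternating-rotate (alternating-tail alt b) a α) ⟩
    - (signC n * φ (b ∷ (α Vec.∷ʳ a))) ≈⟨ -‿distribˡ-* _ _ ⟩
    signC (suc n) * φ (b ∷ (α Vec.∷ʳ a)) ∎

  signC-square : ∀ n → signC n * signC n ≈ 1#
  signC-square zero = *-identityˡ 1#
  signC-square (suc n) = trans (solve 1 (λ x → :- x :* :- x := x :* x) refl (signC n)) (signC-square n)

  tailProduct : ∀ n → Poly (suc n)
  tailProduct n = Π λ (j : Fin n) → -ₚ varP (Fin.suc j)

  negatedProduct : ∀ n → Π (λ (j : Fin n) → -ₚ varP j) ≋ (constP (signC n) *ₚ monomial 𝟏)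
  negatedProduct zero = PolyRing.sym 0 (PolyRing.*-identityˡ 0 oneP)
  negatedProduct (suc n) = P.trans (P.*-congˡ { -ₚ x₀} (P.trans (P.sym (Shift.F-Π (λ j → -ₚ varP j)))
      (P.trans (Shift.F-cong (negatedProduct n)) (Shift.F-* (constP (signC n)) (monomial 𝟏)))))
    (P.trans (P.solve 3 (λ x s m → P.:- x P.:* (s P.:* m) P.:= P.:- s P.:* (x P.:* m)) P.refl x₀ (constP (signC n)) (monomial (0 ∷ 𝟏)))
      (P.*-congˡ {constP (signC (suc n))} (P.trans (P.sym (monomial-⊕ (unitVec Fin.zero) (0 ∷ 𝟏)))
        (≡⇒≋ (≡.cong (λ α → monomial (1 ∷ α)) (⊕-identityˡ 𝟏))))))
    where
    module P = PolyRing (suc n)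
    x₀ = varP {suc n} Fin.zero

  ev-tailProduct : ∀ {n} (φ : Vec ℕ (suc n) → K) p →
    ev φ (tailProduct n *ₚ p) ≈ signC n * ev (λ α → φ ((0 ∷ 𝟏) ⊕ α)) p
  ev-tailProduct {n} φ p = trans (ev-≋ (P.trans (P.*-congʳ {p} (P.trans (P.sym (Shift.F-Π (λ j → -ₚ varP j)))
      (P.trans (Shift.F-cong (negatedProduct n)) (Shift.F-* (constP (signC n)) (monomial 𝟏)))))
      (P.*-assoc (constP (signC n)) (monomial (0 ∷ 𝟏)) p)) φ)
    (trans (ev-constP-* φ (signC n) (monomial (0 ∷ 𝟏) *ₚ p)) (*-congˡ (ev-monomial-* φ (0 ∷ 𝟏) p)))
    where module P = PolyRing (suc n)

  x₀-term : ∀ {n} (g S : Poly (suc n)) →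
    ((scaleP q (varP Fin.zero) *ₚ g) *ₚ S) ≋ (monomial (unitVec Fin.zero) *ₚ ((constP q *ₚ g) *ₚ S))
  x₀-term {n} g S = P.trans (P.*-congʳ {S} (P.*-congʳ {g} (scaleP≋ q (varP Fin.zero))))
    (P.solve 4 (λ q x g S → ((q P.:* x) P.:* g) P.:* S P.:= x P.:* ((q P.:* g) P.:* S)) P.refl (constP q) (varP Fin.zero) g S)
    where module P = PolyRing (suc n)

  shift-tailProduct : ∀ n → shift (tailProduct n) ≋ Π λ (j : Fin n) → -ₚ varP (Fin.suc (Fin.suc j))
  shift-tailProduct n = Shift.F-Π (λ j → -ₚ varP (Fin.suc j))

  -- A functional killing the multiples of l·x₀ only sees the factors −xⱼ in the first row of the q-factor.
  ev-pick-tail : ∀ {n} (φ : Vec ℕ (suc (suc n)) → K) l →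
    (∀ h → ev φ (l *ₚ (monomial (unitVec Fin.zero) *ₚ h)) ≈ 0#) →
    ev φ (l *ₚ qFactor (suc (suc n)) q) ≈ ev φ (l *ₚ shift (tailProduct n *ₚ qFactor (suc n) q))
  ev-pick-tail {n} φ l kill = begin
    ev φ (l *ₚ qFactor (suc (suc n)) q) ≈⟨ ev-≋ (P.*-congˡ {l} (P.trans (qFactor-suc q n) (unit-insert (firstQRow q n)))) φ ⟩
    Λ (firstQRow q n *ₚ oneP)
      ≈⟨ pick (ev-linear φ l S) (λ j → -ₚ varP (Fin.suc (Fin.suc j))) (λ j → scaleP q (varP Fin.zero))
           (λ j g → trans (ev-≋ (P.*-congˡ {l} (x₀-term g S)) φ) (kill ((constP q *ₚ g) *ₚ S))) oneP ⟩
    Λ (Π (λ (j : Fin n) → -ₚ varP (Fin.suc (Fin.suc j))) *ₚ oneP)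
      ≈⟨ ev-≋ (P.*-congˡ {l} (P.trans (P.sym (unit-insert (Π λ (j : Fin n) → -ₚ varP (Fin.suc (Fin.suc j)))))
           (P.trans (P.*-congʳ {S} (P.sym (shift-tailProduct n))) (P.sym (Shift.F-* (tailProduct n) (qFactor (suc n) q)))))) φ ⟩
    ev φ (l *ₚ shift (tailProduct n *ₚ qFactor (suc n) q)) ∎
    where
    module P = PolyRing (suc (suc n))
    S = shift (qFactor (suc n) q)
    Λ : Poly (suc (suc n)) → K
    Λ g = ev φ (l *ₚ (g *ₚ S))
    unit-insert : ∀ g → (g *ₚ S) ≋ ((g *ₚ oneP) *ₚ S)
    unit-insert g = P.sym (P.*-congʳ {S} (P.*-identityʳ g))

  -- A further x₀ would make all exponents positive, so by `critical-positive` only the factors -x_j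
  -- of the first row count, and these form a smaller tail product. Induction applies to α ↦ φ (0 ∷
  -- (𝟏 ⊕ α)). Rotating the 0 to the end of the exponent costs the same sign as the minus signs of
  -- the product, and the two cancel.
  ev-tailProduct-qFactor : ∀ n {φ : Vec ℕ (suc n) → K} → Critical φ →
    ev φ (tailProduct n *ₚ qFactor (suc n) q) ≈ φ (staircase (suc n))
  ev-tailProduct-qFactor zero {φ} crit = trans (ev-≋ (PolyRing.*-identityˡ 1 oneP) φ) (ev-oneP φ)
  ev-tailProduct-qFactor (suc n) {φ} crit = begin
    ev φ (T *ₚ qFactor (suc (suc n)) q) ≈⟨ ev-pick-tail φ T kill ⟩
    ev φ (T *ₚ shift rest) ≈⟨ ev-tailProduct φ (shift rest) ⟩
    signC (suc n) * ev (λ α → φ ((0 ∷ 𝟏) ⊕ α)) (shift rest) ≈⟨ *-congˡ (ev-mapExponents (0 ∷_) _ rest) ⟩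
    signC (suc n) * ev (λ α → φ (0 ∷ (𝟏 ⊕ α))) rest ≈⟨ *-congˡ (ev-tailProduct-qFactor n crit′) ⟩
    signC (suc n) * φ (0 ∷ (𝟏 ⊕ staircase (suc n))) ≈⟨ *-congˡ (alternating-rotate alternating 0 (𝟏 ⊕ staircase (suc n))) ⟩
    signC (suc n) * (signC (suc n) * φ ((𝟏 ⊕ staircase (suc n)) Vec.∷ʳ 0))
      ≈⟨ trans (sym (*-assoc _ _ _)) (trans (*-congʳ (signC-square (suc n))) (*-identityˡ _)) ⟩
    φ ((𝟏 ⊕ staircase (suc n)) Vec.∷ʳ 0) ≡⟨ ≡.cong φ (𝟏⊕staircase-∷ʳ (suc n)) ⟩
    φ (staircase (suc (suc n))) ∎
    where
    open Critical crit
    T = tailProduct (suc n)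
    rest = tailProduct n *ₚ qFactor (suc n) q
    kill : ∀ h → ev φ (T *ₚ (monomial (unitVec Fin.zero) *ₚ h)) ≈ 0#
    kill h = trans (ev-tailProduct φ (monomial (unitVec Fin.zero) *ₚ h)) (trans (*-congˡ (trans
      (ev-monomial-* (λ α → φ ((0 ∷ 𝟏) ⊕ α)) (unitVec Fin.zero) h)
      (ev-vanishing (λ α → trans
        (reflexive (≡.cong φ (≡.trans (≡.sym (⊕-assoc (0 ∷ 𝟏) (unitVec Fin.zero) α))
          (≡.cong (λ β → (1 ∷ β) ⊕ α) (⊕-identityʳ 𝟏)))))
        (critical-positive crit α)) h))) (zeroʳ _))
    crit′ : Critical (λ α → φ (0 ∷ (𝟏 ⊕ α)))
    crit′ = record
      { alternating = alternating-⊕ 𝟏 swapAt-𝟏 (alternating-tail alternating 0)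
      ; concentrated = λ α ≢ → concentrated (0 ∷ (𝟏 ⊕ α)) λ eq → ≢ (ℕ.+-cancelˡ-≡ (suc n) _ _
          (≡.trans (≡.cong (ℕ._+ Vec.sum α) (≡.sym (sum-𝟏 (suc n)))) (≡.trans (≡.sym (sum-⊕ 𝟏 α)) eq)))
      }

  -- One more x₀ exceeds the largest admissible head, so only the factors -x_j of the first row
  -- count. With the head fixed at its maximum, φ is critical in the tail, where the tail product is
  -- already evaluated.
  ev-x₀-power : ∀ n {φ : Vec ℕ (suc n) → K} → Critical φ →
    ev φ (monomial (n · unitVec Fin.zero) *ₚ qFactor (suc n) q) ≈ φ (staircase (suc n))
  ev-x₀-power zero {φ} crit = trans (ev-≋ (PolyRing.*-identityˡ 1 oneP) φ) (ev-oneP φ)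
  ev-x₀-power (suc n) {φ} crit = begin
    ev φ (X *ₚ qFactor (suc (suc n)) q) ≈⟨ ev-pick-tail φ X kill ⟩
    ev φ (X *ₚ shift rest) ≈⟨ ev-monomial-* φ α₀ (shift rest) ⟩
    ev (λ α → φ (α₀ ⊕ α)) (shift rest) ≈⟨ ev-mapExponents (0 ∷_) _ rest ⟩
    ev (λ α → φ (α₀ ⊕ (0 ∷ α))) rest
      ≈⟨ ev-cong (λ α → reflexive (≡.cong φ (≡.cong₂ _∷_ (≡.trans (ℕ.+-identityʳ _) (ℕ.*-identityʳ (suc n)))
           (≡.trans (≡.cong (_⊕ α) (·-𝟎 (suc n))) (⊕-identityˡ α))))) rest ⟩
    ev (λ α → φ (suc n ∷ α)) rest ≈⟨ ev-tailProduct-qFactor n (critical-tail crit) ⟩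
    φ (staircase (suc (suc n))) ∎
    where
    α₀ = suc n · unitVec Fin.zero
    X = monomial α₀
    rest = tailProduct n *ₚ qFactor (suc n) q
    kill : ∀ h → ev φ (X *ₚ (monomial (unitVec Fin.zero) *ₚ h)) ≈ 0#
    kill h = trans (ev-monomial-* φ α₀ (monomial (unitVec Fin.zero) *ₚ h))
      (trans (ev-monomial-* (λ α → φ (α₀ ⊕ α)) (unitVec Fin.zero) h) (ev-vanishing large h))
      where
      large : ∀ α → φ (α₀ ⊕ (unitVec Fin.zero ⊕ α)) ≈ 0#
      large (a ∷ α) = critical-large-head crit _ (ℕ.≤-trans
        (ℕ.≤-reflexive (≡.trans (ℕ.+-comm 1 (suc n)) (≡.cong (ℕ._+ 1) (≡.sym (ℕ.*-identityʳ (suc n))))))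
        (ℕ.+-monoʳ-≤ (suc n ℕ.* 1) (s≤s z≤n)))

-- Splitting the variables into two blocks

swapAt-++ˡ : ∀ {k l} a (α : Vec ℕ k) (β : Vec ℕ l) → suc a ℕ.< k → swapAt a (α Vec.++ β) ≡ swapAt a α Vec.++ β
swapAt-++ˡ (suc a) (x ∷ α) β (s≤s a<k) = ≡.cong (x ∷_) (swapAt-++ˡ a α β a<k)
swapAt-++ˡ zero (x ∷ []) β (s≤s ())
swapAt-++ˡ zero (x ∷ y ∷ α) β _ = ≡.refl

swapAt-++ʳ : ∀ {k l} a (α : Vec ℕ k) (β : Vec ℕ l) → swapAt (k ℕ.+ a) (α Vec.++ β) ≡ α Vec.++ swapAt a β
swapAt-++ʳ a [] β = ≡.refl
swapAt-++ʳ a (x ∷ α) β = ≡.cong (x ∷_) (swapAt-++ʳ a α β)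

swapFin-↑ˡ-low : ∀ {k} l a (i : Fin k) → suc a ℕ.< k → swapFin a (i Fin.↑ˡ l) ≡ swapFin a i Fin.↑ˡ l
swapFin-↑ˡ-low l (suc a) Fin.zero _ = ≡.refl
swapFin-↑ˡ-low l (suc a) (Fin.suc i) (s≤s a<k) = ≡.cong Fin.suc (swapFin-↑ˡ-low l a i a<k)
swapFin-↑ˡ-low {suc zero} l zero i (s≤s ())
swapFin-↑ˡ-low {suc (suc k)} l zero Fin.zero _ = ≡.refl
swapFin-↑ˡ-low {suc (suc k)} l zero (Fin.suc Fin.zero) _ = ≡.refl
swapFin-↑ˡ-low {suc (suc k)} l zero (Fin.suc (Fin.suc i)) _ = ≡.refl

swapFin-↑ʳ-low : ∀ k {l} a (j : Fin l) → suc a ℕ.< k → swapFin a (k Fin.↑ʳ j) ≡ k Fin.↑ʳ j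
swapFin-↑ʳ-low (suc k) (suc a) j (s≤s a<k) = ≡.cong Fin.suc (swapFin-↑ʳ-low k a j a<k)
swapFin-↑ʳ-low (suc zero) zero j (s≤s ())
swapFin-↑ʳ-low (suc (suc k)) zero j _ = ≡.refl

swapFin-↑ˡ-high : ∀ {k} l a (i : Fin k) → swapFin (k ℕ.+ a) (i Fin.↑ˡ l) ≡ i Fin.↑ˡ l
swapFin-↑ˡ-high l a Fin.zero = ≡.refl
swapFin-↑ˡ-high l a (Fin.suc i) = ≡.cong Fin.suc (swapFin-↑ˡ-high l a i)

swapFin-↑ʳ-high : ∀ k {l} a (j : Fin l) → swapFin (k ℕ.+ a) (k Fin.↑ʳ j) ≡ k Fin.↑ʳ swapFin a j
swapFin-↑ʳ-high zero a j = ≡.refl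
swapFin-↑ʳ-high (suc k) a j = ≡.cong Fin.suc (swapFin-↑ʳ-high k a j)

++-⊕ : ∀ {k l} (α α′ : Vec ℕ k) (β β′ : Vec ℕ l) → (α Vec.++ β) ⊕ (α′ Vec.++ β′) ≡ (α ⊕ α′) Vec.++ (β ⊕ β′)
++-⊕ α α′ β β′ = Vec.zipWith-++ ℕ._+_ α β α′ β′

𝟎-++ : ∀ k l → 𝟎 {k} Vec.++ 𝟎 {l} ≡ 𝟎
𝟎-++ zero l = ≡.refl
𝟎-++ (suc k) l = ≡.cong (0 ∷_) (𝟎-++ k l)

sum-++ : ∀ {k l} (α : Vec ℕ k) (β : Vec ℕ l) → Vec.sum (α Vec.++ β) ≡ Vec.sum α ℕ.+ Vec.sum β
sum-++ [] β = ≡.refl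
sum-++ (a ∷ α) β = ≡.trans (≡.cong (a ℕ.+_) (sum-++ α β)) (≡.sym (ℕ.+-assoc a _ _))

triangular-+ : ∀ k l → triangular (k ℕ.+ l) ≡ triangular k ℕ.+ triangular l ℕ.+ k ℕ.* l
triangular-+ zero l = ≡.sym (ℕ.+-identityʳ _)
triangular-+ (suc k) l = ≡.trans (≡.cong ((k ℕ.+ l) ℕ.+_) (triangular-+ k l)) (arith k l (triangular k) (triangular l) (k ℕ.* l))
  where
  arith : ∀ k l s t m → k ℕ.+ l ℕ.+ (s ℕ.+ t ℕ.+ m) ≡ k ℕ.+ s ℕ.+ t ℕ.+ (l ℕ.+ m)
  arith = ℕSolver.solve-∀

∑-constant : ∀ n d → ∑ {n} (λ _ → d) ≡ n ℕ.* d
∑-constant zero d = ≡.refl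
∑-constant (suc n) d = ≡.cong (d ℕ.+_) (∑-constant n d)

module Parabolic {c ℓ} (R : CommutativeRing c ℓ)
  (torsion-free : ∀ {x} → CommutativeRing._≈_ R x (CommutativeRing.-_ R x) → CommutativeRing._≈_ R x (CommutativeRing.0# R))
  (q : CommutativeRing.Carrier R) where
  open CommutativeRing R renaming (Carrier to K) hiding (zero)
  open PolyOps R
  open Functionals R
  open Polynomials R
  open Alternation R
  open TorsionFree torsion-free
  open Products R
  open Leading R
  open Normalisation R torsion-free q
  open SetoidReasoning setoid

  embedˡ : ∀ {k} l → Poly k → Poly (k ℕ.+ l)
  embedˡ l = mapExponents (Vec._++ 𝟎)

  embedʳ : ∀ k {l} → Poly l → Poly (k ℕ.+ l)
  embedʳ k = mapExponents (𝟎 {k} Vec.++_)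

  ++𝟎-additive : ∀ {k} l → Additive (λ (α : Vec ℕ k) → α Vec.++ 𝟎 {l})
  ++𝟎-additive {k} l = record
    { h-𝟎 = 𝟎-++ k l
    ; h-⊕ = λ α β → ≡.sym (≡.trans (++-⊕ α β 𝟎 𝟎) (≡.cong ((α ⊕ β) Vec.++_) (⊕-identityˡ 𝟎)))
    }

  𝟎++-additive : ∀ k {l} → Additive (λ (α : Vec ℕ l) → 𝟎 {k} Vec.++ α)
  𝟎++-additive k {l} = record
    { h-𝟎 = 𝟎-++ k l
    ; h-⊕ = λ α β → ≡.sym (≡.trans (++-⊕ 𝟎 𝟎 α β) (≡.cong (Vec._++ (α ⊕ β)) (⊕-identityˡ (𝟎 {k}))))
    }

  module Embedˡ {k} l = Multiplicative (mapExponents-multiplicative (++𝟎-additive {k} l))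
  module Embedʳ k {l} = Multiplicative (mapExponents-multiplicative (𝟎++-additive k {l}))

  unitVec-↑ˡ : ∀ {k} l (i : Fin k) → unitVec (i Fin.↑ˡ l) ≡ unitVec i Vec.++ 𝟎
  unitVec-↑ˡ {suc k} l Fin.zero = ≡.cong (1 ∷_) (≡.sym (𝟎-++ k l))
  unitVec-↑ˡ l (Fin.suc i) = ≡.cong (0 ∷_) (unitVec-↑ˡ l i)

  unitVec-↑ʳ : ∀ k {l} (j : Fin l) → unitVec (k Fin.↑ʳ j) ≡ 𝟎 {k} Vec.++ unitVec j
  unitVec-↑ʳ zero j = ≡.refl
  unitVec-↑ʳ (suc k) j = ≡.cong (0 ∷_) (unitVec-↑ʳ k j)

  linear-≡ : ∀ {n} (i j : Fin n) {α β} → unitVec i ≡ α → unitVec j ≡ β → linear q i j ≡ (q * 1# , α) ∷ (- 1# , β) ∷ []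
  linear-≡ i j ≡.refl ≡.refl = ≡.refl

  -- The lift x₁ + ⋯ + x_k of the generator u_k.
  prefixSum : ∀ {n} → ℕ → Poly n
  prefixSum {zero} k = zeroP
  prefixSum {suc n} zero = zeroP
  prefixSum {suc n} (suc k) = varP Fin.zero +ₚ shift (prefixSum k)

  prefixSum-zero : ∀ {n} → prefixSum {n} 0 ≡ zeroP
  prefixSum-zero {zero} = ≡.refl
  prefixSum-zero {suc n} = ≡.refl

  prefixSum-suc : ∀ {n} (j : Fin n) → prefixSum (suc (toℕ j)) ≋ (prefixSum (toℕ j) +ₚ varP j)
  prefixSum-suc {suc n} Fin.zero = ≡⇒≋ (≡.cong (λ p → varP Fin.zero +ₚ shift p) (prefixSum-zero {n}))
  prefixSum-suc {suc n} (Fin.suc j) = P.trans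
    (P.+-congˡ {varP Fin.zero} (P.trans (Shift.F-cong (prefixSum-suc j)) (≡⇒≋ (mapExponents-+ (0 ∷_) (prefixSum (toℕ j)) (varP j)))))
    (P.sym (P.+-assoc (varP Fin.zero) (shift (prefixSum (toℕ j))) (varP (Fin.suc j))))
    where module P = PolyRing (suc n)

  homogeneous-prefixSum : ∀ {n} k → Homogeneous 1 (prefixSum {n} k)
  homogeneous-prefixSum {zero} k = []
  homogeneous-prefixSum {suc n} zero = []
  homogeneous-prefixSum {suc n} (suc k) = homogeneous-+ (homogeneous-varP {suc n} Fin.zero) (homogeneous-shift (homogeneous-prefixSum k))

  prefixSum-symmetric : ∀ n a → suc a ℕ.< n → swapP a (prefixSum {n} n) ≋ prefixSum {n} n
  prefixSum-symmetric (suc n) (suc a) (s≤s a<n) = P.+-cong (≡⇒≋ (≡.cong monomial (swapAt-unitVec (suc a) Fin.zero)))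
    (P.trans (≡⇒≋ (shift-swapP a (prefixSum n))) (Shift.F-cong (prefixSum-symmetric n a a<n)))
    where module P = PolyRing (suc n)
  prefixSum-symmetric (suc zero) zero (s≤s ())
  prefixSum-symmetric (suc (suc n)) zero _ = P.trans
    (P.+-congˡ {varP x₁} (P.+-congˡ {varP x₀} (≡⇒≋ (swapP-zero-shift² (prefixSum n)))))
    (P.solve 3 (λ x y z → y P.:+ (x P.:+ z) P.:= x P.:+ (y P.:+ z)) P.refl (varP x₀) (varP x₁) (shift (shift (prefixSum n))))
    where
    module P = PolyRing (suc (suc n))
    x₀ = Fin.zero
    x₁ = Fin.suc Fin.zero

  prefixSum-embed : ∀ k l → prefixSum {k ℕ.+ l} k ≡ embedˡ l (prefixSum {k} k)
  prefixSum-embed zero l = prefixSum-zero {l}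
  prefixSum-embed (suc k) l = ≡.cong₂ (λ α p → (1# , 1 ∷ α) ∷ p) (≡.sym (𝟎-++ k l))
    (≡.trans (≡.cong shift (prefixSum-embed k l)) (≡.trans (≡.sym (List.map-∘ (prefixSum {k} k))) (List.map-∘ (prefixSum {k} k))))

  swapP-embedˡ-low : ∀ {k} l a (p : Poly k) → suc a ℕ.< k → swapP a (embedˡ l p) ≡ embedˡ l (swapP a p)
  swapP-embedˡ-low l a [] a<k = ≡.refl
  swapP-embedˡ-low l a ((x , α) ∷ p) a<k = ≡.cong₂ (λ β r → (x , β) ∷ r) (swapAt-++ˡ a α 𝟎 a<k) (swapP-embedˡ-low l a p a<k)

  swapP-embedˡ-high : ∀ {k} l a (p : Poly k) → swapP (k ℕ.+ a) (embedˡ l p) ≡ embedˡ l p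
  swapP-embedˡ-high l a [] = ≡.refl
  swapP-embedˡ-high l a ((x , α) ∷ p) = ≡.cong₂ (λ β r → (x , β) ∷ r)
    (≡.trans (swapAt-++ʳ a α 𝟎) (≡.cong (α Vec.++_) (swapAt-𝟎 a))) (swapP-embedˡ-high l a p)

  -- The transposition can be moved through S onto φ. The lemma concerns one transposition at a
  -- time, since S will be symmetric only within blocks.
  symmetric-multiplier : ∀ {n a} {φ : Vec ℕ n → K} {S} → swapP a S ≋ S → AlternatingAt a φ →
    AlternatingAt a (λ γ → ev (λ α → φ (α ⊕ γ)) S)
  symmetric-multiplier {a = a} {φ} {S} sym-S alt γ = begin
    ev (λ α → φ (α ⊕ swapAt a γ)) S ≈⟨ ev-≋ sym-S _ ⟨
    ev (λ α → φ (α ⊕ swapAt a γ)) (swapP a S) ≈⟨ ev-mapExponents (swapAt a) _ S ⟩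
    ev (λ α → φ (swapAt a α ⊕ swapAt a γ)) S ≈⟨ ev-cong (λ α → trans (reflexive (≡.cong φ (≡.sym (swapAt-⊕ a α γ)))) (alt (α ⊕ γ))) S ⟩
    ev (λ α → - φ (α ⊕ γ)) S ≈⟨ ev-neg _ S ⟩
    - ev (λ α → φ (α ⊕ γ)) S ∎

  ev-*-multiplier : ∀ {n} (φ : Vec ℕ n → K) S h → ev φ (S *ₚ h) ≈ ev (λ γ → ev (λ α → φ (α ⊕ γ)) S) h
  ev-*-multiplier φ S h = trans (ev-*ₚ φ S h) (ev-swap (λ α γ → φ (α ⊕ γ)) S h)

  -- The sum of all variables is symmetric, so it leaves an alternating functional with one degree
  -- less to spend: below `triangular n` that functional vanishes, and from there on the total
  -- degree overshoots the critical one.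
  critical-e₁ : ∀ {n} {φ : Vec ℕ n → K} → Critical φ → ∀ h → ev φ (prefixSum n *ₚ h) ≈ 0#
  critical-e₁ {n} {φ} crit h = trans (ev-*-multiplier φ (prefixSum n) h) (ev-vanishing vanish h)
    where
    open Critical crit
    vanish : ∀ γ → ev (λ α → φ (α ⊕ γ)) (prefixSum n) ≈ 0#
    vanish γ with Vec.sum γ ℕ.<? triangular n
    ... | yes low = alternating-low (λ a a<n → symmetric-multiplier {S = prefixSum n} (prefixSum-symmetric n a a<n) (alternating a a<n)) low
    ... | no ≮ = ev-vanishing-All (λ α sum≡1 → concentrated (α ⊕ γ) λ eq →
        ≮ (ℕ.≤-reflexive (≡.trans (≡.cong (ℕ._+ Vec.sum γ) (≡.sym sum≡1)) (≡.trans (≡.sym (sum-⊕ α γ)) eq))))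
      (homogeneous-prefixSum n)

  -- Among n+1 variables there are n(n+1)/2 pairs, n of them adjacent, which leaves n(n-1)/2
  -- factors.
  qFactor-form : ∀ n → Form (triangular n) (qFactor (suc n) q)
  qFactor-form zero = oneP , PolyRing.refl 1 , homogeneous-constP {1} 1#
  qFactor-form (suc n) with qFactor-form n
  ... | Q , eq , hom = firstQRow q n *ₚ shift Q ,
    P.trans (qFactor-suc q n) (P.*-congˡ {firstQRow q n} (Shift.F-cong eq)) ,
    ≡.subst (λ d → Homogeneous (d ℕ.+ triangular n) (firstQRow q n *ₚ shift Q)) (∑-ones n)
      (homogeneous-* (homogeneous-Π {d = λ _ → 1} {f = λ j → linear q Fin.zero (Fin.suc (Fin.suc j))}
        (λ j → homogeneous-linear q Fin.zero (Fin.suc (Fin.suc j)))) (homogeneous-shift hom))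
    where module P = PolyRing (suc (suc n))

  Π-split : ∀ {n} k l (f : Fin (k ℕ.+ l) → Poly n) →
    Π f ≋ (Π (λ i → f (i Fin.↑ˡ l)) *ₚ Π (λ j → f (k Fin.↑ʳ j)))
  Π-split {n} zero l f = P.sym (P.*-identityˡ (Π f))
    where module P = PolyRing n
  Π-split {n} (suc k) l f = P.trans (P.*-congˡ {f Fin.zero} (Π-split k l (f ∘ Fin.suc)))
    (P.sym (P.*-assoc (f Fin.zero) (Π (λ i → f (Fin.suc i Fin.↑ˡ l))) (Π (λ j → f (suc k Fin.↑ʳ j)))))
    where module P = PolyRing n

  Π-except-last : ∀ {n} k (f g : Fin (suc k) → Poly n) → f (Fin.fromℕ k) ≋ oneP →
    (∀ i → toℕ i ℕ.< k → f i ≋ g i) → (Π f *ₚ g (Fin.fromℕ k)) ≋ Π g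
  Π-except-last {n} zero f g last _ = P.trans (P.*-congʳ {g Fin.zero} (P.trans (P.*-congʳ {oneP} last) (P.*-identityˡ oneP)))
    (P.*-comm oneP (g Fin.zero))
    where module P = PolyRing n
  Π-except-last {n} (suc k) f g last rest = P.trans (P.*-assoc (f Fin.zero) (Π (f ∘ Fin.suc)) (g (Fin.fromℕ (suc k))))
    (P.*-cong (rest Fin.zero (s≤s z≤n)) (Π-except-last k (f ∘ Fin.suc) (g ∘ Fin.suc) last (λ i i<k → rest (Fin.suc i) (s≤s i<k))))
    where module P = PolyRing n

  does-≤-+ : ∀ k i j → does (suc (suc (k ℕ.+ i)) ℕ.≤? k ℕ.+ j) ≡ does (suc (suc i) ℕ.≤? j)
  does-≤-+ zero i j = ≡.refl
  does-≤-+ (suc k) i j = does-≤-+ k i j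

  -- The block sizes are `suc k` and `suc l`, so both blocks are nonempty and the last variable of
  -- the left one has a right neighbour, to which `link` joins it.
  module Blocks (k l : ℕ) where
    private
      m = suc k
      n = suc l
      N = m ℕ.+ n
      module P = PolyRing N

      entry : ∀ N → Fin N → Fin N → Poly N
      entry N i j = if does (suc (suc (toℕ i)) ℕ.≤? toℕ j) then linear q i j else oneP

    left : Fin m → Fin N
    left i = i Fin.↑ˡ n

    right : Fin n → Fin N
    right j = m Fin.↑ʳ j

    link : Poly N
    link = linear q (left (Fin.fromℕ k)) (right Fin.zero)

    crossProduct : Poly N
    crossProduct = Π λ i → Π λ j → linear q (left i) (right j)

    private
      corner : Fin m → Fin n → Poly N
      corner i j = entry N (left i) (right j)

      gap? : ℕ → ℕ → Bool
      gap? i j = does (suc (suc i) ℕ.≤? j)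

      entry-gap : ∀ {N} (i j : Fin N) {b} → gap? (toℕ i) (toℕ j) ≡ b → entry N i j ≡ (if b then linear q i j else oneP)
      entry-gap i j ≡.refl = ≡.refl

      entry-left : ∀ i j → entry N (left i) (left j) ≡ embedˡ n (entry m i j)
      entry-left i j = ≡.trans (entry-gap (left i) (left j) (≡.cong₂ gap? (Fin.toℕ-↑ˡ i n) (Fin.toℕ-↑ˡ j n)))
        (embedded (gap? (toℕ i) (toℕ j)))
        where
        embedded : ∀ b → (if b then linear q (left i) (left j) else oneP) ≡ embedˡ n (if b then linear q i j else oneP)
        embedded true = linear-≡ (left i) (left j) (unitVec-↑ˡ n i) (unitVec-↑ˡ n j)
        embedded false = ≡.cong monomial (≡.sym (𝟎-++ m n))

      entry-right : ∀ i j → entry N (right i) (right j) ≡ embedʳ m (entry n i j)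
      entry-right i j = ≡.trans
        (entry-gap (right i) (right j) (≡.trans (≡.cong₂ gap? (Fin.toℕ-↑ʳ m i) (Fin.toℕ-↑ʳ m j)) (does-≤-+ m (toℕ i) (toℕ j))))
        (embedded (gap? (toℕ i) (toℕ j)))
        where
        embedded : ∀ b → (if b then linear q (right i) (right j) else oneP) ≡ embedʳ m (if b then linear q i j else oneP)
        embedded true = linear-≡ (right i) (right j) (unitVec-↑ʳ m i) (unitVec-↑ʳ m j)
        embedded false = ≡.cong monomial (≡.sym (𝟎-++ m n))

      entry-below : ∀ i j → entry N (right i) (left j) ≡ oneP
      entry-below i j = entry-gap (right i) (left j) (≡.trans (≡.cong₂ gap? (Fin.toℕ-↑ʳ m i) (Fin.toℕ-↑ˡ j n))
        (dec-false (suc (suc (m ℕ.+ toℕ i)) ℕ.≤? toℕ j) λ ≤j → ℕ.<⇒≱ (ℕ.≤-trans (Fin.toℕ<n j) (ℕ.m≤m+n m (toℕ i)))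
          (ℕ.≤-trans (ℕ.m≤n+m _ 2) ≤j)))

      corner-gap : ∀ i j → suc (suc (toℕ i)) ℕ.≤ m ℕ.+ toℕ j → corner i j ≡ linear q (left i) (right j)
      corner-gap i j gap = entry-gap (left i) (right j) (≡.trans (≡.cong₂ gap? (Fin.toℕ-↑ˡ i n) (Fin.toℕ-↑ʳ m j))
        (dec-true (suc (suc (toℕ i)) ℕ.≤? m ℕ.+ toℕ j) gap))

      corner-link : corner (Fin.fromℕ k) Fin.zero ≡ oneP
      corner-link = entry-gap (left (Fin.fromℕ k)) (right Fin.zero) (≡.trans
        (≡.cong₂ gap? (≡.trans (Fin.toℕ-↑ˡ (Fin.fromℕ k) n) (Fin.toℕ-fromℕ k)) (≡.trans (Fin.toℕ-↑ʳ m (Fin.zero {l})) (ℕ.+-identityʳ m)))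
        (dec-false (suc (suc k) ℕ.≤? suc k) (ℕ.<-irrefl ≡.refl)))

      -- The last left and the first right variable are the only adjacent pair across the blocks, so
      -- `link` fills the single hole of the rectangle.
      corner-product : (Π (λ i → Π (corner i)) *ₚ link) ≋ crossProduct
      corner-product = P.trans (P.*-congʳ {link} (Π-* (λ i → corner i Fin.zero) (λ i → Π (corner i ∘ Fin.suc))))
        (P.trans (P.solve 3 (λ x y z → (x P.:* y) P.:* z P.:= (x P.:* z) P.:* y) P.refl
            (Π (λ i → corner i Fin.zero)) (Π (λ i → Π (corner i ∘ Fin.suc))) link)
          (P.trans (P.*-cong
              (Π-except-last k (λ i → corner i Fin.zero) (λ i → linear q (left i) (right Fin.zero)) (≡⇒≋ corner-link)
                (λ i i<k → ≡⇒≋ (corner-gap i Fin.zero (s≤s (ℕ.≤-trans i<k (ℕ.≤-reflexive (≡.sym (ℕ.+-identityʳ k))))))))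
              (Π-cong λ i → Π-cong λ j → ≡⇒≋ (corner-gap i (Fin.suc j)
                (s≤s (ℕ.≤-trans (Fin.toℕ<n i) (ℕ.≤-trans (s≤s (ℕ.m≤m+n k (toℕ j))) (ℕ.≤-reflexive (≡.sym (ℕ.+-suc k (toℕ j))))))))))
            (P.sym (Π-* (λ i → linear q (left i) (right Fin.zero)) (λ i → Π (λ j → linear q (left i) (right (Fin.suc j))))))))

    -- The table of factors splits into four parts: the diagonal parts are the q-factors of the
    -- blocks, the part below the diagonal is trivial, and the corner together with `link` is the
    -- full rectangle.
    qFactor-blocks : (qFactor N q *ₚ link) ≋ (crossProduct *ₚ (embedˡ n (qFactor m q) *ₚ embedʳ m (qFactor n q)))
    qFactor-blocks = P.trans (P.*-congʳ {link} (P.trans (qFactor-table q N) split))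
      (P.trans (P.solve 4 (λ a b c d → ((a P.:* b) P.:* c) P.:* d P.:= (b P.:* d) P.:* (a P.:* c)) P.refl
          (embedˡ n (qFactor m q)) (Π (λ i → Π (corner i))) (embedʳ m (qFactor n q)) link)
        (P.*-congʳ {embedˡ n (qFactor m q) *ₚ embedʳ m (qFactor n q)} corner-product))
      where
      upper : Π (λ i → Π (entry N (left i))) ≋ (embedˡ n (qFactor m q) *ₚ Π (λ i → Π (corner i)))
      upper = P.trans (Π-cong λ i → Π-split m n (entry N (left i)))
        (P.trans (Π-* (λ i → Π (λ j → entry N (left i) (left j))) (λ i → Π (corner i)))
          (P.*-congʳ {Π (λ i → Π (corner i))} (P.trans
            (Π-cong λ i → P.trans (Π-cong λ j → ≡⇒≋ (entry-left i j)) (P.sym (Embedˡ.F-Π n (entry m i))))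
            (P.trans (P.sym (Embedˡ.F-Π n (λ i → Π (entry m i)))) (Embedˡ.F-cong n (PolyRing.sym m (qFactor-table q m)))))))
      lower : Π (λ i → Π (entry N (right i))) ≋ embedʳ m (qFactor n q)
      lower = P.trans (Π-cong λ i → P.trans (Π-split m n (entry N (right i)))
          (P.trans (P.*-congʳ {Π (λ j → entry N (right i) (right j))} (P.trans (Π-cong λ j → ≡⇒≋ (entry-below i j)) (Π-1 m)))
            (P.trans (P.*-identityˡ (Π (λ j → entry N (right i) (right j))))
              (P.trans (Π-cong λ j → ≡⇒≋ (entry-right i j)) (P.sym (Embedʳ.F-Π m (entry n i)))))))
        (P.trans (P.sym (Embedʳ.F-Π m (λ i → Π (entry n i)))) (Embedʳ.F-cong m (PolyRing.sym n (qFactor-table q n))))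
      split : Π (λ i → Π (entry N i)) ≋ ((embedˡ n (qFactor m q) *ₚ Π (λ i → Π (corner i))) *ₚ embedʳ m (qFactor n q))
      split = P.trans (Π-split m n (λ i → Π (entry N i))) (P.*-cong upper lower)

    crossProduct-symmetricˡ : ∀ a → suc a ℕ.< m → swapP a crossProduct ≋ crossProduct
    crossProduct-symmetricˡ a a<m = P.trans (F-Π (λ i → Π (λ j → linear q (left i) (right j))))
      (P.trans (Π-cong λ i → P.trans (F-Π (λ j → linear q (left i) (right j)))
          (Π-cong λ j → ≡⇒≋ (≡.trans (swapP-linear a q (left i) (right j))
            (≡.cong₂ (linear q) (swapFin-↑ˡ-low n a i a<m) (swapFin-↑ʳ-low m a j a<m)))))
        (Π-swapFin a (λ i → Π (λ j → linear q (left i) (right j)))))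
      where open SwapP {N} a

    crossProduct-symmetricʳ : ∀ a → swapP (m ℕ.+ a) crossProduct ≋ crossProduct
    crossProduct-symmetricʳ a = P.trans (F-Π (λ i → Π (λ j → linear q (left i) (right j))))
      (Π-cong λ i → P.trans (F-Π (λ j → linear q (left i) (right j)))
        (P.trans (Π-cong λ j → ≡⇒≋ (≡.trans (swapP-linear (m ℕ.+ a) q (left i) (right j))
            (≡.cong₂ (linear q) (swapFin-↑ˡ-high n a i) (swapFin-↑ʳ-high m a j))))
          (Π-swapFin a (λ j → linear q (left i) (right j)))))
      where open SwapP {N} (m ℕ.+ a)

    private
      S = prefixSum {N} m *ₚ crossProduct

      homogeneous-S : Homogeneous (1 ℕ.+ m ℕ.* n) S
      homogeneous-S = homogeneous-* (homogeneous-prefixSum {N} m)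
        (≡.subst (λ d → Homogeneous d crossProduct) (≡.trans (∑-constant m (∑ {n} λ _ → 1)) (≡.cong (m ℕ.*_) (∑-ones n)))
          (homogeneous-Π {d = λ _ → ∑ {n} λ _ → 1} λ i → homogeneous-Π {d = λ _ → 1} λ j → homogeneous-linear q (left i) (right j)))

      S-symmetricˡ : ∀ a → suc a ℕ.< m → swapP a S ≋ S
      S-symmetricˡ a a<m = P.trans (F-* (prefixSum m) crossProduct)
        (P.*-cong (P.trans (≡⇒≋ (≡.trans (≡.cong (swapP a) (prefixSum-embed m n)) (swapP-embedˡ-low n a (prefixSum {m} m) a<m)))
          (P.trans (Embedˡ.F-cong n (prefixSum-symmetric m a a<m)) (≡⇒≋ (≡.sym (prefixSum-embed m n)))))
          (crossProduct-symmetricˡ a a<m))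
        where open SwapP {N} a

      S-symmetricʳ : ∀ a → swapP (m ℕ.+ a) S ≋ S
      S-symmetricʳ a = P.trans (F-* (prefixSum m) crossProduct)
        (P.*-cong (≡⇒≋ (≡.trans (≡.cong (swapP (m ℕ.+ a)) (prefixSum-embed m n))
            (≡.trans (swapP-embedˡ-high n a (prefixSum {m} m)) (≡.sym (prefixSum-embed m n)))))
          (crossProduct-symmetricʳ a))
        where open SwapP {N} (m ℕ.+ a)

    module _ {φ : Vec ℕ N → K} (crit : Critical φ) where
      open Critical crit
      private
        ψ : Vec ℕ N → K
        ψ γ = ev (λ α → φ (α ⊕ γ)) S

        ψ-alternatingˡ : ∀ β → Alternating (λ α → ψ (α Vec.++ β))
        ψ-alternatingˡ β a a<m α = trans (reflexive (≡.cong ψ (≡.sym (swapAt-++ˡ a α β a<m))))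
          (symmetric-multiplier {S = S} (S-symmetricˡ a a<m) (alternating a (ℕ.≤-trans a<m (ℕ.m≤m+n m n))) (α Vec.++ β))

        ψ-alternatingʳ : ∀ α → Alternating (λ β → ψ (α Vec.++ β))
        ψ-alternatingʳ α a a<n β = trans (reflexive (≡.cong ψ (≡.sym (swapAt-++ʳ a α β))))
          (symmetric-multiplier {S = S} (S-symmetricʳ a) (alternating (m ℕ.+ a)
            (ℕ.≤-trans (ℕ.≤-reflexive (≡.cong suc (≡.sym (ℕ.+-suc m a)))) (ℕ.+-monoʳ-< m a<n))) (α Vec.++ β))

        -- The blocks need degrees k + triangular k and l + triangular l. If s < k or t < l, one of
        -- them is below its minimum. Otherwise the blocks together with S, of degree 1 + m n,
        -- exceed `triangular N` by at least one, where φ vanishes.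
        ψ-vanishing : ∀ s t (α : Vec ℕ m) (β : Vec ℕ n) → Vec.sum α ≡ s ℕ.+ triangular k → Vec.sum β ≡ t ℕ.+ triangular l →
          ψ (α Vec.++ β) ≈ 0#
        ψ-vanishing s t α β sum-α sum-β with s ℕ.<? k | t ℕ.<? l
        ... | yes s<k | _ = alternating-low (ψ-alternatingˡ β)
          (ℕ.≤-trans (s≤s (ℕ.≤-reflexive sum-α)) (ℕ.+-monoˡ-< (triangular k) s<k))
        ... | no _ | yes t<l = alternating-low (ψ-alternatingʳ α)
          (ℕ.≤-trans (s≤s (ℕ.≤-reflexive sum-β)) (ℕ.+-monoˡ-< (triangular l) t<l))
        ... | no s≮k | no t≮l = ev-vanishing-All (λ γ sum-γ → concentrated (γ ⊕ (α Vec.++ β)) λ eq → ℕ.<-irrefl (≡.sym eq) (too-large γ sum-γ)) homogeneous-S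
          where
          too-large : ∀ γ → Vec.sum γ ≡ 1 ℕ.+ m ℕ.* n → triangular N ℕ.< Vec.sum (γ ⊕ (α Vec.++ β))
          too-large γ sum-γ = ℕ.≤-trans (s≤s (ℕ.≤-trans (ℕ.≤-reflexive (triangular-+ m n))
              (ℕ.≤-trans (ℕ.≤-reflexive (ℕ.+-comm (triangular m ℕ.+ triangular n) (m ℕ.* n)))
                (ℕ.+-monoʳ-≤ (m ℕ.* n) (ℕ.+-mono-≤
                  (ℕ.≤-trans (ℕ.+-monoˡ-≤ (triangular k) (ℕ.≮⇒≥ s≮k)) (ℕ.≤-reflexive (≡.sym sum-α)))
                  (ℕ.≤-trans (ℕ.+-monoˡ-≤ (triangular l) (ℕ.≮⇒≥ t≮l)) (ℕ.≤-reflexive (≡.sym sum-β))))))))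
            (ℕ.≤-reflexive (≡.trans (≡.cong₂ ℕ._+_ (≡.sym sum-γ) (≡.sym (sum-++ α β))) (≡.sym (sum-⊕ γ (α Vec.++ β)))))

      -- With the link included, qFactor splits into a factor symmetric in each block times the q-factors of the
      -- two blocks; by degree, one of the blocks is then too small to survive antisymmetrisation.
      ev-link : ∀ g → ev φ (g *ₚ ((prefixSum m *ₚ link) *ₚ qFactor N q)) ≈ 0#
      ev-link g = begin
        ev φ (g *ₚ ((prefixSum m *ₚ link) *ₚ qFactor N q))
          ≈⟨ ev-≋ (P.trans (P.solve 4 (λ g x l Q → g P.:* ((x P.:* l) P.:* Q) P.:= (g P.:* x) P.:* (Q P.:* l)) P.refl g (prefixSum m) link (qFactor N q))
               (P.trans (P.*-congˡ {g *ₚ prefixSum m} qFactor-blocks)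
                 (P.solve 4 (λ g x W Q → (g P.:* x) P.:* (W P.:* Q) P.:= (x P.:* W) P.:* (g P.:* Q)) P.refl g (prefixSum m) crossProduct (A *ₚ B)))) φ ⟩
        ev φ (S *ₚ (g *ₚ (A *ₚ B))) ≈⟨ ev-*-multiplier φ S (g *ₚ (A *ₚ B)) ⟩
        ev ψ (g *ₚ (A *ₚ B)) ≈⟨ ev-*ₚ ψ g (A *ₚ B) ⟩
        ev (λ γ → ev (λ β → ψ (γ ⊕ β)) (A *ₚ B)) g ≈⟨ ev-vanishing (λ γ → trans (ev-*ₚ _ A B) (blocks γ)) g ⟩
        0# ∎
        where
        A = embedˡ n (qFactor m q)
        B = embedʳ m (qFactor n q)
        blocks : ∀ γ → ev (λ α → ev (λ β → ψ (γ ⊕ (α ⊕ β))) B) A ≈ 0#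
        blocks γ with Vec.splitAt m γ
        ... | γ₁ , γ₂ , ≡.refl = trans (ev-mapExponents (Vec._++ 𝟎) _ (qFactor m q))
          (ev-form (qFactor-form k) λ α sum-α → trans (ev-mapExponents (𝟎 {m} Vec.++_) _ (qFactor n q))
            (ev-form (qFactor-form l) λ β sum-β → trans
              (reflexive (≡.cong ψ (≡.trans (≡.cong ((γ₁ Vec.++ γ₂) ⊕_) (≡.trans (++-⊕ α 𝟎 𝟎 β)
                  (≡.cong₂ Vec._++_ (⊕-identityʳ α) (⊕-identityˡ β)))) (++-⊕ γ₁ α γ₂ β))))
              (ψ-vanishing (Vec.sum γ₁) (Vec.sum γ₂) (γ₁ ⊕ α) (γ₂ ⊕ β)
                (≡.trans (sum-⊕ γ₁ α) (≡.cong (Vec.sum γ₁ ℕ.+_) sum-α))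
                (≡.trans (sum-⊕ γ₂ β) (≡.cong (Vec.sum γ₂ ℕ.+_) sum-β)))))

-- The null ideal and the value for every top coefficient

∑-lookup : ∀ {n} (α : Vec ℕ n) → ∑ (λ i → lookup α i ℕ.* 1) ≡ Vec.sum α
∑-lookup [] = ≡.refl
∑-lookup (a ∷ α) = ≡.cong₂ ℕ._+_ (ℕ.*-identityʳ a) (∑-lookup α)

sum-≤1 : ∀ {n} {α : Vec ℕ n} → VAll.All (ℕ._≤ 1) α → Vec.sum α ℕ.≤ n
sum-≤1 [] = z≤n
sum-≤1 (a≤1 ∷ α≤1) = ℕ.+-mono-≤ a≤1 (sum-≤1 α≤1)

sum-≤1-proper : ∀ {n} {α : Vec ℕ n} → VAll.All (ℕ._≤ 1) α → ¬ (α ≡ 𝟏) → Vec.sum α ℕ.< n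
sum-≤1-proper [] α≢𝟏 = contradiction ≡.refl α≢𝟏
sum-≤1-proper (z≤n ∷ α≤1) α≢𝟏 = s≤s (sum-≤1 α≤1)
sum-≤1-proper (s≤s z≤n ∷ α≤1) α≢𝟏 = s≤s (sum-≤1-proper α≤1 λ eq → α≢𝟏 (≡.cong (1 ∷_) eq))

module CriticalQuotient {c ℓ} (R : CommutativeRing c ℓ)
  (torsion-free : ∀ {x} → CommutativeRing._≈_ R x (CommutativeRing.-_ R x) → CommutativeRing._≈_ R x (CommutativeRing.0# R))
  (q : CommutativeRing.Carrier R) (m : ℕ) where
  open CommutativeRing R renaming (Carrier to K) hiding (zero)
  open PolyOps R
  open Functionals R
  open Polynomials R
  open Alternation R
  open TorsionFree torsion-free
  open Antisymmetrisation R
  open Products R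
  open Leading R
  open Normalisation R torsion-free q
  open Parabolic R torsion-free q
  open IntegerRingSolver R
  open SetoidReasoning setoid

  private
    N = suc m
    module P = PolyRing N

  -- n is a variable so that the equation can be matched with `refl`; in its use n is `suc m`, which
  -- is not literally of the form `suc k + suc l`.
  ev-link : ∀ {n} k l → n ≡ suc k ℕ.+ suc l → {φ : Vec ℕ n → K} → Critical φ →
    ∀ (i j : Fin n) → toℕ i ≡ k → toℕ j ≡ suc k →
    ∀ g → ev φ (g *ₚ ((prefixSum (suc k) *ₚ linear q i j) *ₚ qFactor n q)) ≈ 0#
  ev-link k l ≡.refl crit i j i≡ j≡ g
    with Fin.toℕ-injective (≡.trans i≡ (≡.sym (≡.trans (Fin.toℕ-↑ˡ (Fin.fromℕ k) (suc l)) (Fin.toℕ-fromℕ k))))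
       | Fin.toℕ-injective (≡.trans j≡ (≡.sym (≡.trans (Fin.toℕ-↑ʳ (suc k) (Fin.zero {l})) (ℕ.+-identityʳ (suc k)))))
  ... | ≡.refl | ≡.refl = Blocks.ev-link k l crit g

  -- Abstract: unfolding these polynomials makes the comparison of products blow up.
  abstract
    qF : Poly N
    qF = qFactor N q

    qF≡ : qF ≡ qFactor N q
    qF≡ = ≡.refl

    qF-form : Form (triangular m) qF
    qF-form = qFactor-form m

    ev-x₀-power-qF : {φ : Vec ℕ N → K} → Critical φ → ev φ (monomial (m · unitVec Fin.zero) *ₚ qF) ≈ φ (staircase N)
    ev-x₀-power-qF = ev-x₀-power m

    X : ℕ → Poly N
    X = prefixSum

    X-zero : X 0 ≡ zeroP
    X-zero = ≡.refl

    X-suc : ∀ (j : Fin N) → X (suc (toℕ j)) ≋ (X (toℕ j) +ₚ varP j)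
    X-suc = prefixSum-suc

    homogeneous-X : ∀ k → Homogeneous 1 (X k)
    homogeneous-X k = homogeneous-prefixSum {N} k

    ev-X-N : {φ : Vec ℕ N → K} → Critical φ → ∀ h → ev φ (X N *ₚ h) ≈ 0#
    ev-X-N = critical-e₁

    ev-X-link : {φ : Vec ℕ N → K} → Critical φ → ∀ k l → N ≡ suc k ℕ.+ suc l →
      ∀ (i j : Fin N) → toℕ i ≡ k → toℕ j ≡ suc k → ∀ g → ev φ (g *ₚ ((X (suc k) *ₚ linear q i j) *ₚ qF)) ≈ 0#
    ev-X-link crit k l N≡ = ev-link k l N≡ crit

  module _ {φ : Vec ℕ N → K} (crit : Critical φ) where
    open Critical crit

    -- The quantification over g makes this closed under multiplication as well as addition.
    Null : Poly N → Set (c ⊔ ℓ)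
    Null p = ∀ g → ev φ (g *ₚ (p *ₚ qF)) ≈ 0#

    null-isIdeal : IsIdeal (polyRing N) Null
    null-isIdeal = record
      { I-resp = λ e Np g → trans (sym (ev-≋ (P.*-congˡ {g} (P.*-congʳ {qF} e)) φ)) (Np g)
      ; I-0 = λ g → ev-≋ (P.zeroʳ g) φ
      ; I-+ = λ {x} {y} Nx Ny g → trans
          (ev-≋ (P.solve 4 (λ g x y Q → g P.:* ((x P.:+ y) P.:* Q) P.:= g P.:* (x P.:* Q) P.:+ g P.:* (y P.:* Q)) P.refl g x y qF) φ)
          (trans (ev-+ₚ φ (g *ₚ (x *ₚ qF)) (g *ₚ (y *ₚ qF))) (trans (+-cong (Nx g) (Ny g)) (+-identityˡ 0#)))
      ; I-* = λ a {x} Nx g → trans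
          (ev-≋ (P.solve 4 (λ g a x Q → g P.:* ((a P.:* x) P.:* Q) P.:= (g P.:* a) P.:* (x P.:* Q)) P.refl g a x qF) φ)
          (Nx (g *ₚ a))
      }

    open IsIdeal null-isIdeal
    open Quotient (polyRing N) null-isIdeal
    private module Q = CommutativeRing quotient

    null⇒~0 : ∀ {p} → Null p → p ~ zeroP
    null⇒~0 {p} Np = ~-intro (I-resp (P.sym (P.+-identityʳ p)) Np)

    ev-~ : ∀ {p p′} → p ~ p′ → ev φ (p *ₚ qF) ≈ ev φ (p′ *ₚ qF)
    ev-~ {p} {p′} e = begin
      ev φ (p *ₚ qF)
        ≈⟨ ev-≋ (P.solve 3 (λ p p′ Q → p P.:* Q P.:= P.con (1 , 0) P.:* ((p P.:- p′) P.:* Q) P.:+ p′ P.:* Q) P.refl p p′ qF) φ ⟩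
      ev φ ((oneP *ₚ ((p -ₚ p′) *ₚ qF)) +ₚ (p′ *ₚ qF)) ≈⟨ ev-+ₚ φ (oneP *ₚ ((p -ₚ p′) *ₚ qF)) (p′ *ₚ qF) ⟩
      ev φ (oneP *ₚ ((p -ₚ p′) *ₚ qF)) + ev φ (p′ *ₚ qF) ≈⟨ +-congʳ (~-elim e oneP) ⟩
      0# + ev φ (p′ *ₚ qF) ≈⟨ +-identityˡ _ ⟩
      ev φ (p′ *ₚ qF) ∎

    X-N~0 : X N ~ zeroP
    X-N~0 = null⇒~0 λ g → trans
      (ev-≋ (P.solve 3 (λ g x Q → g P.:* (x P.:* Q) P.:= x P.:* (g P.:* Q)) P.refl g (X N) qF) φ)
      (ev-X-N crit (g *ₚ qF))

    -- Variables are differences of consecutive X, so q x_{j+1} - x_{j+2} equals (q+1) X (j+1) - q X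
    -- j - X (j+2), counting variables from 1. The product of this with X (j+1) is null by the block
    -- argument.
    X-relation : ∀ j → j ℕ.< m → (X (suc j) *ₚ ((constP q +ₚ oneP) *ₚ X (suc j))) ~ (X (suc j) *ₚ ((constP q *ₚ X j) +ₚ X (suc (suc j))))
    X-relation j j<m = ~-intro (I-resp (P.trans (P.*-congˡ {X₁} linear≋)
        (P.solve 4 (λ q x₀ x₁ x₂ → x₁ P.:* (q P.:* (x₁ P.:- x₀) P.:- (x₂ P.:- x₁)) P.:=
            x₁ P.:* ((q P.:+ P.con (1 , 0)) P.:* x₁) P.:- x₁ P.:* (q P.:* x₀ P.:+ x₂)) P.refl (constP q) X₀ X₁ X₂))
      (ev-X-link crit j l (≡.trans (≡.cong suc m≡) (≡.sym (≡.cong suc (ℕ.+-suc j l)))) a b a≡ b≡))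
      where
      i = Fin.fromℕ< j<m
      a = Fin.inject₁ i
      b = Fin.suc i
      X₀ = X j
      X₁ = X (suc j)
      X₂ = X (suc (suc j))
      a≡ : toℕ a ≡ j
      a≡ = ≡.trans (Fin.toℕ-inject₁ i) (Fin.toℕ-fromℕ< j<m)
      b≡ : toℕ b ≡ suc j
      b≡ = ≡.cong suc (Fin.toℕ-fromℕ< j<m)
      -- The left block has j+1 of the m+1 variables, so the right one has m-j, which is `suc l`.
      l = m ℕ.∸ suc j
      m≡ : m ≡ suc (j ℕ.+ l)
      m≡ = ≡.sym (ℕ.m+[n∸m]≡n j<m)
      difference : ∀ (x : Fin N) {k} → toℕ x ≡ k → varP x ≋ (X (suc k) -ₚ X k)
      difference x ≡.refl = P.trans (P.solve 2 (λ y v → v P.:= (y P.:+ v) P.:- y) P.refl (X (toℕ x)) (varP x))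
        (P.+-congʳ { -ₚ X (toℕ x)} (P.sym (X-suc x)))
      linear≋ : linear q a b ≋ ((constP q *ₚ (X₁ -ₚ X₀)) -ₚ (X₂ -ₚ X₁))
      linear≋ = P.+-cong (P.trans (scaleP≋ q (varP a)) (P.*-congˡ {constP q} (difference a a≡))) (P.-‿cong (difference b b≡))

    private
      module PRec = Recurrence (polyRing N)
      module QRec = Recurrence quotient
      module O = PolyOps quotient
      open QuantumIntegerImages R quotient constP (≈⇒~ constP-0) (≈⇒~ P.refl)
        (λ x y → ≈⇒~ (constP-+ x y)) (λ x y → ≈⇒~ (constP-* x y))

      powC-powP : ∀ p k → O.powC p k ≋ powP p k
      powC-powP p zero = P.refl
      powC-powP p (suc k) = P.*-congˡ {p} (powC-powP p k)

      product-quotient : ∀ f k → PRec.product f k ≋ QRec.product f k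
      product-quotient f zero = P.refl
      product-quotient f (suc k) = P.*-congʳ {f k} (product-quotient f k)

      Π-product : ∀ k (f : ℕ → Poly N) → Π (λ (i : Fin k) → f (toℕ i)) ≋ PRec.product f k
      Π-product zero f = P.refl
      Π-product (suc k) f = P.trans (P.*-congˡ {f 0} (Π-product k (f ∘ suc))) (PRec.product-suc f k)

    X-recurrence : ∀ j → j ℕ.< m →
      (X (suc j) Q.* ((constP q Q.+ Q.1#) Q.* X (suc j))) ~ (X (suc j) Q.* ((constP q Q.* X j) Q.+ X (suc (suc j))))
    X-recurrence = X-relation

    product-X : Π (λ (i : Fin m) → X (suc (toℕ i))) ~ (constP (qfact q m) *ₚ powP (X 1) m)
    product-X = ~-trans unfolded (~-trans recurred closed)
      where
      unfolded : Π (λ (i : Fin m) → X (suc (toℕ i))) ~ QRec.product (X ∘ suc) m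
      unfolded = ≈⇒~ (P.trans (Π-product m (X ∘ suc)) (product-quotient (X ∘ suc) m))
      recurred : QRec.product (X ∘ suc) m ~ (O.qfact (constP q) m Q.* O.powC (X 1) m)
      recurred = QRec.product-recurrence (constP q) X m (≈⇒~ (≡⇒≋ X-zero)) X-recurrence m ℕ.≤-refl
      qfact~ : O.qfact (constP q) m ~ constP (qfact q m)
      qfact~ = qfact-image q m
      power~ : O.powC (X 1) m ~ powP (X 1) m
      power~ = ≈⇒~ (powC-powP (X 1) m)
      closed : (O.qfact (constP q) m *ₚ O.powC (X 1) m) ~ (constP (qfact q m) *ₚ powP (X 1) m)
      closed = ~-*-cong {O.qfact (constP q) m} {constP (qfact q m)} {O.powC (X 1) m} {powP (X 1) m} qfact~ power~

    -- Index i stands for the generator u_{i+1}, hence the shift by one.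
    θ : Fin m → Poly N
    θ i = X (suc (toℕ i))

    ev-full : ∀ t → ev φ (substP θ ((t , 𝟏) ∷ []) *ₚ qF) ≈ (qfact q m * t) * φ (staircase N)
    ev-full t = begin
      ev φ (substP θ ((t , 𝟏) ∷ []) *ₚ qF)
        ≈⟨ ev-≋ (P.*-congʳ {qF} (P.trans (≡⇒≋ (substP-∷ θ t 𝟏 [])) (P.trans (P.+-identityʳ (scaleP t (monomialImage θ 𝟏))) (scaleP≋ t (monomialImage θ 𝟏))))) φ ⟩
      ev φ ((constP t *ₚ monomialImage θ 𝟏) *ₚ qF)
        ≈⟨ ev-~ (Q.*-congˡ {constP t} (Q.trans (≈⇒~ image≋) product-X)) ⟩
      ev φ ((constP t *ₚ (constP (qfact q m) *ₚ powP (X 1) m)) *ₚ qF)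
        ≈⟨ ev-≋ (P.trans (P.solve 4 (λ t f x Q → (t P.:* (f P.:* x)) P.:* Q P.:= (f P.:* t) P.:* (x P.:* Q)) P.refl (constP t) (constP (qfact q m)) (powP (X 1) m) qF)
             (P.*-cong (P.sym (constP-* (qfact q m) t)) (P.*-congʳ {qF} power≋))) φ ⟩
      ev φ (constP (qfact q m * t) *ₚ (monomial (m · unitVec Fin.zero) *ₚ qF)) ≈⟨ ev-constP-* φ (qfact q m * t) (monomial (m · unitVec Fin.zero) *ₚ qF) ⟩
      (qfact q m * t) * ev φ (monomial (m · unitVec Fin.zero) *ₚ qF) ≈⟨ *-congˡ (ev-x₀-power-qF crit) ⟩
      (qfact q m * t) * φ (staircase N) ∎
      where
      image≋ : monomialImage θ 𝟏 ≋ Π θ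
      image≋ = Π-cong λ i → P.trans (≡⇒≋ (≡.cong (powP (θ i)) (Vec.lookup-replicate i 1))) (powP-1 (θ i))
      power≋ : powP (X 1) m ≋ monomial (m · unitVec Fin.zero)
      power≋ = P.trans (powP-cong (P.trans (X-suc Fin.zero) (≡⇒≋ (≡.cong (_+ₚ varP Fin.zero) X-zero))) m) (powP-varP Fin.zero m)

    -- A proper squarefree monomial becomes a polynomial of degree less than m, and Q has degree
    -- `triangular m`. The total is short of `triangular N` = m + triangular m, the only degree
    -- where φ can be nonzero.
    ev-low : ∀ g → (∀ α → ¬ (SquareFree α × ¬ (α ≡ 𝟏)) → coeff g α ≈ 0#) → ev φ (substP θ g *ₚ qF) ≈ 0#
    ev-low g vanish = begin
      ev φ (substP θ g *ₚ qF)
        ≈⟨ ev-≋ (P.*-congʳ {qF} (Multiplicative.F-cong (substP-multiplicative θ) (≈ₚ⇒≋ g g′ (filter-≈ₚ proper? g vanish)))) φ ⟩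
      ev φ (substP θ g′ *ₚ qF) ≈⟨ ev-*ₚ φ (substP θ g′) qF ⟩
      ev Φ (substP θ g′) ≈⟨ ev-substP θ Φ g′ ⟩
      ev (λ α → ev Φ (monomialImage θ α)) g′
        ≈⟨ ev-vanishing-All (λ α (sf , proper) → ev-vanishing-All (λ γ sum-γ → low γ (ℕ.<-≤-trans
             (ℕ.≤-reflexive (≡.cong suc (≡.trans sum-γ (∑-lookup α)))) (sum-≤1-proper sf proper)))
             (homogeneous-Π λ i → homogeneous-powP (homogeneous-X (suc (toℕ i))) (lookup α i)))
           (LAll.all-filter (proper? ∘ proj₂) g) ⟩
      0# ∎
      where
      proper? : Decidable (λ (α : Vec ℕ m) → SquareFree α × ¬ (α ≡ 𝟏))
      proper? α = VAll.all? (ℕ._≤? 1) α ×-dec ¬? (Vec.≡-dec ℕ._≟_ α 𝟏)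
      -- The hypothesis speaks of coefficients; after filtering, every listed term is squarefree and
      -- proper, so the degree can be counted term by term.
      g′ = List.filter (proper? ∘ proj₂) g
      Φ : Vec ℕ N → K
      Φ α = ev (λ β → φ (α ⊕ β)) qF
      low : ∀ γ → Vec.sum γ ℕ.< m → Φ γ ≈ 0#
      low γ γ<m = ev-form (qF-form) λ β sum-β → concentrated (γ ⊕ β) λ eq →
        ℕ.<-irrefl (≡.trans (≡.cong (Vec.sum γ ℕ.+_) (≡.sym sum-β)) (≡.trans (≡.sym (sum-⊕ γ β)) eq)) (ℕ.+-monoˡ-< (triangular m) γ<m)

    -- For k ≤ m the two sides are equal as polynomials. At k = N the generator is 0 by convention,
    -- whereas X N, the sum of all variables, is zero only modulo the null ideal.
    θ-uN : ∀ k → k ℕ.≤ N → substP θ (uN m k) ~ X k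
    θ-uN zero _ = ≈⇒~ (≡⇒≋ (≡.sym X-zero))
    θ-uN (suc k) (s≤s k≤m) with k ℕ.<? m
    ... | yes k<m = ≈⇒~ (P.trans (substP-varP θ (Fin.fromℕ< k<m)) (≡⇒≋ (≡.cong (X ∘ suc) (Fin.toℕ-fromℕ< k<m))))
    ... | no k≮m with ℕ.≤-antisym k≤m (ℕ.≮⇒≥ k≮m)
    ...   | ≡.refl = Q.sym X-N~0

    -- ρ takes differences of consecutive generators, and differences of consecutive prefix sums are
    -- the variables again.
    θ-rho : ∀ f → substP θ (rho m f) ~ f
    θ-rho f = Q.trans (≈⇒~ (substP-∘ θ σ f)) (Q.trans (substP-~ null-isIdeal images f) (≈⇒~ (substP-identity f)))
      where
      σ : Fin N → Poly m
      σ j = uN m (suc (toℕ j)) -ₚ uN m (toℕ j)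
      images : ∀ j → substP θ (σ j) ~ varP j
      images j = Q.trans (≈⇒~ (P.trans (substP-+ θ (uN m (suc (toℕ j))) (-ₚ uN m (toℕ j))) (P.+-congˡ {substP θ (uN m (suc (toℕ j)))} (substP-- θ (uN m (toℕ j))))))
        (Q.trans (Q.+-cong (θ-uN (suc (toℕ j)) (Fin.toℕ<n j)) (Q.-‿cong (θ-uN (toℕ j) (ℕ.<⇒≤ (Fin.toℕ<n j)))))
          (≈⇒~ (P.trans (P.+-congʳ { -ₚ X (toℕ j)} (X-suc j))
            (P.solve 2 (λ x v → (x P.:+ v) P.:- x P.:= v) P.refl (X (toℕ j)) (varP j)))))

    -- This makes θ descend to a map from K_n to the quotient by the null ideal.
    θ-relK : ∀ i → substP θ (relK m q i) ~ zeroP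
    θ-relK i = Q.trans (≈⇒~ expanded) (Q.trans
      (Q.+-cong (Q.+-cong (Q.*-congˡ {constP (q + 1#)} (Q.*-cong u~X u~X)) (Q.-‿cong (Q.*-congˡ {constP q} (Q.*-cong u~X (θ-uN k (ℕ.<⇒≤ (ℕ.<-trans k<m (ℕ.n<1+n m))))))))
        (Q.-‿cong (Q.*-cong u~X (θ-uN (suc (suc k)) (s≤s k<m)))))
      (Q.trans (≈⇒~ (P.trans (P.+-congʳ { -ₚ (X₁ *ₚ X₂)} (P.+-congʳ { -ₚ (constP q *ₚ (X₁ *ₚ X₀))} (P.*-congʳ {X₁ *ₚ X₁} (constP-+ q 1#))))
          (P.solve 4 (λ q x₀ x₁ x₂ → ((q P.:+ P.con (1 , 0)) P.:* (x₁ P.:* x₁) P.:- q P.:* (x₁ P.:* x₀)) P.:- x₁ P.:* x₂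
            P.:= x₁ P.:* ((q P.:+ P.con (1 , 0)) P.:* x₁) P.:- x₁ P.:* (q P.:* x₀ P.:+ x₂)) P.refl (constP q) X₀ X₁ X₂)))
        (null⇒~0 (~-elim (X-relation k k<m)))))
      where
      k = toℕ i
      k<m = Fin.toℕ<n i
      X₀ = X k
      X₁ = X (suc k)
      X₂ = X (suc (suc k))
      u = varP i
      u₋ = uN m k
      u₊ = uN m (suc (suc k))
      u~X : substP θ u ~ X₁
      u~X = ≈⇒~ (substP-varP θ i)
      open Multiplicative (substP-multiplicative θ) using (F-*)
      term : ∀ a p r → substP θ (scaleP a (p *ₚ r)) ≋ (constP a *ₚ (substP θ p *ₚ substP θ r))
      term a p r = P.trans (substP-scaleP θ a (p *ₚ r)) (P.trans (scaleP≋ a (substP θ (p *ₚ r))) (P.*-congˡ {constP a} (F-* p r)))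
      minus : ∀ p r → substP θ (p -ₚ r) ≋ (substP θ p -ₚ substP θ r)
      minus p r = P.trans (substP-+ θ p (-ₚ r)) (P.+-congˡ {substP θ p} (substP-- θ r))
      expanded : substP θ (relK m q i) ≋
        (((constP (q + 1#) *ₚ (substP θ u *ₚ substP θ u)) -ₚ (constP q *ₚ (substP θ u *ₚ substP θ u₋))) -ₚ (substP θ u *ₚ substP θ u₊))
      expanded = P.trans (minus (scaleP (q + 1#) (u *ₚ u) -ₚ scaleP q (u *ₚ u₋)) (u *ₚ u₊))
        (P.+-cong (P.trans (minus (scaleP (q + 1#) (u *ₚ u)) (scaleP q (u *ₚ u₋)))
            (P.+-cong (term (q + 1#) u u) (P.-‿cong (term q u u₋))))
          (P.-‿cong (F-* u u₊)))

    θ-ideal : ∀ p → InIdeal m q p → substP θ p ~ zeroP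
    θ-ideal p (a , p≈) = Q.trans (≈⇒~ (F-cong (≈ₚ⇒≋ p (sumP (Vec.toList (Vec.map (λ i → a i *ₚ relK m q i) (Vec.allFin m)))) p≈)))
      (combination (Vec.allFin m))
      where
      open Multiplicative (substP-multiplicative θ)
      combination : ∀ {k} (is : Vec (Fin m) k) → substP θ (sumP (Vec.toList (Vec.map (λ i → a i *ₚ relK m q i) is))) ~ zeroP
      combination [] = Q.refl
      combination (i ∷ is) = Q.trans (≈⇒~ (substP-+ θ (a i *ₚ relK m q i) (sumP (Vec.toList (Vec.map (λ i → a i *ₚ relK m q i) is)))))
        (Q.trans (Q.+-cong (Q.trans (≈⇒~ (F-* (a i) (relK m q i))) (Q.trans (Q.*-congˡ {substP θ (a i)} (θ-relK i)) (Q.zeroʳ (substP θ (a i)))))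
            (combination is))
          (Q.+-identityˡ zeroP))

    ev-top : ∀ f t → IsTop m q f t → ev φ (f *ₚ qF) ≈ (qfact q m * t) * φ (staircase N)
    ev-top f t (g , vanish , ideal) = begin
      ev φ (f *ₚ qF) ≈⟨ ev-~ f~ ⟩
      ev φ ((substP θ full +ₚ substP θ g) *ₚ qF) ≈⟨ ev-≋ (P.distribʳ qF (substP θ full) (substP θ g)) φ ⟩
      ev φ ((substP θ full *ₚ qF) +ₚ (substP θ g *ₚ qF)) ≈⟨ ev-+ₚ φ (substP θ full *ₚ qF) (substP θ g *ₚ qF) ⟩
      ev φ (substP θ full *ₚ qF) + ev φ (substP θ g *ₚ qF) ≈⟨ +-cong (ev-full t) (ev-low g vanish′) ⟩
      (qfact q m * t) * φ (staircase N) + 0# ≈⟨ +-identityʳ _ ⟩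
      (qfact q m * t) * φ (staircase N) ∎
      where
      full : Poly m
      full = (t , 𝟏) ∷ []
      r = rho m f
      f~ : f ~ (substP θ full +ₚ substP θ g)
      f~ = Q.trans (Q.sym (θ-rho f)) (Q.trans (≈⇒~ (P.solve 2 (λ x y → x P.:= (x P.:- y) P.:+ y) P.refl (substP θ r) (substP θ (full +ₚ g))))
        (Q.trans (Q.+-congʳ {substP θ (full +ₚ g)} (Q.trans (≈⇒~ (P.sym (P.trans (substP-+ θ r (-ₚ (full +ₚ g))) (P.+-congˡ {substP θ r} (substP-- θ (full +ₚ g))))))
            (θ-ideal (r -ₚ (full +ₚ g)) ideal)))
          (≈⇒~ (substP-+ θ full g))))
      vanish′ : ∀ α → ¬ (SquareFree α × ¬ (α ≡ 𝟏)) → coeff g α ≈ 0#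
      vanish′ α improper with VAll.all? (ℕ._≤? 1) α | Vec.≡-dec ℕ._≟_ α 𝟏
      ... | no ¬sf | _ = vanish α (inj₁ ¬sf)
      ... | yes _ | yes full = vanish α (inj₂ full)
      ... | yes sf | no proper = contradiction (sf , proper) improper

  det-critical : ∀ n → Critical (det (staircase n))
  det-critical n = record
    { alternating = det-alternating (staircase n)
    ; concentrated = λ α ≢ → det-homogeneous (staircase n) α λ eq → ≢ (≡.trans eq (sum-staircase n))
    }

  dividedSymm-top : ∀ f → (∀ α → m ℕ.< Vec.sum α → coeff f α ≈ 0#) → ∀ t → IsTop m q f t →
    DividedSymm N q f (constP (qfact q m * t))
  dividedSymm-top f bounded t top β = begin
    coeff (antisym (f *ₚ qFactor N q)) β ≈⟨ coeff-antisym (f *ₚ qFactor N q) β ⟩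
    ev (det β) (f *ₚ qFactor N q) ≡⟨ ≡.cong (λ Q → ev (det β) (f *ₚ Q)) qF≡ ⟨
    Λ β ≈⟨ solve 2 (λ x y → x := (x :- y) :+ y) refl (Λ β) (T * coeff V β) ⟩
    D β + T * coeff V β ≈⟨ +-congʳ (D-vanishing β) ⟩
    0# + T * coeff V β ≈⟨ +-identityˡ _ ⟩
    T * coeff V β ≈⟨ *-congˡ (coeff-ev V β) ⟩
    T * ev (χ β) V ≈⟨ ev-constP-* (χ β) T V ⟨
    ev (χ β) (constP T *ₚ V) ≈⟨ coeff-ev (constP T *ₚ V) β ⟨
    coeff (constP T *ₚ V) β ∎
    where
    T = qfact q m * t
    V = vandermonde N
    Λ : Vec ℕ N → K
    Λ β = ev (det β) (f *ₚ qF)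
    D : Vec ℕ N → K
    D β = Λ β - T * coeff V β
    D-alternating : Alternating D
    D-alternating a a<N β = trans (+-cong
        (trans (ev-cong (λ α → det-alternating′ α a a<N β) (f *ₚ qF)) (ev-neg (det β) (f *ₚ qF)))
        (-‿cong (*-congˡ (coeff-vandermonde-alternating N a a<N β))))
      (solve 3 (λ x t y → :- x :- t :* :- y := :- (x :- t :* y)) refl (Λ β) T (coeff V β))
    D-staircase : D (staircase N) ≈ 0#
    D-staircase = trans (+-cong (trans (ev-top (det-critical N) f t top) (*-congˡ (det-staircase N)))
      (-‿cong (*-congˡ (coeff-vandermonde-staircase N)))) (-‿inverseʳ _)
    -- The list f may contain terms of degree above m that cancel; they are dropped before degrees
    -- are counted.
    f′ = List.filter ((λ α → Vec.sum α ℕ.≤? m) ∘ proj₂) f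
    -- Alternation gives nothing above degree `triangular N`. There both parts of D vanish for
    -- degree reasons: f has degree at most m and Q has degree `triangular m`, which add up to
    -- `triangular N`, the degree of V.
    D-high : ∀ β → triangular N ℕ.< Vec.sum β → D β ≈ 0#
    D-high β high = trans (+-cong
        (trans (ev-≋ (P.*-congʳ {qF} (≈ₚ⇒≋ f f′ (filter-≈ₚ (λ α → Vec.sum α ℕ.≤? m) f (λ α ≰m → bounded α (ℕ.≰⇒> ≰m))))) (det β))
          (trans (ev-*ₚ (det β) f′ qF) (ev-vanishing-All (λ α ≤m → ev-form (qF-form) λ γ sum-γ →
              det-homogeneous β (α ⊕ γ) λ eq → ℕ.<⇒≱ high (ℕ.≤-trans (ℕ.≤-reflexive (≡.trans (≡.sym eq) (sum-⊕ α γ)))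
                (ℕ.+-mono-≤ ≤m (ℕ.≤-reflexive sum-γ))))
            (LAll.all-filter ((λ α → Vec.sum α ℕ.≤? m) ∘ proj₂) f))))
        (-‿cong (trans (*-congˡ (trans (coeff-ev V β) (ev-form (vandermonde-form N) λ α sum-α →
          χ-≢ {α = α} {β} λ eq → ℕ.<-irrefl (≡.trans (≡.sym sum-α) (≡.cong Vec.sum eq)) high))) (zeroʳ T))))
      (-‿inverseʳ 0#)
    D-vanishing : ∀ β → D β ≈ 0#
    D-vanishing β with ℕ.<-cmp (Vec.sum β) (triangular N)
    ... | tri< low _ _ = alternating-low D-alternating low
    ... | tri≈ _ eq _ = alternating-staircase D-alternating D-staircase eq
    ... | tri> _ _ high = D-high β high

-- Consequences of characteristic zero: torsion and q-integers

module QuantumIntegers {c ℓ} (R : CommutativeRing c ℓ) (isField : PolyOps.IsField R) (charZero : PolyOps.CharZero R) where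
  open CommutativeRing R renaming (Carrier to K) hiding (zero)
  open PolyOps R
  open IntegerRingSolver R
  open SetoidReasoning setoid

  torsion-free : ∀ {x} → x ≈ - x → x ≈ 0#
  torsion-free {x} x≈-x with proj₂ isField (natC 2) (charZero 1)
  ... | y , 2y≈1 = begin
    x ≈⟨ *-identityˡ x ⟨
    1# * x ≈⟨ *-congʳ 2y≈1 ⟨
    (natC 2 * y) * x ≈⟨ solve 2 (λ x y → ((con (1 , 0) :+ (con (1 , 0) :+ con (0 , 0))) :* y) :* x := y :* (x :+ x)) refl x y ⟩
    y * (x + x) ≈⟨ *-congˡ (trans (+-congˡ x≈-x) (-‿inverseʳ x)) ⟩
    y * 0# ≈⟨ zeroʳ y ⟩
    0# ∎

  module _ (q : K) (nonroot : NotNontrivialRootOfUnity q) where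
    qint-geometric : ∀ k → powC q k ≈ 1# + (q - 1#) * qint q k
    qint-geometric zero = sym (trans (+-congˡ (zeroʳ _)) (+-identityʳ 1#))
    qint-geometric (suc k) = begin
      q * powC q k ≈⟨ solve 2 (λ q p → q :* p := p :+ (q :- con (1 , 0)) :* p) refl q (powC q k) ⟩
      powC q k + (q - 1#) * powC q k ≈⟨ +-congʳ (qint-geometric k) ⟩
      (1# + (q - 1#) * qint q k) + (q - 1#) * powC q k
        ≈⟨ solve 3 (λ r i p → (con (1 , 0) :+ r :* i) :+ r :* p := con (1 , 0) :+ r :* (i :+ p)) refl (q - 1#) (qint q k) (powC q k) ⟩
      1# + (q - 1#) * qint q (suc k) ∎

    qint-at-one : q ≈ 1# → ∀ k → qint q k ≈ natC k
    qint-at-one q≈1 zero = refl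
    qint-at-one q≈1 (suc k) = trans (+-cong (qint-at-one q≈1 k) (power k)) (+-comm _ _)
      where
      power : ∀ k → powC q k ≈ 1#
      power zero = refl
      power (suc k) = trans (*-cong q≈1 (power k)) (*-identityˡ 1#)

    -- If [k+1] were zero, then q^{k+1} = 1 + (q-1)[k+1] would be 1, so q = 1 by the assumption on
    -- roots of unity. But then [k+1] is the integer k+1, which is nonzero in characteristic zero.
    qint-nonzero : ∀ k → ¬ (qint q (suc k) ≈ 0#)
    qint-nonzero k ≈0 = charZero k (trans (sym (qint-at-one q≈1 (suc k))) ≈0)
      where
      q≈1 : q ≈ 1#
      q≈1 = nonroot k (trans (qint-geometric (suc k)) (trans (+-congˡ (trans (*-congˡ ≈0) (zeroʳ _))) (+-identityʳ 1#)))

-- Squarefree monomials span the algebra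

module Spanning {c ℓ} (R : CommutativeRing c ℓ) (isField : PolyOps.IsField R) (charZero : PolyOps.CharZero R)
  (q : CommutativeRing.Carrier R) (nonroot : PolyOps.NotNontrivialRootOfUnity R q) (m : ℕ) where
  open CommutativeRing R renaming (Carrier to K) hiding (zero)
  open PolyOps R
  open Functionals R
  open Polynomials R
  open QuantumIntegers R isField charZero

  private module P = PolyRing m

  combination : ∀ {k} → (Fin k → Poly m) → Poly m
  combination f = sumP (Vec.toList (Vec.tabulate f))

  combination-cong : ∀ {k} {f g : Fin k → Poly m} → (∀ i → f i ≋ g i) → combination f ≋ combination g
  combination-cong {zero} e = P.refl
  combination-cong {suc k} e = P.+-cong (e Fin.zero) (combination-cong (e ∘ Fin.suc))

  combination-0 : ∀ {k} {f : Fin k → Poly m} → (∀ i → f i ≋ zeroP) → combination f ≋ zeroP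
  combination-0 {zero} e = P.refl
  combination-0 {suc k} e = P.trans (P.+-cong (e Fin.zero) (combination-0 (e ∘ Fin.suc))) (P.+-identityˡ zeroP)

  combination-+ : ∀ {k} (f g : Fin k → Poly m) → combination (λ i → f i +ₚ g i) ≋ (combination f +ₚ combination g)
  combination-+ {zero} f g = P.refl
  combination-+ {suc k} f g = P.trans (P.+-congˡ {f Fin.zero +ₚ g Fin.zero} (combination-+ (f ∘ Fin.suc) (g ∘ Fin.suc)))
    (P.solve 4 (λ a b x y → (a P.:+ b) P.:+ (x P.:+ y) P.:= (a P.:+ x) P.:+ (b P.:+ y)) P.refl
      (f Fin.zero) (g Fin.zero) (combination (f ∘ Fin.suc)) (combination (g ∘ Fin.suc)))

  combination-* : ∀ {k} p (f : Fin k → Poly m) → combination (λ i → p *ₚ f i) ≋ (p *ₚ combination f)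
  combination-* {zero} p f = P.sym (P.zeroʳ p)
  combination-* {suc k} p f = P.trans (P.+-congˡ {p *ₚ f Fin.zero} (combination-* p (f ∘ Fin.suc)))
    (P.sym (P.distribˡ p (f Fin.zero) (combination (f ∘ Fin.suc))))

  -- The coefficients that exhibit a single relation as a member of the ideal.
  basisVector : ∀ {k} → Fin k → Fin k → Poly m
  basisVector Fin.zero Fin.zero = oneP
  basisVector Fin.zero (Fin.suc j) = zeroP
  basisVector (Fin.suc i) Fin.zero = zeroP
  basisVector (Fin.suc i) (Fin.suc j) = basisVector i j

  combination-basisVector : ∀ {k} (i : Fin k) (f : Fin k → Poly m) → combination (λ j → basisVector i j *ₚ f j) ≋ f i
  combination-basisVector Fin.zero f = P.trans
    (P.+-cong (P.*-identityˡ (f Fin.zero)) (combination-0 λ j → P.zeroˡ (f (Fin.suc j)))) (P.+-identityʳ (f Fin.zero))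
  combination-basisVector (Fin.suc i) f = combination-basisVector i (f ∘ Fin.suc)

  private
    inIdeal : ∀ {p} (a : Fin m → Poly m) → p ≋ combination (λ i → a i *ₚ relK m q i) → InIdeal m q p
    inIdeal a e = a , ≋⇒≈ₚ (P.trans e (≡⇒≋ (≡.cong (sumP ∘ Vec.toList) (Vec.tabulate-∘ (λ i → a i *ₚ relK m q i) (λ i → i)))))

    fromIdeal : ∀ p ((a , _) : InIdeal m q p) → p ≋ combination (λ i → a i *ₚ relK m q i)
    fromIdeal p (a , e) = P.trans (≈ₚ⇒≋ p _ e)
      (≡⇒≋ (≡.cong (sumP ∘ Vec.toList) (≡.sym (Vec.tabulate-∘ (λ i → a i *ₚ relK m q i) (λ i → i)))))

  inIdeal-isIdeal : IsIdeal (polyRing m) (InIdeal m q)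
  inIdeal-isIdeal = record
    { I-resp = λ {x} e Ix → inIdeal (proj₁ Ix) (P.trans (P.sym e) (fromIdeal x Ix))
    ; I-0 = inIdeal (λ _ → zeroP) (P.sym (combination-0 λ i → P.zeroˡ (relK m q i)))
    ; I-+ = λ {x} {y} Ix Iy → inIdeal (λ i → proj₁ Ix i +ₚ proj₁ Iy i)
        (P.trans (P.+-cong (fromIdeal x Ix) (fromIdeal y Iy))
          (P.sym (P.trans (combination-cong λ i → P.distribʳ (relK m q i) (proj₁ Ix i) (proj₁ Iy i))
            (combination-+ (λ i → proj₁ Ix i *ₚ relK m q i) (λ i → proj₁ Iy i *ₚ relK m q i)))))
    ; I-* = λ p {x} Ix → inIdeal (λ i → p *ₚ proj₁ Ix i)
        (P.trans (P.*-congˡ {p} (fromIdeal x Ix))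
          (P.sym (P.trans (combination-cong λ i → P.*-assoc p (proj₁ Ix i) (relK m q i)) (combination-* p (λ i → proj₁ Ix i *ₚ relK m q i)))))
    }

  open IsIdeal inIdeal-isIdeal
  open Quotient (polyRing m) inIdeal-isIdeal
  private
    module Q = CommutativeRing quotient
    module Rec = Recurrence quotient
    open QuantumIntegerImages R quotient constP (≈⇒~ constP-0) (≈⇒~ P.refl)
      (λ x y → ≈⇒~ (constP-+ x y)) (λ x y → ≈⇒~ (constP-* x y))

  relK~0 : ∀ i → relK m q i ~ zeroP
  relK~0 i = ~-intro (I-resp (P.sym (P.+-identityʳ (relK m q i))) (inIdeal (basisVector i) (P.sym (combination-basisVector i (relK m q)))))

  InSpan : Poly m → Set (c ⊔ ℓ)
  InSpan p = Σ[ h ∈ Poly m ] (LAll.All (SquareFree ∘ proj₂) h × p ~ h)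

  span-~ : ∀ {p p′} → p ~ p′ → InSpan p′ → InSpan p
  span-~ e (h , sf , e′) = h , sf , Q.trans e e′

  span-≋ : ∀ {p p′} → p ≋ p′ → InSpan p′ → InSpan p
  span-≋ e = span-~ (≈⇒~ e)

  span-0 : InSpan zeroP
  span-0 = [] , [] , Q.refl

  span-+ : ∀ {p p′} → InSpan p → InSpan p′ → InSpan (p +ₚ p′)
  span-+ (h , sf , e) (h′ , sf′ , e′) = h +ₚ h′ , LAll.++⁺ sf sf′ , Q.+-cong e e′

  span-constP : ∀ a {p} → InSpan p → InSpan (constP a *ₚ p)
  span-constP a (h , sf , e) = scaleP a h , LAll.map⁺ sf , Q.trans (Q.*-congˡ {constP a} e) (≈⇒~ (P.sym (scaleP≋ a h)))

  span-monomial : ∀ {α} → SquareFree α → InSpan (monomial α)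
  span-monomial sf = monomial _ , sf ∷ [] , Q.refl

  uN-toℕ : ∀ i → uN m (suc (toℕ i)) ≡ varP i
  uN-toℕ i with toℕ i ℕ.<? m
  ... | yes i<m = ≡.cong varP (Fin.fromℕ<-toℕ i i<m)
  ... | no i≮m = contradiction (Fin.toℕ<n i) i≮m

  squareFree-unitVec-⊕ : ∀ {n} {α : Vec ℕ n} → SquareFree α → ∀ i → lookup α i ≡ 0 → SquareFree (unitVec i ⊕ α)
  squareFree-unitVec-⊕ (_∷_ {xs = α} _ sf) Fin.zero ≡.refl = s≤s z≤n ∷ ≡.subst SquareFree (≡.sym (⊕-identityˡ α)) sf
  squareFree-unitVec-⊕ (a≤1 ∷ sf) (Fin.suc i) eq = a≤1 ∷ squareFree-unitVec-⊕ sf i eq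

  unitVec-⊕-split : ∀ {n} (α : Vec ℕ n) i → lookup α i ≡ 1 → Σ[ γ ∈ Vec ℕ n ] (α ≡ unitVec i ⊕ γ)
  unitVec-⊕-split (a ∷ α) Fin.zero ≡.refl = 0 ∷ α , ≡.cong (1 ∷_) (≡.sym (⊕-identityˡ α))
  unitVec-⊕-split (a ∷ α) (Fin.suc i) eq with unitVec-⊕-split α i eq
  ... | γ , α≡ = a ∷ γ , ≡.cong (a ∷_) α≡

  lookup-≤1 : ∀ {n} {α : Vec ℕ n} → SquareFree α → ∀ i → lookup α i ≡ 0 ⊎ lookup α i ≡ 1
  lookup-≤1 (z≤n ∷ _) Fin.zero = inj₁ ≡.refl
  lookup-≤1 (s≤s z≤n ∷ _) Fin.zero = inj₂ ≡.refl
  lookup-≤1 (_ ∷ sf) (Fin.suc i) = lookup-≤1 sf i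

  module Reduction {α : Vec ℕ m} (sf : SquareFree α) where
    private M = monomial α

    Occupied : ℕ → Set
    Occupied k = Σ[ i ∈ Fin m ] (suc (toℕ i) ≡ k × lookup α i ≡ 1)

    Reducible : ℕ → Set (c ⊔ ℓ)
    Reducible k = InSpan (uN m k *ₚ M)

    -- If u_k does not divide M, the product is squarefree. The indices 0 and those above m count as
    -- reducible because u vanishes there, which is what stops the searches in both directions.
    reducible⊎occupied : ∀ k → Reducible k ⊎ Occupied k
    reducible⊎occupied zero = inj₁ span-0
    reducible⊎occupied (suc j) with j ℕ.<? m
    ... | no _ = inj₁ span-0
    ... | yes j<m with lookup-≤1 sf (Fin.fromℕ< j<m)
    ...   | inj₁ free = inj₁ (span-≋ (P.sym (monomial-⊕ (unitVec (Fin.fromℕ< j<m)) α))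
              (span-monomial (squareFree-unitVec-⊕ sf (Fin.fromℕ< j<m) free)))
    ...   | inj₂ occupied = inj₂ (Fin.fromℕ< j<m , ≡.cong suc (Fin.toℕ-fromℕ< j<m) , occupied)

    -- M is u_k times a monomial γ, where k = j+1. Multiplying the quadratic relation for u_k by γ
    -- yields a relation that is linear in the products of the generators with M.
    occupied-relation : ∀ j → Occupied (suc j) →
      ((constP q +ₚ oneP) *ₚ (uN m (suc j) *ₚ M)) ~ ((constP q *ₚ (uN m j *ₚ M)) +ₚ (uN m (suc (suc j)) *ₚ M))
    occupied-relation _ (i , ≡.refl , occupied) with unitVec-⊕-split α i occupied
    ... | γ , α≡ = Q.trans (≈⇒~ left≋) (Q.trans (Q.+-congʳ {right} (Q.trans (Q.*-congˡ {r} (relK~0 i)) (Q.zeroʳ r))) (≈⇒~ (P.+-identityˡ right)))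
      where
      k = toℕ i
      u = varP i
      u₋ = uN m k
      u₊ = uN m (suc (suc k))
      r = monomial γ
      right = (constP q *ₚ (u₋ *ₚ M)) +ₚ (u₊ *ₚ M)
      M≋ : M ≋ (u *ₚ r)
      M≋ = P.trans (≡⇒≋ (≡.cong monomial α≡)) (monomial-⊕ (unitVec i) γ)
      relK≋ : relK m q i ≋ ((((constP q +ₚ oneP) *ₚ (u *ₚ u)) -ₚ (constP q *ₚ (u *ₚ u₋))) -ₚ (u *ₚ u₊))
      relK≋ = P.+-congʳ { -ₚ (u *ₚ u₊)} (P.+-cong
        (P.trans (scaleP≋ (q + 1#) (u *ₚ u)) (P.*-congʳ {u *ₚ u} (constP-+ q 1#))) (P.-‿cong (scaleP≋ q (u *ₚ u₋))))
      left≋ : ((constP q +ₚ oneP) *ₚ (uN m (suc k) *ₚ M)) ≋ ((r *ₚ relK m q i) +ₚ right)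
      left≋ = P.trans (P.*-congˡ {constP q +ₚ oneP} (P.*-cong (≡⇒≋ (uN-toℕ i)) M≋))
        (P.trans (P.solve 5 (λ q u r a b → (q P.:+ P.con (1 , 0)) P.:* (u P.:* (u P.:* r)) P.:=
            r P.:* (((q P.:+ P.con (1 , 0)) P.:* (u P.:* u) P.:- q P.:* (u P.:* a)) P.:- u P.:* b) P.:+ (q P.:* (a P.:* (u P.:* r)) P.:+ b P.:* (u P.:* r)))
            P.refl (constP q) u r u₋ u₊)
          (P.sym (P.+-cong (P.*-congˡ {r} relK≋) (P.+-cong (P.*-congˡ {constP q} (P.*-congˡ {u₋} M≋)) (P.*-congˡ {u₊} M≋)))))

    -- Walks down from k to the first reducible index p, which is at the latest 0. All indices from
    -- p+1 to k are occupied, so the recurrence holds along the way.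
    previous-reducible : ∀ k → Occupied k →
      Σ[ p ∈ ℕ ] Σ[ s ∈ ℕ ] (k ≡ p ℕ.+ suc s × Reducible p × (∀ j → j ℕ.≤ s → Occupied (p ℕ.+ suc j)))
    previous-reducible zero (_ , () , _)
    previous-reducible (suc k) occ with reducible⊎occupied k
    ... | inj₁ red = k , 0 , ≡.sym (ℕ.+-comm k 1) , red , λ { zero z≤n → ≡.subst Occupied (≡.sym (ℕ.+-comm k 1)) occ }
    ... | inj₂ occ′ with previous-reducible k occ′
    ...   | p , s , k≡ , red , between = p , suc s , suck≡ , red , between′
      where
      suck≡ : suc k ≡ p ℕ.+ suc (suc s)
      suck≡ = ≡.trans (≡.cong suc k≡) (≡.sym (ℕ.+-suc p (suc s)))
      between′ : ∀ j → j ℕ.≤ suc s → Occupied (p ℕ.+ suc j)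
      between′ j j≤ with ℕ.m≤n⇒m<n∨m≡n j≤
      ... | inj₁ (s≤s j≤s) = between j j≤s
      ... | inj₂ ≡.refl = ≡.subst Occupied suck≡ occ

    -- The walk upwards. Occupied indices are at most m, so fuel with m ≤ k + fuel cannot run out
    -- before a reducible index appears.
    next-reducible : ∀ fuel k → m ℕ.≤ k ℕ.+ fuel → Occupied k →
      Σ[ d ∈ ℕ ] (Reducible (k ℕ.+ suc d) × (∀ j → j ℕ.≤ d → Occupied (k ℕ.+ j)))
    next-reducible fuel k m≤ occ with reducible⊎occupied (suc k)
    ... | inj₁ red = 0 , ≡.subst Reducible (≡.sym (ℕ.+-comm k 1)) red , λ { zero z≤n → ≡.subst Occupied (≡.sym (ℕ.+-identityʳ k)) occ }
    next-reducible zero k m≤ occ | inj₂ (i , ≡.refl , _) =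
      contradiction (ℕ.≤-trans m≤ (ℕ.≤-reflexive (ℕ.+-identityʳ (toℕ i)))) (ℕ.<⇒≱ (Fin.toℕ<n i))
    next-reducible (suc fuel) k m≤ occ | inj₂ occ′ with next-reducible fuel (suc k) (ℕ.≤-trans m≤ (ℕ.≤-reflexive (ℕ.+-suc k fuel))) occ′
    ... | d , red , between = suc d , ≡.subst Reducible (≡.sym (ℕ.+-suc k (suc d))) red , between′
      where
      between′ : ∀ j → j ℕ.≤ suc d → Occupied (k ℕ.+ j)
      between′ zero _ = ≡.subst Occupied (≡.sym (ℕ.+-identityʳ k)) occ
      between′ (suc j) (s≤s j≤d) = ≡.subst Occupied (≡.sym (ℕ.+-suc k j)) (between j j≤d)

    -- u_k · M interpolates between the two nearest reducible products by the recurrence that the relations impose.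
    occupied⇒reducible : ∀ k → Occupied k → Reducible k
    occupied⇒reducible k occ with previous-reducible k occ | next-reducible m k (ℕ.m≤n+m m k) occ
    ... | p , s , ≡.refl , red-p , before | d , red-r , after = span-~ y-s (span-+ red-0
        (span-constP (qint q (suc s)) (span-constP inv (span-+ red-L (span-≋ (P.solve 1 (λ x → P.:- x P.:= P.:- P.con (1 , 0) P.:* x) P.refl (y 0)) (span-constP (- 1#) red-0))))))
      where
      -- In the sequence y the indices p, k = p + s + 1 and k + d + 1 become 0, s + 1 and L.
      L = suc (suc (s ℕ.+ d))
      y : ℕ → Poly m
      y j = uN m (p ℕ.+ j) *ₚ M
      red-0 : InSpan (y 0)
      red-0 = ≡.subst Reducible (≡.sym (ℕ.+-identityʳ p)) red-p
      red-L : InSpan (y L)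
      red-L = ≡.subst Reducible (≡.trans (ℕ.+-assoc p (suc s) (suc d)) (≡.cong (λ x → p ℕ.+ suc x) (ℕ.+-suc s d))) red-r
      between : ∀ j → j ℕ.≤ s ℕ.+ d → Occupied (p ℕ.+ suc j)
      between j j≤ with j ℕ.≤? s
      ... | yes j≤s = before j j≤s
      ... | no j≰s = ≡.subst Occupied (≡.trans (ℕ.+-assoc p (suc s) (j ℕ.∸ s)) (≡.cong (λ x → p ℕ.+ suc x) (ℕ.m+[n∸m]≡n (ℕ.<⇒≤ (ℕ.≰⇒> j≰s)))))
          (after (j ℕ.∸ s) (ℕ.≤-trans (ℕ.∸-monoˡ-≤ s j≤) (ℕ.≤-reflexive (ℕ.m+n∸m≡n s d))))
      recurrent : Rec.Recurrent (constP q) y (suc (s ℕ.+ d))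
      recurrent j (s≤s j≤) = ≡.subst₂ (λ a b → ((constP q +ₚ oneP) *ₚ (uN m a *ₚ M)) ~ ((constP q *ₚ y j) +ₚ (uN m b *ₚ M)))
        (≡.sym (ℕ.+-suc p j)) (≡.sym (≡.trans (ℕ.+-suc p (suc j)) (≡.cong suc (ℕ.+-suc p j))))
        (occupied-relation (p ℕ.+ j) (≡.subst Occupied (ℕ.+-suc p j) (between j j≤)))
      solution : ∀ j → j ℕ.≤ L → y j ~ (y 0 +ₚ (constP (qint q j) *ₚ (y 1 -ₚ y 0)))
      solution j j≤L = Q.trans (Rec.recurrent-solution (constP q) y (suc (s ℕ.+ d)) recurrent j j≤L)
        (Q.+-congˡ {y 0} (Q.*-congʳ {y 1 -ₚ y 0} (qint-image q j)))
      inv = proj₁ (proj₂ isField (qint q L) (qint-nonzero q nonroot (suc (s ℕ.+ d))))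
      inverse : (constP (qint q L) *ₚ constP inv) ≋ oneP
      inverse = P.trans (P.sym (constP-* (qint q L) inv)) (constP-cong (proj₂ (proj₂ isField (qint q L) (qint-nonzero q nonroot (suc (s ℕ.+ d))))))
      slope : (y 1 -ₚ y 0) ~ (constP inv *ₚ (y L -ₚ y 0))
      slope = Q.sym (Q.trans (Q.*-congˡ {constP inv} (Q.+-congʳ { -ₚ y 0} (solution L ℕ.≤-refl)))
        (≈⇒~ (P.trans (P.solve 4 (λ c i y d → c P.:* ((y P.:+ i P.:* d) P.:- y) P.:= (i P.:* c) P.:* d) P.refl (constP inv) (constP (qint q L)) (y 0) (y 1 -ₚ y 0))
          (P.trans (P.*-congʳ {y 1 -ₚ y 0} inverse) (P.*-identityˡ (y 1 -ₚ y 0))))))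
      y-s : (uN m (p ℕ.+ suc s) *ₚ M) ~ (y 0 +ₚ (constP (qint q (suc s)) *ₚ (constP inv *ₚ (y L -ₚ y 0))))
      y-s = Q.trans (solution (suc s) (s≤s (ℕ.≤-trans (ℕ.m≤m+n s d) (ℕ.n≤1+n _)))) (Q.+-congˡ {y 0} (Q.*-congˡ {constP (qint q (suc s))} slope))

    varP-monomial : ∀ i → InSpan (varP i *ₚ M)
    varP-monomial i = ≡.subst (λ u → InSpan (u *ₚ M)) (uN-toℕ i) reducible
      where
      reducible : Reducible (suc (toℕ i))
      reducible with reducible⊎occupied (suc (toℕ i))
      ... | inj₁ red = red
      ... | inj₂ occ = occupied⇒reducible (suc (toℕ i)) occ

  term≋ : ∀ {n} a (α : Vec ℕ n) → ((a , α) ∷ []) ≋ (constP a *ₚ monomial α)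
  term≋ a α = ≋-intro λ φ → sym (trans (sym (ev-≋ (scaleP≋ a (monomial α)) φ)) (+-congʳ (*-congʳ (*-identityʳ a))))

  span-varP : ∀ i {p} → InSpan p → InSpan (varP i *ₚ p)
  span-varP i (h , sf , e) = span-~ (Q.*-congˡ {varP i} e) (terms sf)
    where
    terms : ∀ {h} → LAll.All (SquareFree ∘ proj₂) h → InSpan (varP i *ₚ h)
    terms [] = span-≋ (P.zeroʳ (varP i)) span-0
    terms {(a , α) ∷ h} (sf ∷ sfs) = span-≋ (P.trans (P.*-congˡ {varP i} (P.+-congʳ {h} (term≋ a α)))
        (P.solve 4 (λ v a M h → v P.:* (a P.:* M P.:+ h) P.:= a P.:* (v P.:* M) P.:+ v P.:* h) P.refl (varP i) (constP a) (monomial α) h))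
      (span-+ (span-constP a (Reduction.varP-monomial sf i)) (terms sfs))

  span-powP : ∀ i k {p} → InSpan p → InSpan (powP (varP i) k *ₚ p)
  span-powP i zero {p} s = span-≋ (P.*-identityˡ p) s
  span-powP i (suc k) {p} s = span-≋ (P.*-assoc (varP i) (powP (varP i) k) p) (span-varP i (span-powP i k s))

  span-Π : ∀ {k} (f : Fin k → Poly m) → (∀ i {p} → InSpan p → InSpan (f i *ₚ p)) → ∀ {p} → InSpan p → InSpan (Π f *ₚ p)
  span-Π {zero} f closed {p} s = span-≋ (P.*-identityˡ p) s
  span-Π {suc k} f closed {p} s = span-≋ (P.*-assoc (f Fin.zero) (Π (f ∘ Fin.suc)) p)
    (closed Fin.zero (span-Π (f ∘ Fin.suc) (closed ∘ Fin.suc) s))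

  squareFree-𝟎 : ∀ n → SquareFree (𝟎 {n})
  squareFree-𝟎 zero = []
  squareFree-𝟎 (suc n) = z≤n ∷ squareFree-𝟎 n

  monomial≋image : ∀ α → monomial α ≋ monomialImage varP α
  monomial≋image α = P.trans (≡⇒≋ (≡.cong monomial (≡.sym (unitVec-act-allFin α))))
    (P.trans (P.sym (monomialImage-varP (Vec.allFin m) α))
      (Π-cong λ i → powP-cong (≡⇒≋ (≡.cong varP (Vec.lookup-allFin i))) (lookup α i)))

  -- Every monomial arises from 1 by multiplying with one variable at a time, and by `span-varP` no
  -- such step leaves the span.
  span-any-monomial : ∀ α → InSpan (monomial α)
  span-any-monomial α = span-≋ (P.trans (monomial≋image α) (P.sym (P.*-identityʳ (monomialImage varP α))))
    (span-Π (λ i → powP (varP i) (lookup α i)) (λ i → span-powP i (lookup α i)) (span-monomial (squareFree-𝟎 m)))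

  spanning : ∀ p → InSpan p
  spanning [] = span-0
  spanning ((a , α) ∷ p) = span-≋ (P.+-congʳ {p} (term≋ a α)) (span-+ (span-constP a (span-any-monomial α)) (spanning p))

  coeff-absent : ∀ {n} {α : Vec ℕ n} {p} → LAll.All (λ t → ¬ (proj₂ t ≡ α)) p → coeff p α ≈ 0#
  coeff-absent {α = α} {p} absent = trans (coeff-ev p α) (ev-vanishing-All (λ β → χ-≢) absent)

  without-≢ : ∀ {n} (α : Vec ℕ n) p → LAll.All (λ t → ¬ (proj₂ t ≡ α)) (without α p)
  without-≢ α [] = []
  without-≢ α ((a , β) ∷ p) with Vec.≡-dec ℕ._≟_ β α
  ... | yes _ = without-≢ α p
  ... | no β≢α = β≢α ∷ without-≢ α p

  without-All : ∀ {n} {A : Vec ℕ n → Set} (α : Vec ℕ n) {p} → LAll.All (A ∘ proj₂) p → LAll.All (A ∘ proj₂) (without α p)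
  without-All α [] = []
  without-All α {(a , β) ∷ p} (Aβ ∷ Ap) with Vec.≡-dec ℕ._≟_ β α
  ... | yes _ = without-All α Ap
  ... | no _ = Aβ ∷ without-All α Ap

  -- The squarefree representative h may list the full monomial several times. Its total coefficient
  -- becomes t, and `without` removes all of these terms from the remainder.
  top-exists : ∀ f → Σ[ t ∈ K ] IsTop m q f t
  top-exists f with spanning (rho m f)
  ... | h , sf , ρ~h = coeff h full , without full h , vanish , I-resp (P.+-congˡ {rho m f} (P.-‿cong h≋)) (~-elim ρ~h)
    where
    full = fullMono m
    vanish : ∀ α → ¬ SquareFree α ⊎ α ≡ full → coeff (without full h) α ≈ 0#
    vanish α (inj₁ ¬sf) = coeff-absent (LAll.map (λ {t} sf-t eq → ¬sf (≡.subst SquareFree eq sf-t)) (without-All full sf))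
    vanish α (inj₂ ≡.refl) = coeff-absent (without-≢ full h)
    h≋ : h ≋ (((coeff h full , full) ∷ []) +ₚ without full h)
    h≋ = ≋-intro λ φ → ev-without φ full h

theorem4p11 : ∀ {c ℓ} (R : CommutativeRing c ℓ) → PolyOps.IsField R → PolyOps.CharZero R
    → (q : CommutativeRing.Carrier R) → PolyOps.NotNontrivialRootOfUnity R q
    → (m : ℕ) → (f : PolyOps.Poly R (suc m)) → PolyOps.HasDegree R f m
    → (Σ[ t ∈ CommutativeRing.Carrier R ] PolyOps.IsTop R m q f t)
    × (∀ t → PolyOps.IsTop R m q f t
    → PolyOps.DividedSymm R (suc m) q f (PolyOps.constP R (CommutativeRing._*_ R (PolyOps.qfact R q m) t)))
theorem4p11 R isField charZero q nonroot m f (bounded , _) = top-exists f , dividedSymm-top f bounded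
  where
  open Spanning R isField charZero q nonroot m
  open CriticalQuotient R (QuantumIntegers.torsion-free R isField charZero) q m
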